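{- Let $n\ge0$ and let $\sigma,\tau\in\mathrm{Typ}(n)$ be types of $n$. (1) The coefficient of $H_\tau$ in the expansion of $P_\sigma$ in the basis $\{H_\rho:\rho\in\mathrm{Typ}(n)\}$ is $\sum_{T\in\mathcal{PT}^{\mathrm{simp}}(\sigma,\tau)}(-1)^{\ell(\tau)-\ell(\sigma)}\,\mathfrak{L}(T)$. (2) The coefficient of $E_\tau$ in the expansion of $P_\sigma$ in the basis $\{E_\rho:\rho\in\mathrm{Typ}(n)\}$ is $\sum_{T\in\mathcal{PT}^{\mathrm{simp}}(\sigma,\tau)}(-1)^{\ell(\tau)}\,\mathfrak{L}(T)$.
   Context: A type of $n$ is a sequence $\tau=(\tau|^1,\tau|^2,\dots)$ of (possibly empty) integer partitions with $\sum_{i\ge1} i\,|\tau|^i|=n$, where $|\tau|^i|$ is the size of the partition $\tau|^i$; $\mathrm{Typ}(n)$ is the set of types of $n$. Its length is $\ell(\tau)=\sum_i\ell(\tau|^i)$, the total number of parts. Each part $d$ of $\tau|^r$ gives a block $d^r$ of $\tau$ (degree $d$, multiplicity $r$; not exponentiation). Let $x_{i,j}$ ($i,j\ge 1$) be indeterminates with $\deg x_{i,j}=i$; all series have rational coefficients. A monomial is square-free if every exponent is at most $1$. $H_d$ is the sum of all monomials of degree $d$; $E_d$ is the sum over square-free monomials $f$ of degree $d$ of $(-1)^{m(f)}f$, where $m(f)$ is the number of indeterminates in $f$; for $d\ge1$, $P_d=\sum_{k\mid d}\sum_{j\ge1}k\,x_{k,j}^{d/k}$. For $F\in\{H,E,P\}$,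 $F_{d^r}$ is obtained from $F_d$ by replacing each $x_{i,j}$ by $x_{i,j}^r$, and $F_\tau=\prod F_{d^r}$ over all blocks $d^r$ of $\tau$ (counted with repetition; empty product $=1$). It is known that $\{F_\tau\}_{\tau\in\mathrm{Typ}(n)}$ is, for each such $F$, a $\mathbb{Q}$-basis of the space $\mathrm{PSym}(n)$ of polysymmetric functions of degree $n$ (power series homogeneous of degree $n$ that are symmetric separately in each variable set $\{x_{i,j}\}_{j\ge1}$). The diagram of a partition $\lambda$ has left-justified rows of $\lambda_1,\lambda_2,\dots$ cells. A brick is a nonempty set of consecutive cells in one row; its length is its number of cells. A brick tabloid of shape $\lambda$ and content $\mu$ ($\lambda,\mu$ partitions) is a decomposition of the diagram of $\lambda$ into disjoint bricks whose multiset of lengths is the multiset of parts of $\mu$. A simple polybrick tabloid of shape $\sigma$ and content $\tau$ is a sequence $T=(T_i)_{i\ge1}$ where $T_i$ is a brick tabloid of shape $\sigma|^i$ and content $\tau|^i$ for each $i$. $\mathcal{PT}^{\mathrm{simp}}(\sigma,\tau)$ is the set of these. For $T$ in it, $\mathfrak{L}(T)$ is the product, over all rows of all $T_i$, of the length of the last (rightmost) brick in that row. -}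

module Defs where

open import Data.Bool.Base using (if_then_else_)
open import Data.Fin.Base using (Fin; toℕ)
open import Data.Integer.Base as ℤ using (ℤ; +_)
open import Data.Irrelevant using ([_])
open import Data.List.Base as List
  using (List; []; _∷_; _++_; length; foldr; concat; concatMap; cartesianProductWith; deduplicate; upTo; allFin)
import Data.List.Properties as List
open import Data.List.Membership.Propositional using (_∈_)
open import Data.List.Membership.Propositional.Properties
open import Data.List.Relation.Binary.Permutation.Propositional using (_↭_; prep; ↭-refl; ↭-sym; ↭-trans)
open import Data.List.Relation.Binary.Permutation.Propositional.Properties
  using (shift; drop-∷; ∈-resp-↭; ¬x∷xs↭[])
open import Data.List.Relation.Unary.All as All using (All; []; _∷_)
open import Data.List.Relation.Unary.Any using (here; there)
open import Data.List.Relation.Unary.Linked using (Linked; linked?)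
open import Data.List.Relation.Unary.Unique.Propositional using (Unique; []; _∷_)
import Data.List.Relation.Unary.Unique.Propositional.Properties as Unique
open import Data.Nat.Base as ℕ using (ℕ; zero; suc; _+_; _*_; _∸_; _≤_; _<_; _≥_; NonZero; z≤n; s≤s; _/_)
open import Data.Nat.Divisibility using (_∣?_)
open import Data.Nat.ListAction using (sum; product)
import Data.Nat.Properties as ℕ
open import Data.Product.Base as Product using (_×_; _,_; proj₁; proj₂; ∃)
open import Data.Rational.Base as ℚ using (ℚ; 0ℚ; 1ℚ)
open import Data.Refinement as Refinement using (Refinement-syntax; _,_; value)
open import Data.Vec.Base as Vec using (Vec; []; _∷_; lookup)
import Data.Vec.Properties as Vec
open import Data.Vec.Relation.Binary.Pointwise.Inductive using (Pointwise; []; _∷_)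
import Data.Vec.Relation.Unary.All as VecAll
open import Function.Base using (_∘_)
open import Level using (Level)
open import Relation.Binary.Definitions using (DecidableEquality)
open import Relation.Binary.PropositionalEquality
  using (_≡_; refl; sym; cong; subst)
open import Relation.Nullary using (Dec; yes; no; does; contradiction; recompute)
open import Relation.Nullary.Decidable using (map′; _×-dec_)
open import Relation.Unary using (Pred; Decidable)

private
  variable
    a p : Level
    A : Set a
    n : ℕ

record Finite (A : Set a) : Set a where
  field
    elements : List A
    complete : ∀ x → x ∈ elements
    unique   : Unique elements

open Finite public

∑ : List A → (A → ℚ) → ℚ
∑ xs f = foldr ℚ._+_ 0ℚ (List.map f xs)

syntax ∑ xs (λ x → e) = ∑[ x ∈ xs ] e

module _ {A : Set a} {P : Pred A p} (P? : Decidable P) where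

  select : List A → List [ x ∈ A ∣ P x ]
  select []       = []
  select (x ∷ xs) with P? x
  ... | yes px = (x , [ px ]) ∷ select xs
  ... | no  _  = select xs

  ∈-select⁺ : ∀ {xs} (x : [ x ∈ A ∣ P x ]) → value x ∈ xs → x ∈ select xs
  ∈-select⁺ {y ∷ ys} (x , [ px ]) (here refl) with P? x
  ... | yes _  = here refl
  ... | no ¬px = contradiction (recompute (P? x) px) ¬px
  ∈-select⁺ {y ∷ ys} x (there x∈ys) with P? y
  ... | yes _ = there (∈-select⁺ x x∈ys)
  ... | no  _ = ∈-select⁺ x x∈ys

  value-select : ∀ xs → List.map value (select xs) ≡ List.filter P? xs
  value-select []       = refl
  value-select (x ∷ xs) with P? x
  ... | yes _ = cong (x ∷_) (value-select xs)
  ... | no  _ = value-select xs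

  finite-refinement : DecidableEquality A → (xs : List A) → (∀ {x} → P x → x ∈ xs) →
                      Finite [ x ∈ A ∣ P x ]
  finite-refinement _≟_ xs all-in = record
    { elements = select (deduplicate _≟_ xs)
    ; complete = λ { x@(y , [ py ]) →
        ∈-select⁺ x (∈-deduplicate⁺ _≟_ (all-in (recompute (P? y) py))) }
    ; unique   = Unique.map⁻ (subst Unique (sym (value-select (deduplicate _≟_ xs)))
                   (Unique.filter⁺ P? (deduplicate-! xs)))
    }
    where open import Data.List.Relation.Unary.Unique.DecPropositional.Properties _≟_
            using (deduplicate-!)

grow : List ℕ → List (List ℕ)
grow []       = (1 ∷ []) ∷ []
grow (b ∷ bs) = (1 ∷ b ∷ bs) ∷ (suc b ∷ bs) ∷ []

-- All sequences with positive entries and sum n.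
compositions : ℕ → List (List ℕ)
compositions zero    = [] ∷ []
compositions (suc n) = concatMap grow (compositions n)

∈-compositions : ∀ {n} bs → All (0 <_) bs → sum bs ≡ n → bs ∈ compositions n
∈-compositions [] [] refl = here refl
∈-compositions (suc zero ∷ bs) (_ ∷ bs>0) refl =
  ∈-concat⁺′ (1∷bs∈grow bs) (∈-map⁺ _ (∈-compositions bs bs>0 refl))
  where
  1∷bs∈grow : ∀ bs → (1 ∷ bs) ∈ grow bs
  1∷bs∈grow []      = here refl
  1∷bs∈grow (_ ∷ _) = here refl
∈-compositions (suc (suc b) ∷ bs) (_ ∷ bs>0) refl =
  ∈-concat⁺′ (there (here refl)) (∈-map⁺ _ (∈-compositions (suc b ∷ bs) (s≤s z≤n ∷ bs>0) refl))

vectors : List A → ∀ n → List (Vec A n)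
vectors xs zero    = [] ∷ []
vectors xs (suc n) = cartesianProductWith _∷_ xs (vectors xs n)

∈-vectors : {xs : List A} (v : Vec A n) → (∀ i → lookup v i ∈ xs) → v ∈ vectors xs n
∈-vectors []      _  = here refl
∈-vectors (x ∷ v) v∈ =
  ∈-cartesianProductWith⁺ _∷_ (v∈ Fin.zero) (∈-vectors v (v∈ ∘ Fin.suc))

infix 4 _↭?_
_↭?_ : (xs ys : List ℕ) → Dec (xs ↭ ys)
[]       ↭? []       = yes ↭-refl
[]       ↭? (y ∷ ys) = no (¬x∷xs↭[] ∘ ↭-sym)
(x ∷ xs) ↭? ys with x ∈? ys
  where open import Data.List.Membership.DecPropositional ℕ._≟_ using (_∈?_)
... | no  x∉ys = no λ x∷xs↭ys → x∉ys (∈-resp-↭ x∷xs↭ys (here refl))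
... | yes x∈ys with ∈-∃++ x∈ys
...   | as , bs , refl = map′
        (λ xs↭ → ↭-trans (prep x xs↭) (↭-sym (shift x as bs)))
        (λ x∷xs↭ → drop-∷ (↭-trans x∷xs↭ (shift x as bs)))
        (xs ↭? as ++ bs)

IsPartition : List ℕ → Set
IsPartition ds = All (0 <_) ds × Linked _≥_ ds

isPartition? : Decidable IsPartition
isPartition? ds = All.all? (0 ℕ.<?_) ds ×-dec linked? ℕ._≥?_ ds

Partition : Set
Partition = [ ds ∈ List ℕ ∣ IsPartition ds ]

parts : Partition → List ℕ
parts = value

size : Partition → ℕ
size = sum ∘ parts

_≟ᴾ_ : DecidableEquality Partition
_≟ᴾ_ = Refinement._≟_ (List.≡-dec ℕ._≟_)

-- The partition at position i : Fin n is the one of index suc (toℕ i).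
weight : Vec Partition n → ℕ
weight {n} τ = sum (List.map (λ i → suc (toℕ i) * size (lookup τ i)) (allFin n))

-- In a type of n all partitions of index greater than n are empty, so
-- that only the indices 1, …, n are recorded.
Typ : ℕ → Set
Typ n = [ τ ∈ Vec Partition n ∣ weight τ ≡ n ]

infix 8 _∣^_
_∣^_ : Typ n → Fin n → Partition
τ ∣^ i = lookup (value τ) i

ℓ : Typ n → ℕ
ℓ {n} τ = sum (List.map (λ i → length (parts (τ ∣^ i))) (allFin n))

partitionsUpTo : ℕ → List Partition
partitionsUpTo n = select isPartition? (concatMap compositions (upTo (suc n)))

∈-partitionsUpTo : (λ′ : Partition) → size λ′ ≤ n → λ′ ∈ partitionsUpTo n
∈-partitionsUpTo λ′@(ds , [ isP ]) size≤n = ∈-select⁺ isPartition? λ′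
  (∈-concat⁺′ (∈-compositions ds (proj₁ (recompute (isPartition? ds) isP)) refl)
              (∈-map⁺ compositions (∈-upTo⁺ (s≤s size≤n))))

finite-Typ : ∀ n → Finite (Typ n)
finite-Typ n = finite-refinement (λ τ → weight τ ℕ.≟ n) (Vec.≡-dec _≟ᴾ_)
  (vectors (partitionsUpTo n) n)
  (λ {τ} weight≡n → ∈-vectors τ λ i → ∈-partitionsUpTo (lookup τ i)
    (ℕ.≤-trans (size≤weight τ i) (ℕ.≤-reflexive weight≡n)))
  where
  ≤-sum : ∀ {x} {xs : List ℕ} → x ∈ xs → x ≤ sum xs
  ≤-sum {xs = x ∷ xs} (here refl)  = ℕ.m≤m+n x (sum xs)
  ≤-sum {xs = x ∷ xs} (there x∈xs) = ℕ.≤-trans (≤-sum x∈xs) (ℕ.m≤n+m (sum xs) x)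

  size≤weight : (τ : Vec Partition n) (i : Fin n) → size (lookup τ i) ≤ weight τ
  size≤weight τ i = ℕ.≤-trans (ℕ.m≤m+n _ (toℕ i * size (lookup τ i)))
    (≤-sum (∈-map⁺ (λ i → suc (toℕ i) * size (lookup τ i)) (∈-allFin i)))

types : ∀ n → List (Typ n)
types n = elements (finite-Typ n)

-- A decomposition of a row of cells into bricks is the list of their
-- lengths from left to right; a tabloid is the list of its rows.
IsBrickTabloid : Partition → Partition → List (List ℕ) → Set
IsBrickTabloid lam mu rows =
  All (All (0 <_)) rows × List.map sum rows ≡ parts lam × concat rows ↭ parts mu

isBrickTabloid? : ∀ lam mu → Decidable (IsBrickTabloid lam mu)
isBrickTabloid? lam mu rows =
  All.all? (All.all? (0 ℕ.<?_)) rows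
  ×-dec List.≡-dec ℕ._≟_ (List.map sum rows) (parts lam)
  ×-dec concat rows ↭? parts mu

BrickTabloid : (shape content : Partition) → Set
BrickTabloid lam mu = [ rows ∈ List (List ℕ) ∣ IsBrickTabloid lam mu rows ]

decompositions : List ℕ → List (List (List ℕ))
decompositions []       = [] ∷ []
decompositions (r ∷ rs) = cartesianProductWith _∷_ (compositions r) (decompositions rs)

∈-decompositions : ∀ {rs} rows → All (All (0 <_)) rows → List.map sum rows ≡ rs →
                   rows ∈ decompositions rs
∈-decompositions []           []            refl = here refl
∈-decompositions (row ∷ rows) (row>0 ∷ rows>0) refl =
  ∈-cartesianProductWith⁺ _∷_ (∈-compositions row row>0 refl) (∈-decompositions rows rows>0 refl)

finite-BrickTabloid : ∀ lam mu → Finite (BrickTabloid lam mu)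
finite-BrickTabloid lam mu = finite-refinement (isBrickTabloid? lam mu)
  (List.≡-dec (List.≡-dec ℕ._≟_)) (decompositions (parts lam))
  (λ { {rows} (rows>0 , sums , _) → ∈-decompositions rows rows>0 sums })

SimplePolybrickTabloid : (shape content : Typ n) → Set
SimplePolybrickTabloid σ τ = Pointwise BrickTabloid (value σ) (value τ)

finite-Pointwise : ∀ {k} (lams mus : Vec Partition k) → Finite (Pointwise BrickTabloid lams mus)
finite-Pointwise [] [] = record
  { elements = [] ∷ []
  ; complete = λ { [] → here refl }
  ; unique   = [] ∷ []
  }
finite-Pointwise (lam ∷ lams) (mu ∷ mus) = record
  { elements = cartesianProductWith _∷_ (elements fin) (elements fins)
  ; complete = λ { (T ∷ Ts) →
      ∈-cartesianProductWith⁺ _∷_ (complete fin T) (complete fins Ts) }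
  ; unique   = Unique.cartesianProductWith⁺ _∷_ (λ { refl → refl , refl })
                 (unique fin) (unique fins)
  }
  where
  fin  = finite-BrickTabloid lam mu
  fins = finite-Pointwise lams mus

𝒫𝒯ˢⁱᵐᵖ : (σ τ : Typ n) → List (SimplePolybrickTabloid σ τ)
𝒫𝒯ˢⁱᵐᵖ σ τ = elements (finite-Pointwise (value σ) (value τ))

-- The first equation is never used, as the rows of a partition are nonempty.
lastBrick : List ℕ → ℕ
lastBrick []           = 0
lastBrick (b ∷ [])     = b
lastBrick (_ ∷ b ∷ bs) = lastBrick (b ∷ bs)

𝔏 : ∀ {lams mus : Vec Partition n} → Pointwise BrickTabloid lams mus → ℕ
𝔏 []       = 1
𝔏 (T ∷ Ts) = product (List.map lastBrick (value T)) * 𝔏 Ts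

-- A monomial in the indeterminates x_{i,j} with 1 ≤ i ≤ I and 1 ≤ j ≤ J,
-- given by its exponents; the entry at (i , j) : Fin I × Fin J is the
-- exponent of x_{1+i,1+j}.  Every monomial in the x_{i,j} with i, j ≥ 1
-- is of this form for suitable I and J.
Monomial : ℕ → ℕ → Set
Monomial I J = Vec (Vec ℕ J) I

private
  variable
    I J : ℕ

deg : Monomial I J → ℕ
deg {I} m = sum (List.map (λ i → suc (toℕ i) * Vec.sum (lookup m i)) (allFin I))

SquareFree : Monomial I J → Set
SquareFree = VecAll.All (VecAll.All (_≤ 1))

squareFree? : Decidable (SquareFree {I} {J})
squareFree? = VecAll.all? (VecAll.all? (ℕ._≤? 1))

#indeterminates : Monomial I J → ℕ
#indeterminates m = Vec.sum (Vec.map (Vec.count (0 ℕ.<?_)) m)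

x[_,_]^_ : Fin I → Fin J → ℕ → Monomial I J
x[_,_]^_ {I} {J} i j e = Vec.replicate I (Vec.replicate J 0) Vec.[ i ]%= (Vec._[ j ]≔ e)

_≟ᴹ_ : DecidableEquality (Monomial I J)
_≟ᴹ_ = Vec.≡-dec (Vec.≡-dec ℕ._≟_)

splitVec : (A → List (A × A)) → Vec A n → List (Vec A n × Vec A n)
splitVec split []      = ([] , []) ∷ []
splitVec split (x ∷ v) =
  cartesianProductWith (Product.zip _∷_ _∷_) (split x) (splitVec split v)

-- All pairs of monomials with product m.
factorizations : Monomial I J → List (Monomial I J × Monomial I J)
factorizations = splitVec (splitVec λ e → List.map (λ k → k , e ∸ k) (upTo (suc e)))

fromℕ : ℕ → ℚ
fromℕ k = + k ℚ./ 1

alternating : ℕ → ℚ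
alternating zero    = 1ℚ
alternating (suc k) = ℚ.- alternating k

infix 8 -1^_
-1^_ : ℤ → ℚ
-1^ z = alternating ℤ.∣ z ∣

-- The coefficient of a monomial is given for each of its presentations
-- with bounds I and J on the indices.
record Series : Set where
  field coeff : ∀ {I J} → Monomial I J → ℚ

open Series public

infix 4 _≈_
_≈_ : Series → Series → Set
f ≈ g = ∀ {I J} (m : Monomial I J) → coeff f m ≡ coeff g m

𝟙 : Series
coeff 𝟙 m = if does (deg m ℕ.≟ 0) then 1ℚ else 0ℚ

infixl 7 _⊛_
_⊛_ : Series → Series → Series
coeff (f ⊛ g) m = ∑[ kl ∈ factorizations m ] (coeff f (proj₁ kl) ℚ.* coeff g (proj₂ kl))

-- f with every x_{i,j} replaced by x_{i,j}^r.
infix 9 _[x^_]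
_[x^_] : Series → (r : ℕ) .{{_ : NonZero r}} → Series
coeff (f [x^ r ]) m =
  if does (VecAll.all? (VecAll.all? (r ∣?_)) m)
  then coeff f (Vec.map (Vec.map (_/ r)) m)
  else 0ℚ

H : ℕ → Series
coeff (H d) m = if does (deg m ℕ.≟ d) then 1ℚ else 0ℚ

E : ℕ → Series
coeff (E d) m =
  if does (squareFree? m ×-dec (deg m ℕ.≟ d)) then -1^ (+ #indeterminates m) else 0ℚ

-- Only meant for d ≥ 1.  For k ∣ d the exponent d / k is then positive,
-- hence x_{k,j}^{d/k} with k > I or j > J is no monomial of bounds I and J.
P : ℕ → Series
coeff (P d) {I} {J} m =
  ∑[ i ∈ List.filter (λ i → suc (toℕ i) ∣? d) (allFin I) ]
  ∑[ j ∈ allFin J ]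
    (if does (m ≟ᴹ (x[ i , j ]^ (d / suc (toℕ i)))) then fromℕ (suc (toℕ i)) else 0ℚ)

infix 9 _⟨_⟩
_⟨_⟩ : (ℕ → Series) → Typ n → Series
_⟨_⟩ {n} F τ = foldr _⊛_ 𝟙
  (concatMap (λ i → List.map (λ d → F d [x^ suc (toℕ i) ]) (parts (τ ∣^ i))) (allFin n))

linearCombination : (ℕ → Series) → (Typ n → ℚ) → Series
coeff (linearCombination {n} F c) m = ∑[ ρ ∈ types n ] (c ρ ℚ.* coeff (F ⟨ ρ ⟩) m)

-- f is a linear combination of the F ⟨ ρ ⟩, and in every such linear
-- combination the coefficient of F ⟨ τ ⟩ is q.
record HasCoefficient (F : ℕ → Series) (f : Series) (τ : Typ n) (q : ℚ) : Set where
  field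
    expansion : ∃ λ (c : Typ n → ℚ) → f ≈ linearCombination F c × c τ ≡ q
    unique    : ∀ (c : Typ n → ℚ) → f ≈ linearCombination F c → c τ ≡ q

{-# OPTIONS --safe #-}

-- Dropping the grading, H = ∑ H_d and E = ∑ E_d are products over all indeterminates x_{i,j}
-- of a series u(x_{i,j}) in one variable, so that the Euler derivation (which multiplies f of
-- degree d by d) acts on them as the multiplication by ε P, where ε = 1 for H and ε = -1 for E.
-- Taking components gives Newton's identities ε d F_d = ∑ P_k F_{d-k}, and iterating them
-- expresses P_d as the sum over the compositions b of d of (-ε) (-1)^{ℓ(b)} last(b) ∏ F_{b_i}.
-- Choosing a composition for each row of the diagrams of σ is choosing a polybrick tabloid.
--
-- For the uniqueness of the coefficients, the F_τ are linearly independent: among the monomials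
-- of F_{d^r}, the x_{d,j}^r are those that maximise a measure V which is subadditive, and strictly
-- so for monomials with a common indeterminate.  Hence a monomial that is a product of powers
-- x_{d,j}^r of distinct indeterminates, one for each block d^r of ρ, occurs in F_ρ with a nonzero
-- coefficient, and in F_τ for τ ≠ ρ only if V(ρ) < V(τ).
module Submission where

open import Defs
open import Algebra.Bundles using (CommutativeMonoid; CommutativeRing)
import Algebra.Properties.CommutativeSemigroup as CommutativeSemigroupProperties
import Algebra.Properties.Ring as RingProperties
open import Data.Bool.Base using (Bool; true; false; if_then_else_; _∧_; not; T)
open import Data.Bool.Properties using (∧-comm; ∧-zeroʳ)
open import Data.Fin.Base using (Fin; toℕ)
open import Data.Integer.Base as ℤ using (_⊖_)
import Data.Integer.Properties as ℤ
open import Data.Irrelevant using ([_])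
open import Data.List.Base as List using (List; []; _∷_; _++_; allFin; cartesianProductWith; concat; concatMap; deduplicate; foldr; length; upTo)
open import Data.List.Membership.Propositional using (_∈_)
open import Data.List.Membership.Propositional.Properties using (∈-cartesianProductWith⁺; ∈-cartesianProductWith⁻; ∈-deduplicate⁺; ∈-deduplicate⁻; ∈-filter⁺; ∈-filter⁻; ∈-map⁺; ∈-map⁻; ∈-upTo⁺; ∈-upTo⁻; ∈-∃++)
open import Data.List.Membership.Propositional.Properties.WithK using (unique∧set⇒bag)
import Data.List.Properties as List
open import Data.List.Relation.Binary.BagAndSetEquality using (∼bag⇒↭)
open import Data.List.Relation.Binary.Disjoint.Propositional using (Disjoint)
import Data.List.Relation.Binary.Permutation.Homogeneous as Homogeneous
open import Data.List.Relation.Binary.Permutation.Propositional using (_↭_; prep; ↭-refl; ↭-sym; ↭-trans; ↭⇒↭ₛ)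
import Data.List.Relation.Binary.Permutation.Propositional.Properties as Perm
open import Data.List.Relation.Binary.Permutation.Setoid.Properties using (foldr-commMonoid)
import Data.List.Relation.Binary.Pointwise as ListPointwise
open import Data.List.Relation.Unary.All as All using (All; []; _∷_)
import Data.List.Relation.Unary.All.Properties as All
open import Data.List.Relation.Unary.AllPairs as AllPairs using (AllPairs)
import Data.List.Relation.Unary.AllPairs.Properties as AllPairs
open import Data.List.Relation.Unary.Any using (here; there)
open import Data.List.Relation.Unary.Linked using (Linked)
open import Data.List.Relation.Unary.Sorted.TotalOrder.Properties using (↗↭↗⇒≋)
open import Data.List.Relation.Unary.Unique.Propositional using (Unique; []; _∷_)
import Data.List.Relation.Unary.Unique.Propositional.Properties as Unique
open import Data.Nat.Base as ℕ using (ℕ; zero; suc; _≤_; _<_; _≥_; z≤n; s≤s; _∸_; _/_; NonZero)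
open import Data.Nat.Divisibility using (_∣_; _∣?_; _∣0; divides; divides-refl; m∣m*n; ∣m∸n∣n⇒∣m; ∣⇒≤)
open import Data.Nat.DivMod using (m*n/n≡m; m/n*n≡m; m*[n/m]≡n; m≥n⇒m/n>0)
open import Data.Nat.ListAction using (sum; product)
open import Data.Nat.ListAction.Properties using (sum-++; sum-↭)
import Data.Nat.Properties as ℕ
open import Data.Nat.Tactic.RingSolver using (solve-∀)
open import Data.Product.Base as Product using (_×_; _,_; proj₁; proj₂; ∃; ∃₂)
open import Data.Rational.Base as ℚ using (ℚ; 0ℚ; 1ℚ; _+_; _*_; -_)
import Data.Rational.Properties as ℚ
open import Data.Rational.Unnormalised.Base as ℚᵘ using (mkℚᵘ; *≡*)
import Data.Rational.Unnormalised.Properties as ℚᵘ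
open import Data.Refinement as Refinement using (value; _,_; value-injective)
open import Data.Sum.Base using (_⊎_; inj₁; inj₂)
open import Data.Unit.Base using (tt)
open import Data.Vec.Base as Vec using (Vec; []; _∷_; lookup)
import Data.Vec.Properties as Vec
open import Data.Vec.Relation.Binary.Pointwise.Inductive using (Pointwise; []; _∷_)
import Data.Vec.Relation.Unary.All as VecAll
open import Function.Base using (_∘_; id; _on_)
open import Function.Bundles using (mk⇔)
open import Level using (Level; 0ℓ)
open import Relation.Binary.Bundles using (DecTotalOrder)
import Relation.Binary.Properties.DecTotalOrder as DecTotalOrderProperties
open import Relation.Binary.PropositionalEquality hiding (J; [_])
open import Relation.Binary.Structures using (IsEquivalence)
open import Relation.Nullary using (Dec; yes; no; does; ¬_; contradiction; recompute)
open import Relation.Nullary.Decidable using (dec-true; dec-false; _×-dec_)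
open import Relation.Unary using (Pred; Decidable)

-- Linear independence needs a leading monomial for each type. The function ∑ (i - 1) i e over the
-- factors x_{i,j}^e, restricted to monomials of degree d, is largest exactly at the x_{d,j},
-- because t ↦ (t - 1) t is strictly superadditive, and a dilation by r multiplies it by r. It
-- cannot tell x_{d,j}^(r+s) from x_{d,j}^r x_{d,k}^s, hence not the block d^(r+s) from the pair
-- d^r, d^s. Therefore V adds the number of indeterminates, as a tie-breaker too small to overturn
-- the first term within a block. The other danger is cancellation: a leading monomial may arise
-- from several factorizations, and the coefficients of E have signs. But each extremal factor
-- x_{d,j}^r has the same coefficient u_1 = ε, and ε² = 1; after multiplication by ε^ℓ(ρ) all
-- contributions are nonnegative, and one positive contribution suffices, without counting them.
-- Multisets of blocks are compared through the sums of arbitrary test functions: equality of all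
-- these sums passes to products of coprime monomials and specialises to the degree, to V and to
-- counts of powers.

private
  variable
    a b c′ p : Level
    A : Set a
    B : Set b
    C : Set c′
    n I J : ℕ

-- Finite sums

module ℕ+ = CommutativeSemigroupProperties ℕ.+-commutativeSemigroup
module ℚ+ = CommutativeSemigroupProperties (CommutativeMonoid.commutativeSemigroup ℚ.+-0-commutativeMonoid)
module ℚ* = CommutativeSemigroupProperties (CommutativeMonoid.commutativeSemigroup ℚ.*-1-commutativeMonoid)

-- This is by definition the conditional in the coefficients of `𝟙`, `H`, `E`, `P` and of dilations,
-- so all of these are guards without any rewriting.
guard : Bool → ℚ → ℚ
guard b q = if b then q else 0ℚ

guard-0 : ∀ b → guard b 0ℚ ≡ 0ℚ
guard-0 true  = refl
guard-0 false = refl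

guard-*ˡ : ∀ b p q → guard b p * q ≡ guard b (p * q)
guard-*ˡ true  p q = refl
guard-*ˡ false p q = ℚ.*-zeroˡ q

guard-*ʳ : ∀ b p q → p * guard b q ≡ guard b (p * q)
guard-*ʳ true  p q = refl
guard-*ʳ false p q = ℚ.*-zeroʳ p

guard-* : ∀ b c p q → guard b p * guard c q ≡ guard (b ∧ c) (p * q)
guard-* true  c p q = guard-*ʳ c p q
guard-* false c p q = ℚ.*-zeroˡ (guard c q)

guard-∧ : ∀ b c q → guard b (guard c q) ≡ guard (b ∧ c) q
guard-∧ true  c q = refl
guard-∧ false c q = refl

guard-yes : ∀ {P : Set p} (P? : Dec P) {q} → P → guard (does P?) q ≡ q
guard-yes P? {q} px = cong (λ b → guard b q) (dec-true P? px)

guard-no : ∀ {P : Set p} (P? : Dec P) {q} → ¬ P → guard (does P?) q ≡ 0ℚ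
guard-no P? {q} ¬px = cong (λ b → guard b q) (dec-false P? ¬px)

guard-⇔ : ∀ {p′} {P : Set p} {Q : Set p′} (P? : Dec P) (Q? : Dec Q) → (P → Q) → (Q → P) →
          ∀ q → guard (does P?) q ≡ guard (does Q?) q
guard-⇔ P? (yes y) f g q = guard-yes P? (g y)
guard-⇔ P? (no ¬y) f g q = guard-no P? (¬y ∘ f)

guard-cong : ∀ {P : Set p} (P? : Dec P) {q r} → (P → q ≡ r) → guard (does P?) q ≡ guard (does P?) r
guard-cong (yes px) q≡r = q≡r px
guard-cong (no _)   q≡r = refl

∑-cong : ∀ (xs : List A) {f g : A → ℚ} → (∀ x → f x ≡ g x) → ∑ xs f ≡ ∑ xs g
∑-cong []       f≗g = refl
∑-cong (x ∷ xs) f≗g = cong₂ _+_ (f≗g x) (∑-cong xs f≗g)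

∑-cong-All : ∀ {xs : List A} {f g : A → ℚ} → All (λ x → f x ≡ g x) xs → ∑ xs f ≡ ∑ xs g
∑-cong-All []         = refl
∑-cong-All (eq ∷ eqs) = cong₂ _+_ eq (∑-cong-All eqs)

∑-0 : ∀ (xs : List A) → ∑[ x ∈ xs ] 0ℚ ≡ 0ℚ
∑-0 []       = refl
∑-0 (x ∷ xs) = trans (ℚ.+-identityˡ _) (∑-0 xs)

∑-++ : ∀ (xs ys : List A) (f : A → ℚ) → ∑ (xs ++ ys) f ≡ ∑ xs f + ∑ ys f
∑-++ []       ys f = sym (ℚ.+-identityˡ _)
∑-++ (x ∷ xs) ys f = trans (cong (f x +_) (∑-++ xs ys f)) (sym (ℚ.+-assoc (f x) _ _))

∑-map : ∀ (h : A → B) xs (f : B → ℚ) → ∑ (List.map h xs) f ≡ ∑ xs (f ∘ h)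
∑-map h []       f = refl
∑-map h (x ∷ xs) f = cong (f (h x) +_) (∑-map h xs f)

∑-concatMap : ∀ (h : A → List B) xs (f : B → ℚ) → ∑ (concatMap h xs) f ≡ ∑[ x ∈ xs ] ∑ (h x) f
∑-concatMap h []       f = refl
∑-concatMap h (x ∷ xs) f =
  trans (∑-++ (h x) (concatMap h xs) f) (cong (∑ (h x) f +_) (∑-concatMap h xs f))

∑-cartesian : ∀ (h : A → B → C) xs ys (f : C → ℚ) →
              ∑ (cartesianProductWith h xs ys) f ≡ ∑[ x ∈ xs ] ∑[ y ∈ ys ] f (h x y)
∑-cartesian h []       ys f = refl
∑-cartesian h (x ∷ xs) ys f = trans (∑-++ (List.map (h x) ys) _ f)
  (cong₂ _+_ (∑-map (h x) ys f) (∑-cartesian h xs ys f))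

∑-+ : ∀ (xs : List A) (f g : A → ℚ) → ∑[ x ∈ xs ] (f x + g x) ≡ ∑ xs f + ∑ xs g
∑-+ []       f g = refl
∑-+ (x ∷ xs) f g = trans (cong (f x + g x +_) (∑-+ xs f g)) (ℚ+.interchange (f x) (g x) _ _)

∑-*ˡ : ∀ (xs : List A) q (f : A → ℚ) → q * ∑ xs f ≡ ∑[ x ∈ xs ] (q * f x)
∑-*ˡ []       q f = ℚ.*-zeroʳ q
∑-*ˡ (x ∷ xs) q f = trans (ℚ.*-distribˡ-+ q (f x) _) (cong (q * f x +_) (∑-*ˡ xs q f))

∑-*ʳ : ∀ (xs : List A) q (f : A → ℚ) → ∑ xs f * q ≡ ∑[ x ∈ xs ] (f x * q)
∑-*ʳ []       q f = ℚ.*-zeroˡ q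
∑-*ʳ (x ∷ xs) q f = trans (ℚ.*-distribʳ-+ q (f x) _) (cong (f x * q +_) (∑-*ʳ xs q f))

∑-swap : ∀ (xs : List A) (ys : List B) (f : A → B → ℚ) →
         ∑[ x ∈ xs ] ∑[ y ∈ ys ] f x y ≡ ∑[ y ∈ ys ] ∑[ x ∈ xs ] f x y
∑-swap []       ys f = sym (∑-0 ys)
∑-swap (x ∷ xs) ys f =
  trans (cong (∑ ys (f x) +_) (∑-swap xs ys f)) (sym (∑-+ ys (f x) _))

∑-guard : ∀ (xs : List A) b (f : A → ℚ) → ∑[ x ∈ xs ] guard b (f x) ≡ guard b (∑ xs f)
∑-guard xs true  f = refl
∑-guard xs false f = ∑-0 xs

∑-filter : ∀ {P : Pred A p} (P? : Decidable P) xs (f : A → ℚ) →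
           ∑ (List.filter P? xs) f ≡ ∑[ x ∈ xs ] guard (does (P? x)) (f x)
∑-filter P? []       f = refl
∑-filter P? (x ∷ xs) f with does (P? x)
... | true  = cong (f x +_) (∑-filter P? xs f)
... | false = trans (∑-filter P? xs f) (sym (ℚ.+-identityˡ _))

∑-select : ∀ {P : Pred A p} (P? : Decidable P) xs (f : A → ℚ) →
           ∑ (select P? xs) (f ∘ value) ≡ ∑[ x ∈ xs ] guard (does (P? x)) (f x)
∑-select P? xs f = trans (sym (∑-map value (select P? xs) f))
  (trans (cong (λ ys → ∑ ys f) (value-select P? xs)) (∑-filter P? xs f))

∑-↭ : ∀ {xs ys : List A} (f : A → ℚ) → xs ↭ ys → ∑ xs f ≡ ∑ ys f
∑-↭ f xs↭ys = foldr-commMonoid (CommutativeMonoid.setoid M) (CommutativeMonoid.isCommutativeMonoid M)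
  (↭⇒↭ₛ (Perm.map⁺ f xs↭ys))
  where M = ℚ.+-0-commutativeMonoid

unique-↭ : ∀ {xs ys : List A} → Unique xs → Unique ys →
           (∀ {x} → x ∈ xs → x ∈ ys) → (∀ {x} → x ∈ ys → x ∈ xs) → xs ↭ ys
unique-↭ xs! ys! xs⊆ys ys⊆xs = ∼bag⇒↭ (unique∧set⇒bag xs! ys! (mk⇔ xs⊆ys ys⊆xs))

∑-δ : ∀ {xs : List A} {y : A} (f : A → ℚ) → Unique xs → y ∈ xs →
      (≡? : ∀ x → Dec (y ≡ x)) → ∑[ x ∈ xs ] guard (does (≡? x)) (f x) ≡ f y
∑-δ {xs = x ∷ xs} {y} f (x∉xs ∷ _) (here refl) ≡? = begin
  guard (does (≡? x)) (f x) + ∑ xs _ ≡⟨ cong₂ _+_ (guard-yes (≡? x) refl)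
      (trans (∑-cong-All (All.map (λ {z} x≢z → guard-no (≡? z) x≢z) x∉xs)) (∑-0 xs)) ⟩
  f x + 0ℚ                           ≡⟨ ℚ.+-identityʳ (f x) ⟩
  f x                                ∎
  where open ≡-Reasoning
∑-δ {xs = x ∷ xs} {y} f (x∉xs ∷ xs!) (there y∈xs) ≡? = begin
  guard (does (≡? x)) (f x) + ∑ xs _ ≡⟨ cong₂ _+_ (guard-no (≡? x) λ { refl → All.lookup x∉xs y∈xs refl })
                                                  (∑-δ f xs! y∈xs ≡?) ⟩
  0ℚ + f y                           ≡⟨ ℚ.+-identityˡ (f y) ⟩
  f y                                ∎
  where open ≡-Reasoning

-- The monoid of series

-- A comultiplication with values in lists. The product of series is convolution along
-- `factorizations`, so its monoid laws are dual to laws of `splitℕ`, which `splitVec` lifts to rows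
-- and then to monomials.
Split : Set a → Set a
Split A = A → List (A × A)

∑₂ : Split A → A → (A → A → ℚ) → ℚ
∑₂ s x F = ∑[ kl ∈ s x ] F (proj₁ kl) (proj₂ kl)

∑₂-cong : ∀ (s : Split A) x {F G : A → A → ℚ} → (∀ k l → F k l ≡ G k l) → ∑₂ s x F ≡ ∑₂ s x G
∑₂-cong s x F≗G = ∑-cong (s x) λ kl → F≗G (proj₁ kl) (proj₂ kl)

-- Opaque, so that unification does not unfold sums over the splittings of a concrete number.
opaque
  splitℕ : Split ℕ
  splitℕ e = List.map (λ k → k , e ∸ k) (upTo (suc e))

Cocommutative : Split A → Set _
Cocommutative {A = A} s = ∀ x (F : A → A → ℚ) → ∑₂ s x F ≡ ∑₂ s x (λ k l → F l k)

Coassociative : Split A → Set _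
Coassociative {A = A} s = ∀ x (F : A → A → A → ℚ) →
  ∑₂ s x (λ k l → ∑₂ s k (λ a b → F a b l)) ≡ ∑₂ s x (λ a k → ∑₂ s k (λ b l → F a b l))

Counital : (A → Bool) → Split A → Set _
Counital {A = A} z s = ∀ x (F : A → ℚ) → ∑₂ s x (λ k l → guard (z k) (F l)) ≡ F x

opaque
  unfolding splitℕ

  ∑₂-splitℕ-0 : ∀ F → ∑₂ splitℕ 0 F ≡ F 0 0
  ∑₂-splitℕ-0 F = ℚ.+-identityʳ (F 0 0)

  ∑₂-splitℕ-suc : ∀ e F → ∑₂ splitℕ (suc e) F ≡ F 0 (suc e) + ∑₂ splitℕ e (F ∘ suc)
  ∑₂-splitℕ-suc e F = cong (F 0 (suc e) +_) (begin
    ∑ (List.map g (List.applyUpTo suc (suc e))) f   ≡⟨ ∑-map g (List.applyUpTo suc (suc e)) f ⟩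
    ∑ (List.applyUpTo suc (suc e)) (f ∘ g)          ≡⟨ cong (λ ks → ∑ ks (f ∘ g)) (List.map-upTo suc (suc e)) ⟨
    ∑ (List.map suc (upTo (suc e))) (f ∘ g)         ≡⟨ ∑-map suc (upTo (suc e)) (f ∘ g) ⟩
    ∑ (upTo (suc e)) (f ∘ g ∘ suc)                  ≡⟨ ∑-map (λ k → k , e ∸ k) (upTo (suc e)) (λ kl → F (suc (proj₁ kl)) (proj₂ kl)) ⟨
    ∑₂ splitℕ e (F ∘ suc)                           ∎)
    where
    open ≡-Reasoning
    g : ℕ → ℕ × ℕ
    g k = k , suc e ∸ k
    f : ℕ × ℕ → ℚ
    f kl = F (proj₁ kl) (proj₂ kl)

∑₂-splitℕ-sucʳ : ∀ e F → ∑₂ splitℕ (suc e) F ≡ ∑₂ splitℕ e (λ k l → F k (suc l)) + F (suc e) 0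
∑₂-splitℕ-sucʳ zero F = trans (∑₂-splitℕ-suc 0 F)
  (cong₂ _+_ (sym (∑₂-splitℕ-0 (λ k l → F k (suc l)))) (∑₂-splitℕ-0 (F ∘ suc)))
∑₂-splitℕ-sucʳ (suc e) F = begin
  ∑₂ splitℕ (2 ℕ.+ e) F                                                             ≡⟨ ∑₂-splitℕ-suc (suc e) F ⟩
  F 0 (2 ℕ.+ e) + ∑₂ splitℕ (suc e) (F ∘ suc)                                       ≡⟨ cong (F 0 (2 ℕ.+ e) +_) (∑₂-splitℕ-sucʳ e (F ∘ suc)) ⟩
  F 0 (2 ℕ.+ e) + (∑₂ splitℕ e (λ k l → F (suc k) (suc l)) + F (2 ℕ.+ e) 0)         ≡⟨ ℚ.+-assoc (F 0 (2 ℕ.+ e)) _ _ ⟨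
  F 0 (2 ℕ.+ e) + ∑₂ splitℕ e (λ k l → F (suc k) (suc l)) + F (2 ℕ.+ e) 0           ≡⟨ cong (_+ F (2 ℕ.+ e) 0) (∑₂-splitℕ-suc e (λ k l → F k (suc l))) ⟨
  ∑₂ splitℕ (suc e) (λ k l → F k (suc l)) + F (2 ℕ.+ e) 0                           ∎
  where open ≡-Reasoning

splitℕ-cocomm : Cocommutative splitℕ
splitℕ-cocomm zero    F = trans (∑₂-splitℕ-0 F) (sym (∑₂-splitℕ-0 (λ k l → F l k)))
splitℕ-cocomm (suc e) F = begin
  ∑₂ splitℕ (suc e) F                              ≡⟨ ∑₂-splitℕ-suc e F ⟩
  F 0 (suc e) + ∑₂ splitℕ e (F ∘ suc)              ≡⟨ ℚ.+-comm (F 0 (suc e)) _ ⟩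
  ∑₂ splitℕ e (F ∘ suc) + F 0 (suc e)              ≡⟨ cong (_+ F 0 (suc e)) (splitℕ-cocomm e (F ∘ suc)) ⟩
  ∑₂ splitℕ e (λ k l → F (suc l) k) + F 0 (suc e)  ≡⟨ ∑₂-splitℕ-sucʳ e (λ k l → F l k) ⟨
  ∑₂ splitℕ (suc e) (λ k l → F l k)                ∎
  where open ≡-Reasoning

-- Both sides run over the triples with a given total. The triples with first entry 0 agree, and
-- lowering the first entry of the others by one leaves the claim for the predecessor.
splitℕ-coassoc : Coassociative splitℕ
splitℕ-coassoc zero    F = trans
  (trans (∑₂-splitℕ-0 (λ k l → ∑₂ splitℕ k (λ a b → F a b l))) (∑₂-splitℕ-0 (λ a b → F a b 0)))
  (sym (trans (∑₂-splitℕ-0 (λ a k → ∑₂ splitℕ k (λ b l → F a b l))) (∑₂-splitℕ-0 (F 0))))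
splitℕ-coassoc (suc e) F = begin
  ∑₂ splitℕ (suc e) (λ k l → ∑₂ splitℕ k (λ a b → F a b l))
    ≡⟨ ∑₂-splitℕ-suc e (λ k l → ∑₂ splitℕ k (λ a b → F a b l)) ⟩
  ∑₂ splitℕ 0 (λ a b → F a b (suc e)) + ∑₂ splitℕ e (λ k l → ∑₂ splitℕ (suc k) (λ a b → F a b l))
    ≡⟨ cong₂ _+_ (∑₂-splitℕ-0 (λ a b → F a b (suc e))) (trans
         (∑₂-cong splitℕ e λ k l → ∑₂-splitℕ-suc k (λ a b → F a b l))
         (∑-+ (splitℕ e) _ _)) ⟩
  F 0 0 (suc e) + (∑₂ splitℕ e (λ k l → F 0 (suc k) l)
    + ∑₂ splitℕ e (λ k l → ∑₂ splitℕ k (λ a b → F (suc a) b l)))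
    ≡⟨ cong (λ q → F 0 0 (suc e) + (∑₂ splitℕ e (λ k l → F 0 (suc k) l) + q))
         (splitℕ-coassoc e (F ∘ suc)) ⟩
  F 0 0 (suc e) + (∑₂ splitℕ e (λ k l → F 0 (suc k) l)
    + ∑₂ splitℕ e (λ a k → ∑₂ splitℕ k (λ b l → F (suc a) b l)))
    ≡⟨ ℚ.+-assoc (F 0 0 (suc e)) _ _ ⟨
  F 0 0 (suc e) + ∑₂ splitℕ e (λ k l → F 0 (suc k) l)
    + ∑₂ splitℕ e (λ a k → ∑₂ splitℕ k (λ b l → F (suc a) b l))
    ≡⟨ cong (_+ ∑₂ splitℕ e (λ a k → ∑₂ splitℕ k (λ b l → F (suc a) b l))) (∑₂-splitℕ-suc e (F 0)) ⟨
  ∑₂ splitℕ (suc e) (λ b l → F 0 b l) + ∑₂ splitℕ e (λ a k → ∑₂ splitℕ k (λ b l → F (suc a) b l))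
    ≡⟨ ∑₂-splitℕ-suc e (λ a k → ∑₂ splitℕ k (λ b l → F a b l)) ⟨
  ∑₂ splitℕ (suc e) (λ a k → ∑₂ splitℕ k (λ b l → F a b l)) ∎
  where open ≡-Reasoning

splitℕ-counit : Counital (ℕ._≡ᵇ 0) splitℕ
splitℕ-counit zero    F = ∑₂-splitℕ-0 (λ k l → guard (k ℕ.≡ᵇ 0) (F l))
splitℕ-counit (suc e) F = trans (∑₂-splitℕ-suc e (λ k l → guard (k ℕ.≡ᵇ 0) (F l)))
  (trans (cong (F (suc e) +_) (∑-0 (splitℕ e))) (ℚ.+-identityʳ (F (suc e))))

module _ (s : Split A) where

  ∑₂-splitVec : ∀ x (v : Vec A n) F → ∑₂ (splitVec s) (x ∷ v) F ≡
                ∑₂ s x (λ k l → ∑₂ (splitVec s) v (λ u w → F (k ∷ u) (l ∷ w)))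
  ∑₂-splitVec x v F = ∑-cartesian (Product.zip _∷_ _∷_) (s x) (splitVec s v) (λ kl → F (proj₁ kl) (proj₂ kl))

  splitVec-cocomm : Cocommutative s → Cocommutative (splitVec {n = n} s)
  splitVec-cocomm comm []      F = refl
  splitVec-cocomm comm (x ∷ v) F = begin
    ∑₂ (splitVec s) (x ∷ v) F                                         ≡⟨ ∑₂-splitVec x v F ⟩
    ∑₂ s x (λ k l → ∑₂ (splitVec s) v (λ u w → F (k ∷ u) (l ∷ w)))    ≡⟨ comm x _ ⟩
    ∑₂ s x (λ k l → ∑₂ (splitVec s) v (λ u w → F (l ∷ u) (k ∷ w)))    ≡⟨ ∑₂-cong s x (λ k l → splitVec-cocomm comm v _) ⟩
    ∑₂ s x (λ k l → ∑₂ (splitVec s) v (λ u w → F (l ∷ w) (k ∷ u)))    ≡⟨ ∑₂-splitVec x v (λ k l → F l k) ⟨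
    ∑₂ (splitVec s) (x ∷ v) (λ k l → F l k)                           ∎
    where open ≡-Reasoning

  splitVec-coassoc : Coassociative s → Coassociative (splitVec {n = n} s)
  splitVec-coassoc assoc []      F = refl
  splitVec-coassoc {n = suc n} assoc (x ∷ v) F = begin
    ∑₂ S (x ∷ v) (λ k l → ∑₂ S k (λ a b → F a b l))
      ≡⟨ ∑₂-splitVec x v _ ⟩
    ∑₂ s x (λ k l → ∑₂ S v (λ k′ l′ → ∑₂ S (k ∷ k′) (λ a b → F a b (l ∷ l′))))
      ≡⟨ ∑₂-cong s x (λ k l → ∑₂-cong S v λ k′ l′ → ∑₂-splitVec k k′ _) ⟩
    ∑₂ s x (λ k l → ∑₂ S v (λ k′ l′ → ∑₂ s k (λ a b → ∑₂ S k′ (λ a′ b′ → F (a ∷ a′) (b ∷ b′) (l ∷ l′)))))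
      -- Head and tail split independently: once the sums over the head stand outside those over the
      -- tail, coassociativity applies to each separately.
      ≡⟨ ∑₂-cong s x (λ k l → ∑-swap (S v) (s k) _) ⟩
    ∑₂ s x (λ k l → ∑₂ s k (λ a b → ∑₂ S v (λ k′ l′ → ∑₂ S k′ (λ a′ b′ → F (a ∷ a′) (b ∷ b′) (l ∷ l′)))))
      ≡⟨ assoc x _ ⟩
    ∑₂ s x (λ a k → ∑₂ s k (λ b l → ∑₂ S v (λ k′ l′ → ∑₂ S k′ (λ a′ b′ → F (a ∷ a′) (b ∷ b′) (l ∷ l′)))))
      ≡⟨ ∑₂-cong s x (λ a k → ∑₂-cong s k λ b l → splitVec-coassoc assoc v _) ⟩
    ∑₂ s x (λ a k → ∑₂ s k (λ b l → ∑₂ S v (λ a′ k′ → ∑₂ S k′ (λ b′ l′ → F (a ∷ a′) (b ∷ b′) (l ∷ l′)))))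
      ≡⟨ ∑₂-cong s x (λ a k → ∑-swap (S v) (s k) _) ⟨
    ∑₂ s x (λ a k → ∑₂ S v (λ a′ k′ → ∑₂ s k (λ b l → ∑₂ S k′ (λ b′ l′ → F (a ∷ a′) (b ∷ b′) (l ∷ l′)))))
      ≡⟨ ∑₂-cong s x (λ a k → ∑₂-cong S v λ a′ k′ → ∑₂-splitVec k k′ _) ⟨
    ∑₂ s x (λ a k → ∑₂ S v (λ a′ k′ → ∑₂ S (k ∷ k′) (λ b l → F (a ∷ a′) b l)))
      ≡⟨ ∑₂-splitVec x v _ ⟨
    ∑₂ S (x ∷ v) (λ a k → ∑₂ S k (λ b l → F a b l)) ∎
    where
    open ≡-Reasoning
    S : ∀ {n} → Split (Vec A n)
    S = splitVec s

  splitVec-counit : ∀ z → Counital z s → Counital (λ v → Vec.foldr _ (λ x b → z x ∧ b) true v) (splitVec {n = n} s)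
  splitVec-counit z counit []      F = ℚ.+-identityʳ (F [])
  splitVec-counit z counit (x ∷ v) F = begin
    ∑₂ (splitVec s) (x ∷ v) (λ k l → guard (zs k) (F l))
      ≡⟨ ∑₂-splitVec x v _ ⟩
    ∑₂ s x (λ k l → ∑₂ (splitVec s) v (λ k′ l′ → guard (z k ∧ zs k′) (F (l ∷ l′))))
      ≡⟨ ∑₂-cong s x (λ k l → trans
           (∑₂-cong (splitVec s) v λ k′ l′ → sym (guard-∧ (z k) (zs k′) (F (l ∷ l′))))
           (trans (∑-guard (splitVec s v) (z k) _)
                  (cong (guard (z k)) (splitVec-counit z counit v (λ l′ → F (l ∷ l′)))))) ⟩
    ∑₂ s x (λ k l → guard (z k) (F (l ∷ v)))
      ≡⟨ counit x (λ l → F (l ∷ v)) ⟩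
    F (x ∷ v) ∎
    where
    open ≡-Reasoning
    zs : ∀ {n} → Vec _ n → Bool
    zs = Vec.foldr _ (λ x b → z x ∧ b) true

opaque
  unfolding splitℕ

  factorizations-cocomm : Cocommutative (factorizations {I} {J})
  factorizations-cocomm = splitVec-cocomm _ (splitVec-cocomm splitℕ splitℕ-cocomm)

  factorizations-coassoc : Coassociative (factorizations {I} {J})
  factorizations-coassoc = splitVec-coassoc _ (splitVec-coassoc splitℕ splitℕ-coassoc)

-- Sums over the exponents of a monomial

isZeroRow : Vec ℕ J → Bool
isZeroRow = Vec.foldr _ (λ e b → (e ℕ.≡ᵇ 0) ∧ b) true

isZero : Monomial I J → Bool
isZero = Vec.foldr _ (λ r b → isZeroRow r ∧ b) true

opaque
  unfolding splitℕ

  factorizations-counit : Counital isZero (factorizations {I} {J})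
  factorizations-counit = splitVec-counit _ isZeroRow (splitVec-counit splitℕ (ℕ._≡ᵇ 0) splitℕ-counit)

-- The function of the exponents is arbitrary because the degree, the measure V and the test
-- functions that recover the blocks from a monomial are all sums of this kind.
∑ʳ : (ℕ → ℕ) → Vec ℕ J → ℕ
∑ʳ h []      = 0
∑ʳ h (e ∷ r) = h e ℕ.+ ∑ʳ h r

-- The rows are numbered from 0, so h i applies to the exponents of the x_{1+i,j}.
∑ᴹ : (ℕ → ℕ → ℕ) → Monomial I J → ℕ
∑ᴹ h []      = 0
∑ᴹ h (r ∷ m) = ∑ʳ (h 0) r ℕ.+ ∑ᴹ (h ∘ suc) m

∑ʳ-linear : ∀ k (r : Vec ℕ J) → ∑ʳ (k ℕ.*_) r ≡ k ℕ.* Vec.sum r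
∑ʳ-linear k []      = sym (ℕ.*-zeroʳ k)
∑ʳ-linear k (e ∷ r) = trans (cong (k ℕ.* e ℕ.+_) (∑ʳ-linear k r)) (sym (ℕ.*-distribˡ-+ k e (Vec.sum r)))

map-tail-allFin : ∀ (f : Fin (suc n) → A) →
  List.map f (List.tabulate Fin.suc) ≡ List.map (f ∘ Fin.suc) (allFin n)
map-tail-allFin f = trans (List.map-tabulate Fin.suc f) (sym (List.map-tabulate id (f ∘ Fin.suc)))

-- The weight is a variable because removing the first row replaces `w` by `w ∘ suc`; the degree is
-- the case `w = suc`.
∑ᴹ-linear : ∀ (w : ℕ → ℕ) (m : Monomial I J) → ∑ᴹ (λ i e → w i ℕ.* e) m ≡
            sum (List.map (λ i → w (toℕ i) ℕ.* Vec.sum (lookup m i)) (allFin I))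
∑ᴹ-linear w []      = refl
∑ᴹ-linear {I = suc I} w (r ∷ m) = cong₂ ℕ._+_ (∑ʳ-linear (w 0) r)
  (trans (∑ᴹ-linear (w ∘ suc) m)
    (cong sum (sym (map-tail-allFin (λ i → w (toℕ i) ℕ.* Vec.sum (lookup (r ∷ m) i))))))

deg≡∑ᴹ : ∀ (m : Monomial I J) → deg m ≡ ∑ᴹ (λ i e → suc i ℕ.* e) m
deg≡∑ᴹ m = sym (∑ᴹ-linear suc m)

+≡ᵇ0 : ∀ a b → (a ℕ.+ b ℕ.≡ᵇ 0) ≡ (a ℕ.≡ᵇ 0) ∧ (b ℕ.≡ᵇ 0)
+≡ᵇ0 zero    b = refl
+≡ᵇ0 (suc a) b = refl

∑ʳ-≡ᵇ0 : ∀ {h} → (∀ e → (h e ℕ.≡ᵇ 0) ≡ (e ℕ.≡ᵇ 0)) → ∀ (r : Vec ℕ J) → (∑ʳ h r ℕ.≡ᵇ 0) ≡ isZeroRow r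
∑ʳ-≡ᵇ0 h≡ []      = refl
∑ʳ-≡ᵇ0 {h = h} h≡ (e ∷ r) = trans (+≡ᵇ0 (h e) _) (cong₂ _∧_ (h≡ e) (∑ʳ-≡ᵇ0 h≡ r))

∑ᴹ-≡ᵇ0 : ∀ {h} → (∀ d e → (h d e ℕ.≡ᵇ 0) ≡ (e ℕ.≡ᵇ 0)) →
         ∀ (m : Monomial I J) → (∑ᴹ h m ℕ.≡ᵇ 0) ≡ isZero m
∑ᴹ-≡ᵇ0 h≡ []      = refl
∑ᴹ-≡ᵇ0 {h = h} h≡ (r ∷ m) =
  trans (+≡ᵇ0 (∑ʳ (h 0) r) _) (cong₂ _∧_ (∑ʳ-≡ᵇ0 (h≡ 0) r) (∑ᴹ-≡ᵇ0 (h≡ ∘ suc) m))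

suc*≡ᵇ0 : ∀ d e → (suc d ℕ.* e ℕ.≡ᵇ 0) ≡ (e ℕ.≡ᵇ 0)
suc*≡ᵇ0 d zero    = cong (ℕ._≡ᵇ 0) (ℕ.*-zeroʳ d)
suc*≡ᵇ0 d (suc e) = refl

deg≡ᵇ0 : ∀ (m : Monomial I J) → (deg m ℕ.≡ᵇ 0) ≡ isZero m
deg≡ᵇ0 m = trans (cong (ℕ._≡ᵇ 0) (deg≡∑ᴹ m)) (∑ᴹ-≡ᵇ0 suc*≡ᵇ0 m)

-- Unlike f ≈ g, which unfolds to a family of equations, f ≋ g determines f and g.
infix 4 _≋_
record _≋_ (f g : Series) : Set where
  constructor mk
  field at : f ≈ g

open _≋_ public

≋-isEquivalence : IsEquivalence _≋_
≋-isEquivalence = record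
  { refl  = mk λ m → refl
  ; sym   = λ f≋g → mk λ m → sym (at f≋g m)
  ; trans = λ f≋g g≋h → mk λ m → trans (at f≋g m) (at g≋h m)
  }

-- An opaque copy of _⊛_: the η-rule of Series makes f ⊛ g useless for inferring f and g.
opaque
  infixl 7 _⊙_
  _⊙_ : Series → Series → Series
  _⊙_ = _⊛_

opaque
  unfolding _⊙_

  ⊙-cong : ∀ {f f′ g g′} → f ≋ f′ → g ≋ g′ → f ⊙ g ≋ f′ ⊙ g′
  ⊙-cong f≋f′ g≋g′ = mk λ m → ∑₂-cong factorizations m λ k l → cong₂ _*_ (at f≋f′ k) (at g≋g′ l)

  ⊙-comm : ∀ f g → f ⊙ g ≋ g ⊙ f
  ⊙-comm f g = mk λ m → trans (factorizations-cocomm m (λ k l → coeff f k * coeff g l))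
    (∑₂-cong factorizations m λ k l → ℚ.*-comm (coeff f l) (coeff g k))

  ⊙-assoc : ∀ f g h → (f ⊙ g) ⊙ h ≋ f ⊙ (g ⊙ h)
  ⊙-assoc f g h = mk λ m → begin
    ∑₂ factorizations m (λ k l → coeff (f ⊙ g) k * coeff h l)
      ≡⟨ ∑₂-cong factorizations m (λ k l → trans (∑-*ʳ (factorizations k) (coeff h l) _)
           (∑₂-cong factorizations k λ a b → ℚ.*-assoc (coeff f a) (coeff g b) (coeff h l))) ⟩
    ∑₂ factorizations m (λ k l → ∑₂ factorizations k (λ a b → coeff f a * (coeff g b * coeff h l)))
      ≡⟨ factorizations-coassoc m (λ a b l → coeff f a * (coeff g b * coeff h l)) ⟩
    ∑₂ factorizations m (λ a k → ∑₂ factorizations k (λ b l → coeff f a * (coeff g b * coeff h l)))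
      ≡⟨ ∑₂-cong factorizations m (λ a k → ∑-*ˡ (factorizations k) (coeff f a) _) ⟨
    ∑₂ factorizations m (λ a k → coeff f a * coeff (g ⊙ h) k) ∎
    where open ≡-Reasoning

  ⊙-identityˡ : ∀ f → 𝟙 ⊙ f ≋ f
  ⊙-identityˡ f = mk λ m → trans
    (∑₂-cong factorizations m λ k l → trans (guard-*ˡ (does (deg k ℕ.≟ 0)) 1ℚ (coeff f l))
      (cong₂ guard (deg≡ᵇ0 k) (ℚ.*-identityˡ (coeff f l))))
    (factorizations-counit m (coeff f))

⊙-commutativeMonoid : CommutativeMonoid 0ℓ 0ℓ
⊙-commutativeMonoid = record
  { Carrier = Series
  ; _≈_     = _≋_
  ; _∙_     = _⊙_
  ; ε       = 𝟙
  ; isCommutativeMonoid = record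
    { isMonoid = record
      { isSemigroup = record
        { isMagma = record { isEquivalence = ≋-isEquivalence ; ∙-cong = ⊙-cong }
        ; assoc   = ⊙-assoc
        }
      ; identity = ⊙-identityˡ , λ f → IsEquivalence.trans ≋-isEquivalence (⊙-comm f 𝟙) (⊙-identityˡ f)
      }
    ; comm = ⊙-comm
    }
  }

module ⊙ = CommutativeMonoid ⊙-commutativeMonoid

∏ : List Series → Series
∏ = foldr _⊙_ 𝟙

∏-++ : ∀ fs gs → ∏ (fs ++ gs) ≋ ∏ fs ⊙ ∏ gs
∏-++ []       gs = ⊙.sym (⊙.identityˡ (∏ gs))
∏-++ (f ∷ fs) gs = ⊙.trans (⊙.∙-congˡ (∏-++ fs gs)) (⊙.sym (⊙.assoc f (∏ fs) (∏ gs)))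

∏-↭ : ∀ {fs gs} → fs ↭ gs → ∏ fs ≋ ∏ gs
∏-↭ fs↭gs = foldr-commMonoid ⊙.setoid ⊙.isCommutativeMonoid
  (Homogeneous.map ⊙.reflexive (↭⇒↭ₛ fs↭gs))

∏-map-cong : ∀ {f g : A → Series} xs → (∀ x → f x ≋ g x) → ∏ (List.map f xs) ≋ ∏ (List.map g xs)
∏-map-cong []       f≋g = ⊙.refl
∏-map-cong (x ∷ xs) f≋g = ⊙.∙-cong (f≋g x) (∏-map-cong xs f≋g)

infixr 8 _•_
_•_ : ℚ → Series → Series
coeff (q • f) m = q * coeff f m

⨁ : List A → (A → Series) → Series
coeff (⨁ xs f) m = ∑[ x ∈ xs ] coeff (f x) m

⨁-cong : ∀ (xs : List A) {f g : A → Series} → (∀ x → f x ≋ g x) → ⨁ xs f ≋ ⨁ xs g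
⨁-cong xs f≋g = mk λ m → ∑-cong xs λ x → at (f≋g x) m

opaque
  unfolding _⊙_

  ∏≡foldr : ∀ fs → ∏ fs ≡ foldr _⊛_ 𝟙 fs
  ∏≡foldr fs = refl

  ⨁-⊙ : ∀ (xs : List A) (f : A → Series) g → ⨁ xs f ⊙ g ≋ ⨁ xs (λ x → f x ⊙ g)
  ⨁-⊙ xs f g = mk λ m → trans
    (∑₂-cong factorizations m λ k l → ∑-*ʳ xs (coeff g l) (λ x → coeff (f x) k))
    (∑-swap (factorizations m) xs _)

  ⊙-⨁ : ∀ (xs : List A) (f : A → Series) g → g ⊙ ⨁ xs f ≋ ⨁ xs (λ x → g ⊙ f x)
  ⊙-⨁ xs f g = mk λ m → trans
    (∑₂-cong factorizations m λ k l → ∑-*ˡ xs (coeff g k) (λ x → coeff (f x) l))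
    (∑-swap (factorizations m) xs _)

  •-⊙ : ∀ q f g → (q • f) ⊙ g ≋ q • (f ⊙ g)
  •-⊙ q f g = mk λ m → trans
    (∑₂-cong factorizations m λ k l → ℚ.*-assoc q (coeff f k) (coeff g l))
    (sym (∑-*ˡ (factorizations m) q _))

  ⊙-• : ∀ q f g → f ⊙ (q • g) ≋ q • (f ⊙ g)
  ⊙-• q f g = mk λ m → trans
    (∑₂-cong factorizations m λ k l → ℚ*.x∙yz≈y∙xz (coeff f k) q (coeff g l))
    (sym (∑-*ˡ (factorizations m) q _))

-- Dilations f ↦ f [x^ r ]

-- With divisibility by r for `P?` and division by r for `q`, this is the multiplicativity of f ↦ f
-- [x^ r ], expressed for the comultiplication.
Divisible : {P : Pred A p} → Decidable P → (A → A) → Split A → Set _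
Divisible {A = A} P? q s = ∀ x (F : A → A → ℚ) →
  ∑₂ s x (λ k l → guard (does (P? k) ∧ does (P? l)) (F (q k) (q l))) ≡ guard (does (P? x)) (∑₂ s (q x) F)

∧-interchange : ∀ w x y z → (w ∧ x) ∧ (y ∧ z) ≡ (w ∧ y) ∧ (x ∧ z)
∧-interchange true  true  y z = refl
∧-interchange true  false y z = sym (∧-zeroʳ y)
∧-interchange false x     y z = refl

splitVec-divisible : ∀ {P : Pred A p} (P? : Decidable P) q (s : Split A) → Divisible P? q s →
                     Divisible (VecAll.all? {n = n} P?) (Vec.map q) (splitVec s)
splitVec-divisible P? q s div []      F = refl
splitVec-divisible P? q s div (x ∷ v) F = begin
  ∑₂ (splitVec s) (x ∷ v) (λ k l → guard (does (VecAll.all? P? k) ∧ does (VecAll.all? P? l)) (F (Vec.map q k) (Vec.map q l)))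
    ≡⟨ ∑₂-splitVec s x v (λ k l → guard (does (VecAll.all? P? k) ∧ does (VecAll.all? P? l)) (F (Vec.map q k) (Vec.map q l))) ⟩
  ∑₂ s x (λ k l → ∑₂ (splitVec s) v (λ u w →
    guard ((does (P? k) ∧ all u) ∧ (does (P? l) ∧ all w)) (F (q k ∷ Vec.map q u) (q l ∷ Vec.map q w))))
    ≡⟨ ∑₂-cong s x (λ k l → trans
         (∑₂-cong (splitVec s) v λ u w → trans
           (cong (λ b → guard b (F (q k ∷ Vec.map q u) (q l ∷ Vec.map q w)))
                 (∧-interchange (does (P? k)) (all u) (does (P? l)) (all w)))
           (sym (guard-∧ (does (P? k) ∧ does (P? l)) _ _)))
         (trans (∑-guard (splitVec s v) (does (P? k) ∧ does (P? l)) _)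
                (cong (guard (does (P? k) ∧ does (P? l)))
                      (splitVec-divisible P? q s div v (λ u w → F (q k ∷ u) (q l ∷ w)))))) ⟩
  ∑₂ s x (λ k l → guard (does (P? k) ∧ does (P? l))
    (guard (all v) (∑₂ (splitVec s) (Vec.map q v) (λ u w → F (q k ∷ u) (q l ∷ w)))))
    ≡⟨ div x (λ k l → guard (all v) (∑₂ (splitVec s) (Vec.map q v) (λ u w → F (k ∷ u) (l ∷ w)))) ⟩
  guard (does (P? x)) (∑₂ s (q x) (λ k l →
    guard (all v) (∑₂ (splitVec s) (Vec.map q v) (λ u w → F (k ∷ u) (l ∷ w)))))
    ≡⟨ cong (guard (does (P? x))) (trans (∑-guard (s (q x)) (all v) _)
         (cong (guard (all v)) (sym (∑₂-splitVec s (q x) (Vec.map q v) F)))) ⟩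
  guard (does (P? x)) (guard (all v) (∑₂ (splitVec s) (q x ∷ Vec.map q v) F))
    ≡⟨ guard-∧ (does (P? x)) (all v) _ ⟩
  guard (does (P? x) ∧ all v) (∑₂ (splitVec s) (q x ∷ Vec.map q v) F) ∎
  where
  open ≡-Reasoning
  all : ∀ {n} → Vec _ n → Bool
  all u = does (VecAll.all? P? u)

multiples-↭ : ∀ r .{{_ : NonZero r}} q →
              List.filter (r ∣?_) (upTo (suc (q ℕ.* r))) ↭ List.map (ℕ._* r) (upTo (suc q))
multiples-↭ r q = unique-↭ (Unique.filter⁺ (r ∣?_) (Unique.upTo⁺ (suc (q ℕ.* r))))
  (Unique.map⁺ (λ {x} {y} → ℕ.*-cancelʳ-≡ x y r) (Unique.upTo⁺ (suc q))) to from
  where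
  to : ∀ {k} → k ∈ List.filter (r ∣?_) (upTo (suc (q ℕ.* r))) → k ∈ List.map (ℕ._* r) (upTo (suc q))
  to k∈ with ∈-filter⁻ (r ∣?_) {xs = upTo (suc (q ℕ.* r))} k∈
  ... | k∈upTo , divides-refl k′ =
    ∈-map⁺ (ℕ._* r) (∈-upTo⁺ (s≤s (ℕ.*-cancelʳ-≤ k′ q r (ℕ.≤-pred (∈-upTo⁻ k∈upTo)))))

  from : ∀ {k} → k ∈ List.map (ℕ._* r) (upTo (suc q)) → k ∈ List.filter (r ∣?_) (upTo (suc (q ℕ.* r)))
  from k∈ with ∈-map⁻ (ℕ._* r) {xs = upTo (suc q)} k∈
  ... | k′ , k′∈ , refl = ∈-filter⁺ (r ∣?_) {xs = upTo (suc (q ℕ.* r))}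
    (∈-upTo⁺ (s≤s (ℕ.*-monoˡ-≤ r (ℕ.≤-pred (∈-upTo⁻ k′∈))))) (divides-refl k′)

opaque
  unfolding splitℕ

  ∑₂-splitℕ : ∀ e F → ∑₂ splitℕ e F ≡ ∑ (upTo (suc e)) (λ k → F k (e ∸ k))
  ∑₂-splitℕ e F = ∑-map (λ k → k , e ∸ k) (upTo (suc e)) (λ kl → F (proj₁ kl) (proj₂ kl))

-- If r does not divide e, no splitting of e consists of two multiples of r. If it does,
-- divisibility of one entry implies that of the other, and the splittings that remain are the
-- r-fold multiples of those of e / r.
splitℕ-divisible : ∀ r .{{_ : NonZero r}} → Divisible (r ∣?_) (_/ r) splitℕ
splitℕ-divisible r e F with r ∣? e
... | no r∤e = begin
  ∑₂ splitℕ e (λ k l → guard (does (r ∣? k) ∧ does (r ∣? l)) (F (k / r) (l / r)))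
    ≡⟨ ∑₂-splitℕ e (λ k l → guard (does (r ∣? k) ∧ does (r ∣? l)) (F (k / r) (l / r))) ⟩
  ∑ (upTo (suc e)) (λ k → guard (does (r ∣? k) ∧ does (r ∣? (e ∸ k))) (F (k / r) ((e ∸ k) / r)))
    ≡⟨ ∑-cong-All {xs = upTo (suc e)}
         {λ k → guard (does (r ∣? k) ∧ does (r ∣? (e ∸ k))) (F (k / r) ((e ∸ k) / r))} {λ _ → 0ℚ}
         (All.tabulate λ {k} k∈ → guard-no (r ∣? k ×-dec r ∣? (e ∸ k))
           λ { (r∣k , r∣e∸k) → r∤e (∣m∸n∣n⇒∣m r (ℕ.≤-pred (∈-upTo⁻ k∈)) r∣e∸k r∣k) }) ⟩
  ∑ (upTo (suc e)) (λ _ → 0ℚ)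
    ≡⟨ ∑-0 (upTo (suc e)) ⟩
  0ℚ ∎
  where open ≡-Reasoning
... | yes (divides-refl q) = begin
  ∑₂ splitℕ e (λ k l → guard (does (r ∣? k) ∧ does (r ∣? l)) (F (k / r) (l / r)))
    ≡⟨ ∑₂-splitℕ e (λ k l → guard (does (r ∣? k) ∧ does (r ∣? l)) (F (k / r) (l / r))) ⟩
  ∑ (upTo (suc e)) (λ k → guard (does (r ∣? k) ∧ does (r ∣? (e ∸ k))) (h k))
    ≡⟨ ∑-cong (upTo (suc e))
         {λ k → guard (does (r ∣? k) ∧ does (r ∣? (e ∸ k))) (h k)} {λ k → guard (does (r ∣? k)) (h k)}
         (λ k → guard-⇔ (r ∣? k ×-dec r ∣? (e ∸ k)) (r ∣? k) proj₁
           (λ { (divides-refl k′) → divides-refl k′ ,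
             divides (q ∸ k′) (sym (ℕ.*-distribʳ-∸ r q k′)) }) (h k)) ⟩
  ∑ (upTo (suc e)) (λ k → guard (does (r ∣? k)) (h k))
    ≡⟨ ∑-filter (r ∣?_) (upTo (suc e)) h ⟨
  ∑ (List.filter (r ∣?_) (upTo (suc e))) h
    ≡⟨ ∑-↭ h (multiples-↭ r q) ⟩
  ∑ (List.map (ℕ._* r) (upTo (suc q))) h
    ≡⟨ ∑-map (ℕ._* r) (upTo (suc q)) h ⟩
  ∑ (upTo (suc q)) (λ k → F (k ℕ.* r / r) ((q ℕ.* r ∸ k ℕ.* r) / r))
    ≡⟨ ∑-cong (upTo (suc q))
         {λ k → F (k ℕ.* r / r) ((q ℕ.* r ∸ k ℕ.* r) / r)} {λ k → F k (q ∸ k)}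
         (λ k → cong₂ F (m*n/n≡m k r)
           (trans (cong (_/ r) (sym (ℕ.*-distribʳ-∸ r q k))) (m*n/n≡m (q ∸ k) r))) ⟩
  ∑ (upTo (suc q)) (λ k → F k (q ∸ k))
    ≡⟨ ∑₂-splitℕ q F ⟨
  ∑₂ splitℕ q F
    ≡⟨ cong (λ q → ∑₂ splitℕ q F) (m*n/n≡m q r) ⟨
  ∑₂ splitℕ (e / r) F ∎
  where
  open ≡-Reasoning
  h : ℕ → ℚ
  h k = F (k / r) ((e ∸ k) / r)

∣∧/≡ᵇ0 : ∀ r .{{_ : NonZero r}} e → does (r ∣? e) ∧ (e / r ℕ.≡ᵇ 0) ≡ (e ℕ.≡ᵇ 0)
∣∧/≡ᵇ0 r e with r ∣? e
∣∧/≡ᵇ0 r zero    | no r∤e = contradiction (r ∣0) r∤e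
∣∧/≡ᵇ0 r (suc e) | no r∤e = refl
∣∧/≡ᵇ0 r@(suc _) e | yes (divides-refl zero) = refl
∣∧/≡ᵇ0 r@(suc _) e | yes (divides-refl (suc q)) = cong (ℕ._≡ᵇ 0) (m*n/n≡m (suc q) r)

∣∧/-isZero : ∀ r .{{_ : NonZero r}} (m : Monomial I J) →
  does (VecAll.all? (VecAll.all? (r ∣?_)) m) ∧ isZero (Vec.map (Vec.map (_/ r)) m) ≡ isZero m
∣∧/-isZero r []      = refl
∣∧/-isZero r (v ∷ m) = trans
  (∧-interchange (does (VecAll.all? (r ∣?_) v)) _ (isZeroRow (Vec.map (_/ r) v)) _)
  (cong₂ _∧_ (row v) (∣∧/-isZero r m))
  where
  row : ∀ {J} (v : Vec ℕ J) →
        does (VecAll.all? (r ∣?_) v) ∧ isZeroRow (Vec.map (_/ r) v) ≡ isZeroRow v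
  row []      = refl
  row (e ∷ v) = trans (∧-interchange (does (r ∣? e)) _ (e / r ℕ.≡ᵇ 0) _)
    (cong₂ _∧_ (∣∧/≡ᵇ0 r e) (row v))

module _ (r : ℕ) .{{_ : NonZero r}} where

  opaque
    unfolding splitℕ

    factorizations-divisible : Divisible (VecAll.all? (VecAll.all? (r ∣?_))) (Vec.map (Vec.map (_/ r)))
                                 (factorizations {I} {J})
    factorizations-divisible = splitVec-divisible _ (Vec.map (_/ r)) _
      (splitVec-divisible (r ∣?_) (_/ r) splitℕ (splitℕ-divisible r))

  opaque
    unfolding _⊙_

    [x^]-⊙ : ∀ f g → (f ⊙ g) [x^ r ] ≋ f [x^ r ] ⊙ g [x^ r ]
    [x^]-⊙ f g = mk λ m → sym (trans
      (∑₂-cong factorizations m λ k l → guard-* (does (VecAll.all? (VecAll.all? (r ∣?_)) k))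
        (does (VecAll.all? (VecAll.all? (r ∣?_)) l)) _ _)
      (factorizations-divisible m (λ k l → coeff f k * coeff g l)))

  [x^]-cong : ∀ {f g} → f ≋ g → f [x^ r ] ≋ g [x^ r ]
  [x^]-cong f≋g = mk λ m → cong (guard (does (VecAll.all? (VecAll.all? (r ∣?_)) m))) (at f≋g _)

  [x^]-⨁ : ∀ (xs : List A) (f : A → Series) → ⨁ xs f [x^ r ] ≋ ⨁ xs (λ x → f x [x^ r ])
  [x^]-⨁ xs f = mk λ m → sym (∑-guard xs (does (VecAll.all? (VecAll.all? (r ∣?_)) m)) _)

  [x^]-• : ∀ q f → (q • f) [x^ r ] ≋ q • (f [x^ r ])
  [x^]-• q f = mk λ m → sym (guard-*ʳ (does (VecAll.all? (VecAll.all? (r ∣?_)) m)) q _)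

  [x^]-𝟙 : 𝟙 [x^ r ] ≋ 𝟙
  [x^]-𝟙 = mk λ m → trans (guard-∧ (does (VecAll.all? (VecAll.all? (r ∣?_)) m)) _ 1ℚ)
    (cong (λ b → guard b 1ℚ) (trans
      (cong (does (VecAll.all? (VecAll.all? (r ∣?_)) m) ∧_) (deg≡ᵇ0 (Vec.map (Vec.map (_/ r)) m)))
      (trans (∣∧/-isZero r m) (sym (deg≡ᵇ0 m)))))

  [x^]-∏ : ∀ (f : A → Series) xs → ∏ (List.map f xs) [x^ r ] ≋ ∏ (List.map (λ x → f x [x^ r ]) xs)
  [x^]-∏ f []       = [x^]-𝟙
  [x^]-∏ f (x ∷ xs) = ⊙.trans ([x^]-⊙ (f x) (∏ (List.map f xs))) (⊙.∙-congˡ ([x^]-∏ f xs))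

-- Exponent sums of monomials

toℚᵘ-fromℕ : ∀ k → ℚ.toℚᵘ (fromℕ k) ℚᵘ.≃ mkℚᵘ (ℤ.+ k) 0
toℚᵘ-fromℕ k = ℚ.toℚᵘ-fromℚᵘ (mkℚᵘ (ℤ.+ k) 0)

fromℕ-+ : ∀ j k → fromℕ (j ℕ.+ k) ≡ fromℕ j + fromℕ k
fromℕ-+ j k = ℚ.toℚᵘ-injective (begin
  ℚ.toℚᵘ (fromℕ (j ℕ.+ k))                     ≈⟨ toℚᵘ-fromℕ (j ℕ.+ k) ⟩
  mkℚᵘ (ℤ.+ (j ℕ.+ k)) 0                         ≈⟨ *≡* (cong (ℤ._* ℤ.+ 1) (sym (cong₂ ℤ._+_ (ℤ.*-identityʳ (ℤ.+ j)) (ℤ.*-identityʳ (ℤ.+ k))))) ⟩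
  mkℚᵘ (ℤ.+ j) 0 ℚᵘ.+ mkℚᵘ (ℤ.+ k) 0               ≈⟨ ℚᵘ.+-cong (toℚᵘ-fromℕ j) (toℚᵘ-fromℕ k) ⟨
  ℚ.toℚᵘ (fromℕ j) ℚᵘ.+ ℚ.toℚᵘ (fromℕ k)       ≈⟨ ℚ.toℚᵘ-homo-+ (fromℕ j) (fromℕ k) ⟨
  ℚ.toℚᵘ (fromℕ j + fromℕ k)                   ∎)
  where open ℚᵘ.≃-Reasoning

fromℕ-* : ∀ j k → fromℕ (j ℕ.* k) ≡ fromℕ j * fromℕ k
fromℕ-* zero    k = sym (ℚ.*-zeroˡ (fromℕ k))
fromℕ-* (suc j) k = begin
  fromℕ (k ℕ.+ j ℕ.* k)            ≡⟨ fromℕ-+ k (j ℕ.* k) ⟩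
  fromℕ k + fromℕ (j ℕ.* k)        ≡⟨ cong₂ _+_ (sym (ℚ.*-identityˡ (fromℕ k))) (fromℕ-* j k) ⟩
  1ℚ * fromℕ k + fromℕ j * fromℕ k ≡⟨ ℚ.*-distribʳ-+ (fromℕ k) 1ℚ (fromℕ j) ⟨
  (1ℚ + fromℕ j) * fromℕ k         ≡⟨ cong (_* fromℕ k) (fromℕ-+ 1 j) ⟨
  fromℕ (suc j) * fromℕ k          ∎
  where open ≡-Reasoning

module _ {s : Split A} {_∙_ : A → A → A} where

  splitVec-∈⁻ : (∀ x {k l} → (k , l) ∈ s x → k ∙ l ≡ x) →
                ∀ (v : Vec A n) {u w} → (u , w) ∈ splitVec s v → Vec.zipWith _∙_ u w ≡ v
  splitVec-∈⁻ s⁻ []      (here refl) = refl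
  splitVec-∈⁻ s⁻ (x ∷ v) uw∈
    with _ , _ , kl∈ , uw∈′ , refl ← ∈-cartesianProductWith⁻ (Product.zip _∷_ _∷_) (s x) (splitVec s v) uw∈
    = cong₂ _∷_ (s⁻ x kl∈) (splitVec-∈⁻ s⁻ v uw∈′)

  splitVec-∈⁺ : (∀ k l → (k , l) ∈ s (k ∙ l)) →
                ∀ (u w : Vec A n) → (u , w) ∈ splitVec s (Vec.zipWith _∙_ u w)
  splitVec-∈⁺ s⁺ []      []      = here refl
  splitVec-∈⁺ s⁺ (k ∷ u) (l ∷ w) =
    ∈-cartesianProductWith⁺ (Product.zip _∷_ _∷_) (s⁺ k l) (splitVec-∈⁺ s⁺ u w)

infixl 6 _⊞_
_⊞_ : Monomial I J → Monomial I J → Monomial I J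
_⊞_ = Vec.zipWith (Vec.zipWith ℕ._+_)

opaque
  unfolding splitℕ

  splitℕ-∈⁻ : ∀ e {k l} → (k , l) ∈ splitℕ e → k ℕ.+ l ≡ e
  splitℕ-∈⁻ e kl∈ with ∈-map⁻ (λ k → k , e ∸ k) {xs = upTo (suc e)} kl∈
  ... | k , k∈ , refl = ℕ.m+[n∸m]≡n (ℕ.≤-pred (∈-upTo⁻ k∈))

  splitℕ-∈⁺ : ∀ k l → (k , l) ∈ splitℕ (k ℕ.+ l)
  splitℕ-∈⁺ k l = subst (λ l′ → (k , l′) ∈ splitℕ (k ℕ.+ l)) (ℕ.m+n∸m≡n k l)
    (∈-map⁺ (λ k′ → k′ , k ℕ.+ l ∸ k′) {xs = upTo (suc (k ℕ.+ l))} (∈-upTo⁺ (s≤s (ℕ.m≤m+n k l))))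

opaque
  unfolding splitℕ

  factorizations-∈⁻ : ∀ (m : Monomial I J) {k l} → (k , l) ∈ factorizations m → k ⊞ l ≡ m
  factorizations-∈⁻ m = splitVec-∈⁻ (splitVec-∈⁻ splitℕ-∈⁻) m

  factorizations-∈⁺ : ∀ (k l : Monomial I J) → (k , l) ∈ factorizations (k ⊞ l)
  factorizations-∈⁺ = splitVec-∈⁺ (splitVec-∈⁺ splitℕ-∈⁺)

∑₂-cong-∈ : ∀ (s : Split A) x {F G : A → A → ℚ} →
            (∀ {k l} → (k , l) ∈ s x → F k l ≡ G k l) → ∑₂ s x F ≡ ∑₂ s x G
∑₂-cong-∈ s x {F} {G} F≗G = ∑-cong-All {xs = s x}
  {λ kl → F (proj₁ kl) (proj₂ kl)} {λ kl → G (proj₁ kl) (proj₂ kl)} (All.tabulate F≗G)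

∑ʳ-additive : ∀ {h} → (∀ e f → h (e ℕ.+ f) ≡ h e ℕ.+ h f) →
              ∀ (q r : Vec ℕ J) → ∑ʳ h (Vec.zipWith ℕ._+_ q r) ≡ ∑ʳ h q ℕ.+ ∑ʳ h r
∑ʳ-additive h+ []      []      = refl
∑ʳ-additive {h = h} h+ (e ∷ q) (f ∷ r) = trans (cong₂ ℕ._+_ (h+ e f) (∑ʳ-additive h+ q r))
  (ℕ+.interchange (h e) (h f) _ _)

∑ᴹ-additive : ∀ {h} → (∀ i e f → h i (e ℕ.+ f) ≡ h i e ℕ.+ h i f) →
              ∀ (k l : Monomial I J) → ∑ᴹ h (k ⊞ l) ≡ ∑ᴹ h k ℕ.+ ∑ᴹ h l
∑ᴹ-additive h+ []      []      = refl
∑ᴹ-additive {h = h} h+ (q ∷ k) (r ∷ l) = trans (cong₂ ℕ._+_ (∑ʳ-additive (h+ 0) q r) (∑ᴹ-additive (h+ ∘ suc) k l))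
  (ℕ+.interchange (∑ʳ (h 0) q) (∑ʳ (h 0) r) _ _)

deg-⊞ : ∀ (k l : Monomial I J) → deg (k ⊞ l) ≡ deg k ℕ.+ deg l
deg-⊞ k l = begin
  deg (k ⊞ l)           ≡⟨ deg≡∑ᴹ (k ⊞ l) ⟩
  ∑ᴹ _ (k ⊞ l)          ≡⟨ ∑ᴹ-additive (λ i → ℕ.*-distribˡ-+ (suc i)) k l ⟩
  ∑ᴹ _ k ℕ.+ ∑ᴹ _ l     ≡⟨ cong₂ ℕ._+_ (deg≡∑ᴹ k) (deg≡∑ᴹ l) ⟨
  deg k ℕ.+ deg l       ∎
  where open ≡-Reasoning

-- The coefficients of c (x + x² + ⋯); for c = 1 this series is ε x u′ / u, for both choices of u.
p₀ : ℚ → ℕ → ℚ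
p₀ c e = guard (not (e ℕ.≡ᵇ 0)) c

pʳ : ℚ → Vec ℕ J → ℚ
pʳ c []      = 0ℚ
pʳ c (e ∷ r) = guard (isZeroRow r) (p₀ c e) + guard (e ℕ.≡ᵇ 0) (pʳ c r)

-- For `w = id` these are the coefficients of the sum of all P_d with d ≥ 1: nonzero only at
-- positive powers of a single indeterminate, with its degree as value. The P_d are the homogeneous
-- components, as the F_d are those of `uᴹ u`.
pᴹ : (ℕ → ℕ) → Monomial I J → ℚ
pᴹ w []      = 0ℚ
pᴹ w (r ∷ m) = guard (isZero m) (pʳ (fromℕ (suc (w 0))) r) + guard (isZeroRow r) (pᴹ (w ∘ suc) m)

∑-allFin : ∀ (f : Fin (suc n) → ℚ) → ∑ (allFin (suc n)) f ≡ f Fin.zero + ∑ (allFin n) (f ∘ Fin.suc)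
∑-allFin f = cong (λ qs → f Fin.zero + foldr _+_ 0ℚ qs) (map-tail-allFin f)

row : Fin J → ℕ → Vec ℕ J
row {J} j e = Vec.replicate J 0 Vec.[ j ]≔ e

_≟ʳ_ : (q r : Vec ℕ J) → Dec (q ≡ r)
_≟ʳ_ = Vec.≡-dec ℕ._≟_

isZeroRow-≟ : ∀ (r : Vec ℕ J) → does (r ≟ʳ Vec.replicate J 0) ≡ isZeroRow r
isZeroRow-≟ []      = refl
isZeroRow-≟ (e ∷ r) = cong ((e ℕ.≡ᵇ 0) ∧_) (isZeroRow-≟ r)

isZero-≟ : ∀ (m : Monomial I J) → does (m ≟ᴹ Vec.replicate I (Vec.replicate J 0)) ≡ isZero m
isZero-≟ []      = refl
isZero-≟ (r ∷ m) = cong₂ _∧_ (isZeroRow-≟ r) (isZero-≟ m)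

-- Coefficients of power sums

guard-comm : ∀ b c q → guard b (guard c q) ≡ guard c (guard b q)
guard-comm b true  q = refl
guard-comm b false q = guard-0 b

-- Each summand tests only the degree of its own part, but its guard forces the other part to have
-- degree 0, so both tests are tests of the total degree.
guard-graded-+ : ∀ a b d p q →
  guard (b ℕ.≡ᵇ 0) (guard (a ℕ.≡ᵇ suc d) p) + guard (a ℕ.≡ᵇ 0) (guard (b ℕ.≡ᵇ suc d) q)
    ≡ guard (a ℕ.+ b ℕ.≡ᵇ suc d) (guard (b ℕ.≡ᵇ 0) p + guard (a ℕ.≡ᵇ 0) q)
guard-graded-+ zero    zero    d p q = refl
guard-graded-+ zero    (suc b) d p q = trans (ℚ.+-identityˡ _)
  (cong (guard (b ℕ.≡ᵇ d)) (sym (ℚ.+-identityˡ q)))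
guard-graded-+ (suc a) zero    d p q rewrite ℕ.+-identityʳ a = trans (ℚ.+-identityʳ _)
  (cong (guard (a ℕ.≡ᵇ d)) (sym (ℚ.+-identityʳ p)))
guard-graded-+ (suc a) (suc b) d p q = sym (guard-0 (a ℕ.+ suc b ℕ.≡ᵇ d))

sum≡ᵇ0 : ∀ (r : Vec ℕ J) → (Vec.sum r ℕ.≡ᵇ 0) ≡ isZeroRow r
sum≡ᵇ0 []      = refl
sum≡ᵇ0 (e ∷ r) = trans (+≡ᵇ0 e (Vec.sum r)) (cong ((e ℕ.≡ᵇ 0) ∧_) (sum≡ᵇ0 r))

-- The exponent has to be positive: the rows `row j 0` coincide for all `j`, so the zero row would
-- be counted `J` times.
∑-row : ∀ c e (r : Vec ℕ J) → ∑[ j ∈ allFin J ] guard (does (r ≟ʳ row j (suc e))) c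
                             ≡ guard (Vec.sum r ℕ.≡ᵇ suc e) (pʳ c r)
∑-row c e []      = refl
∑-row {J = suc J} c e (k ∷ r) = begin
  ∑[ j ∈ allFin (suc J) ] guard (does ((k ∷ r) ≟ʳ row j (suc e))) c
    ≡⟨ ∑-allFin (λ j → guard (does ((k ∷ r) ≟ʳ row j (suc e))) c) ⟩
  guard ((k ℕ.≡ᵇ suc e) ∧ does (r ≟ʳ Vec.replicate J 0)) c
    + ∑[ j ∈ allFin J ] guard ((k ℕ.≡ᵇ 0) ∧ does (r ≟ʳ row j (suc e))) c
    ≡⟨ cong₂ _+_ head tail ⟩
  guard (Vec.sum r ℕ.≡ᵇ 0) (guard (k ℕ.≡ᵇ suc e) (p₀ c k)) + guard (k ℕ.≡ᵇ 0) (guard (Vec.sum r ℕ.≡ᵇ suc e) (pʳ c r))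
    ≡⟨ guard-graded-+ k (Vec.sum r) e (p₀ c k) (pʳ c r) ⟩
  guard (k ℕ.+ Vec.sum r ℕ.≡ᵇ suc e) (guard (Vec.sum r ℕ.≡ᵇ 0) (p₀ c k) + guard (k ℕ.≡ᵇ 0) (pʳ c r))
    ≡⟨ cong (λ b → guard (k ℕ.+ Vec.sum r ℕ.≡ᵇ suc e) (guard b (p₀ c k) + guard (k ℕ.≡ᵇ 0) (pʳ c r))) (sum≡ᵇ0 r) ⟩
  guard (k ℕ.+ Vec.sum r ℕ.≡ᵇ suc e) (pʳ c (k ∷ r)) ∎
  where
  open ≡-Reasoning

  p₀-suc : ∀ k → guard (k ℕ.≡ᵇ suc e) c ≡ guard (k ℕ.≡ᵇ suc e) (p₀ c k)
  p₀-suc zero    = refl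
  p₀-suc (suc k) = refl

  head : guard ((k ℕ.≡ᵇ suc e) ∧ does (r ≟ʳ Vec.replicate J 0)) c
         ≡ guard (Vec.sum r ℕ.≡ᵇ 0) (guard (k ℕ.≡ᵇ suc e) (p₀ c k))
  head = begin
    guard ((k ℕ.≡ᵇ suc e) ∧ does (r ≟ʳ Vec.replicate J 0)) c
      ≡⟨ guard-∧ (k ℕ.≡ᵇ suc e) _ c ⟨
    guard (k ℕ.≡ᵇ suc e) (guard (does (r ≟ʳ Vec.replicate J 0)) c)
      ≡⟨ guard-comm (k ℕ.≡ᵇ suc e) _ c ⟩
    guard (does (r ≟ʳ Vec.replicate J 0)) (guard (k ℕ.≡ᵇ suc e) c)
      ≡⟨ cong₂ guard (trans (isZeroRow-≟ r) (sym (sum≡ᵇ0 r))) (p₀-suc k) ⟩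
    guard (Vec.sum r ℕ.≡ᵇ 0) (guard (k ℕ.≡ᵇ suc e) (p₀ c k)) ∎

  tail : ∑[ j ∈ allFin J ] guard ((k ℕ.≡ᵇ 0) ∧ does (r ≟ʳ row j (suc e))) c
         ≡ guard (k ℕ.≡ᵇ 0) (guard (Vec.sum r ℕ.≡ᵇ suc e) (pʳ c r))
  tail = begin
    ∑[ j ∈ allFin J ] guard ((k ℕ.≡ᵇ 0) ∧ does (r ≟ʳ row j (suc e))) c
      ≡⟨ ∑-cong (allFin J) (λ j → guard-∧ (k ℕ.≡ᵇ 0) _ c) ⟨
    ∑[ j ∈ allFin J ] guard (k ℕ.≡ᵇ 0) (guard (does (r ≟ʳ row j (suc e))) c)
      ≡⟨ ∑-guard (allFin J) (k ℕ.≡ᵇ 0) (λ j → guard (does (r ≟ʳ row j (suc e))) c) ⟩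
    guard (k ℕ.≡ᵇ 0) (∑[ j ∈ allFin J ] guard (does (r ≟ʳ row j (suc e))) c)
      ≡⟨ cong (guard (k ℕ.≡ᵇ 0)) (∑-row c e r) ⟩
    guard (k ℕ.≡ᵇ 0) (guard (Vec.sum r ℕ.≡ᵇ suc e) (pʳ c r)) ∎

∑-row-/ : ∀ c w d (r : Vec ℕ J) →
  guard (does (suc w ∣? suc d)) (∑[ j ∈ allFin J ] guard (does (r ≟ʳ row j (suc d / suc w))) c)
    ≡ guard (∑ʳ (suc w ℕ.*_) r ℕ.≡ᵇ suc d) (pʳ c r)
∑-row-/ {J} c w d r = trans
  (guard-cong (suc w ∣? suc d) λ w∣d → subst
    (λ e → ∑[ j ∈ allFin J ] guard (does (r ≟ʳ row j e)) c ≡ guard (Vec.sum r ℕ.≡ᵇ e) (pʳ c r))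
    -- The quotient is positive because `suc w` divides `suc d`; hence it is a successor, as `∑-row`
    -- demands.
    (ℕ.suc-pred (suc d / suc w) {{ℕ.>-nonZero (m≥n⇒m/n>0 (∣⇒≤ w∣d))}})
    (∑-row c (ℕ.pred (suc d / suc w)) r))
  (trans (guard-∧ (does (suc w ∣? suc d)) _ _)
    (guard-⇔ (suc w ∣? suc d ×-dec (Vec.sum r ℕ.≟ suc d / suc w)) (∑ʳ (suc w ℕ.*_) r ℕ.≟ suc d)
      (λ { (w∣d , eq) → trans (∑ʳ-linear (suc w) r) (trans (cong (suc w ℕ.*_) eq) (m*[n/m]≡n w∣d)) })
      (λ eq → let eq′ = trans (sym eq) (∑ʳ-linear (suc w) r) in
        subst (suc w ∣_) (sym eq′) (m∣m*n (Vec.sum r)) ,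
        sym (trans (cong (_/ suc w) (trans eq′ (ℕ.*-comm (suc w) (Vec.sum r)))) (m*n/n≡m (Vec.sum r) (suc w))))
      (pʳ c r)))

∑-powers : ∀ w d (m : Monomial I J) →
  ∑[ i ∈ allFin I ] guard (does (suc (w (toℕ i)) ∣? suc d))
    (∑[ j ∈ allFin J ] guard (does (m ≟ᴹ (x[ i , j ]^ (suc d / suc (w (toℕ i)))))) (fromℕ (suc (w (toℕ i)))))
    ≡ guard (∑ᴹ (λ i e → suc (w i) ℕ.* e) m ℕ.≡ᵇ suc d) (pᴹ w m)
∑-powers w d []      = refl
∑-powers {I = suc I} {J = J} w d (r ∷ m) = begin
  ∑ (allFin (suc I)) f
    ≡⟨ ∑-allFin f ⟩
  f Fin.zero + ∑ (allFin I) (f ∘ Fin.suc)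
    ≡⟨ cong₂ _+_ head tail ⟩
  guard (∑m ℕ.≡ᵇ 0) (guard (∑r ℕ.≡ᵇ suc d) (pʳ (fromℕ (suc (w 0))) r)) + guard (∑r ℕ.≡ᵇ 0) (guard (∑m ℕ.≡ᵇ suc d) (pᴹ (w ∘ suc) m))
    ≡⟨ guard-graded-+ ∑r ∑m d (pʳ (fromℕ (suc (w 0))) r) (pᴹ (w ∘ suc) m) ⟩
  guard (∑r ℕ.+ ∑m ℕ.≡ᵇ suc d) (guard (∑m ℕ.≡ᵇ 0) (pʳ (fromℕ (suc (w 0))) r) + guard (∑r ℕ.≡ᵇ 0) (pᴹ (w ∘ suc) m))
    ≡⟨ cong (guard (∑r ℕ.+ ∑m ℕ.≡ᵇ suc d)) (cong₂ (λ b c → guard b (pʳ (fromℕ (suc (w 0))) r) + guard c (pᴹ (w ∘ suc) m)) ∑m≡ᵇ0 ∑r≡ᵇ0) ⟩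
  guard (∑r ℕ.+ ∑m ℕ.≡ᵇ suc d) (pᴹ w (r ∷ m)) ∎
  where
  open ≡-Reasoning

  f : Fin (suc I) → ℚ
  f i = guard (does (suc (w (toℕ i)) ∣? suc d))
    (∑[ j ∈ allFin J ] guard (does ((r ∷ m) ≟ᴹ (x[ i , j ]^ (suc d / suc (w (toℕ i)))))) (fromℕ (suc (w (toℕ i)))))

  ∑r ∑m : ℕ
  ∑r = ∑ʳ (suc (w 0) ℕ.*_) r
  ∑m = ∑ᴹ (λ i e → suc (w (suc i)) ℕ.* e) m

  ∑r≡ᵇ0 : (∑r ℕ.≡ᵇ 0) ≡ isZeroRow r
  ∑r≡ᵇ0 = ∑ʳ-≡ᵇ0 (suc*≡ᵇ0 (w 0)) r

  ∑m≡ᵇ0 : (∑m ℕ.≡ᵇ 0) ≡ isZero m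
  ∑m≡ᵇ0 = ∑ᴹ-≡ᵇ0 (λ i → suc*≡ᵇ0 (w (suc i))) m

  c : ℚ
  c = fromℕ (suc (w 0))

  head : f Fin.zero ≡ guard (∑m ℕ.≡ᵇ 0) (guard (∑r ℕ.≡ᵇ suc d) (pʳ c r))
  head = begin
    guard (does (suc (w 0) ∣? suc d)) (∑[ j ∈ allFin J ]
      guard (does (r ≟ʳ row j (suc d / suc (w 0))) ∧ does (m ≟ᴹ Vec.replicate I (Vec.replicate J 0))) c)
      ≡⟨ cong (guard (does (suc (w 0) ∣? suc d))) (trans
           (∑-cong (allFin J) (λ j → trans
             (cong (λ b → guard b c) (trans (∧-comm (does (r ≟ʳ row j (suc d / suc (w 0)))) _)
               (cong (_∧ _) (trans (isZero-≟ m) (sym ∑m≡ᵇ0)))))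
             (sym (guard-∧ (∑m ℕ.≡ᵇ 0) _ c))))
           (∑-guard (allFin J) (∑m ℕ.≡ᵇ 0) (λ j → guard (does (r ≟ʳ row j (suc d / suc (w 0)))) c))) ⟩
    guard (does (suc (w 0) ∣? suc d)) (guard (∑m ℕ.≡ᵇ 0) (∑[ j ∈ allFin J ] guard (does (r ≟ʳ row j (suc d / suc (w 0)))) c))
      ≡⟨ guard-comm (does (suc (w 0) ∣? suc d)) (∑m ℕ.≡ᵇ 0) _ ⟩
    guard (∑m ℕ.≡ᵇ 0) (guard (does (suc (w 0) ∣? suc d)) (∑[ j ∈ allFin J ] guard (does (r ≟ʳ row j (suc d / suc (w 0)))) c))
      ≡⟨ cong (guard (∑m ℕ.≡ᵇ 0)) (∑-row-/ c (w 0) d r) ⟩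
    guard (∑m ℕ.≡ᵇ 0) (guard (∑r ℕ.≡ᵇ suc d) (pʳ c r)) ∎

  tail : ∑ (allFin I) (f ∘ Fin.suc) ≡ guard (∑r ℕ.≡ᵇ 0) (guard (∑m ℕ.≡ᵇ suc d) (pᴹ (w ∘ suc) m))
  tail = begin
    ∑ (allFin I) (f ∘ Fin.suc)
      ≡⟨ ∑-cong (allFin I) (λ i → let v = suc (w (suc (toℕ i))) in trans
           (cong (guard (does (v ∣? suc d))) (trans
             (∑-cong (allFin J) (λ j → trans
               (cong (λ b → guard (b ∧ does (m ≟ᴹ (x[ i , j ]^ (suc d / v)))) (fromℕ v)) (trans (isZeroRow-≟ r) (sym ∑r≡ᵇ0)))
               (sym (guard-∧ (∑r ℕ.≡ᵇ 0) (does (m ≟ᴹ (x[ i , j ]^ (suc d / v)))) (fromℕ v)))))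
             (∑-guard (allFin J) (∑r ℕ.≡ᵇ 0) (λ j → guard (does (m ≟ᴹ (x[ i , j ]^ (suc d / v)))) (fromℕ v)))))
           (guard-comm (does (v ∣? suc d)) (∑r ℕ.≡ᵇ 0) _)) ⟩
    ∑[ i ∈ allFin I ] guard (∑r ℕ.≡ᵇ 0) (g i)
      ≡⟨ ∑-guard (allFin I) (∑r ℕ.≡ᵇ 0) g ⟩
    guard (∑r ℕ.≡ᵇ 0) (∑ (allFin I) g)
      ≡⟨ cong (guard (∑r ℕ.≡ᵇ 0)) (∑-powers (w ∘ suc) d m) ⟩
    guard (∑r ℕ.≡ᵇ 0) (guard (∑m ℕ.≡ᵇ suc d) (pᴹ (w ∘ suc) m)) ∎
    where
    g : Fin I → ℚ
    g i = guard (does (suc (w (suc (toℕ i))) ∣? suc d))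
      (∑[ j ∈ allFin J ] guard (does (m ≟ᴹ (x[ i , j ]^ (suc d / suc (w (suc (toℕ i))))))) (fromℕ (suc (w (suc (toℕ i))))))

coeff-P : ∀ d (m : Monomial I J) → coeff (P (suc d)) m ≡ guard (deg m ℕ.≡ᵇ suc d) (pᴹ id m)
coeff-P {I} {J} d m = trans
  (∑-filter (λ i → suc (toℕ i) ∣? suc d) (allFin I) (λ i →
    ∑[ j ∈ allFin J ] guard (does (m ≟ᴹ (x[ i , j ]^ (suc d / suc (toℕ i))))) (fromℕ (suc (toℕ i)))))
  (trans (∑-powers id d m) (cong (λ k → guard (k ℕ.≡ᵇ suc d) (pᴹ id m)) (sym (deg≡∑ᴹ m))))

-- Newton's identities

uʳ : (ℕ → ℚ) → Vec ℕ J → ℚ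
uʳ u []      = 1ℚ
uʳ u (e ∷ r) = u e * uʳ u r

uᴹ : (ℕ → ℚ) → Monomial I J → ℚ
uᴹ u []      = 1ℚ
uᴹ u (r ∷ m) = uʳ u r * uᴹ u m

∑₂-+ : ∀ (s : Split A) x F G → ∑₂ s x (λ k l → F k l + G k l) ≡ ∑₂ s x F + ∑₂ s x G
∑₂-+ s x F G = ∑-+ (s x) (λ kl → F (proj₁ kl) (proj₂ kl)) (λ kl → G (proj₁ kl) (proj₂ kl))

∑₂-guard : ∀ (s : Split A) x b F → ∑₂ s x (λ k l → guard b (F k l)) ≡ guard b (∑₂ s x F)
∑₂-guard s x b F = ∑-guard (s x) b (λ kl → F (proj₁ kl) (proj₂ kl))

∑₂-*ˡ : ∀ (s : Split A) x q F → q * ∑₂ s x F ≡ ∑₂ s x (λ k l → q * F k l)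
∑₂-*ˡ s x q F = ∑-*ˡ (s x) q (λ kl → F (proj₁ kl) (proj₂ kl))

∑₂-*ʳ : ∀ (s : Split A) x q F → ∑₂ s x F * q ≡ ∑₂ s x (λ k l → F k l * q)
∑₂-*ʳ s x q F = ∑-*ʳ (s x) q (λ kl → F (proj₁ kl) (proj₂ kl))

-- Leibniz rule: if p₁ · U₁ and p₂ · U₂ are the derivatives of U₁ and U₂ in two sets
-- of variables, then (p₁ + p₂) · U₁ U₂ is the derivative of U₁ U₂.
∑₂-splitVec-leibniz : ∀ {s : Split A} {z : A → Bool} {zs : Vec A n → Bool} →
  Counital z s → Counital zs (splitVec s) →
  ∀ (p U : A → ℚ) (ps Us : Vec A n → ℚ) x v →
  ∑₂ s x (λ k l → ∑₂ (splitVec s) v (λ u w → (guard (zs u) (p k) + guard (z k) (ps u)) * (U l * Us w)))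
    ≡ ∑₂ s x (λ k l → p k * U l) * Us v + U x * ∑₂ (splitVec s) v (λ u w → ps u * Us w)
∑₂-splitVec-leibniz {s = s} {z} {zs} counit counits p U ps Us x v = begin
  ∑₂ s x (λ k l → ∑₂ (splitVec s) v (λ u w → (guard (zs u) (p k) + guard (z k) (ps u)) * (U l * Us w)))
    ≡⟨ ∑₂-cong s x (λ k l → trans
         (∑₂-cong (splitVec s) v λ u w → trans
           (ℚ.*-distribʳ-+ (U l * Us w) (guard (zs u) (p k)) (guard (z k) (ps u)))
           (cong₂ _+_ (guard-*ˡ (zs u) (p k) (U l * Us w)) (guard-*ˡ (z k) (ps u) (U l * Us w))))
         (∑₂-+ (splitVec s) v (λ u w → guard (zs u) (p k * (U l * Us w))) (λ u w → guard (z k) (ps u * (U l * Us w))))) ⟩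
  ∑₂ s x (λ k l → ∑₂ (splitVec s) v (λ u w → guard (zs u) (p k * (U l * Us w)))
                + ∑₂ (splitVec s) v (λ u w → guard (z k) (ps u * (U l * Us w))))
    ≡⟨ ∑₂-+ s x (λ k l → ∑₂ (splitVec s) v (λ u w → guard (zs u) (p k * (U l * Us w))))
                (λ k l → ∑₂ (splitVec s) v (λ u w → guard (z k) (ps u * (U l * Us w)))) ⟩
  ∑₂ s x (λ k l → ∑₂ (splitVec s) v (λ u w → guard (zs u) (p k * (U l * Us w))))
    + ∑₂ s x (λ k l → ∑₂ (splitVec s) v (λ u w → guard (z k) (ps u * (U l * Us w))))
    ≡⟨ cong₂ _+_
         (trans (∑₂-cong s x λ k l → trans (counits v (λ w → p k * (U l * Us w))) (sym (ℚ.*-assoc (p k) (U l) (Us v))))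
                (sym (∑₂-*ʳ s x (Us v) (λ k l → p k * U l))))
         (trans (∑₂-cong s x λ k l → ∑₂-guard (splitVec s) v (z k) (λ u w → ps u * (U l * Us w)))
           (trans (counit x (λ l → ∑₂ (splitVec s) v (λ u w → ps u * (U l * Us w))))
             (trans (∑₂-cong (splitVec s) v λ u w → ℚ*.x∙yz≈y∙xz (ps u) (U x) (Us w))
                    (sym (∑₂-*ˡ (splitVec s) v (U x) (λ u w → ps u * Us w)))))) ⟩
  ∑₂ s x (λ k l → p k * U l) * Us v + U x * ∑₂ (splitVec s) v (λ u w → ps u * Us w) ∎
  where open ≡-Reasoning

-- The field `newton` is the differential equation (x + x² + ⋯) u = ε x u′, solved by u = 1 / (1 -
-- x) with ε = 1 and by u = 1 - x with ε = -1. Through these fields `H` and `E` are treated alike.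
record IsGenerating (u : ℕ → ℚ) (ε : ℚ) : Set where
  field
    u-0    : u 0 ≡ 1ℚ
    newton : ∀ e → ∑₂ splitℕ e (λ k l → guard (not (k ℕ.≡ᵇ 0)) (u l)) ≡ ε * (fromℕ e * u e)
    ε²     : ε * ε ≡ 1ℚ

  u-1 : u 1 ≡ ε
  u-1 = begin
    u 1                     ≡⟨ ℚ.*-identityˡ (u 1) ⟨
    1ℚ * u 1                ≡⟨ cong (_* u 1) ε² ⟨
    ε * ε * u 1             ≡⟨ ℚ.*-assoc ε ε (u 1) ⟩
    ε * (ε * u 1)           ≡⟨ cong (λ q → ε * (ε * q)) (ℚ.*-identityˡ (u 1)) ⟨
    ε * (ε * (1ℚ * u 1))    ≡⟨ cong (ε *_) (newton 1) ⟨
    ε * ∑₂ splitℕ 1 (λ k l → guard (not (k ℕ.≡ᵇ 0)) (u l)) ≡⟨ cong (ε *_) (trans (∑₂-splitℕ-suc 0 _) (trans (ℚ.+-identityˡ _) (∑₂-splitℕ-0 _))) ⟩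
    ε * u 0                 ≡⟨ cong (ε *_) u-0 ⟩
    ε * 1ℚ                  ≡⟨ ℚ.*-identityʳ ε ⟩
    ε                       ∎
    where open ≡-Reasoning

  ε-cancel : ∀ s q → ε * s * (ε * q) ≡ s * q
  ε-cancel s q = trans (ℚ*.interchange ε s ε q) (trans (cong (_* (s * q)) ε²) (ℚ.*-identityˡ (s * q)))

  private
    step : ∀ d e U Us → ε * (fromℕ d * U) * Us + U * (ε * (fromℕ e * Us)) ≡ ε * (fromℕ (d ℕ.+ e) * (U * Us))
    step d e U Us = begin
      ε * (fromℕ d * U) * Us + U * (ε * (fromℕ e * Us))
        ≡⟨ cong₂ _+_ (trans (ℚ.*-assoc ε (fromℕ d * U) Us) (cong (ε *_) (ℚ.*-assoc (fromℕ d) U Us)))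
                     (trans (ℚ*.x∙yz≈y∙xz U ε (fromℕ e * Us)) (cong (ε *_) (ℚ*.x∙yz≈y∙xz U (fromℕ e) Us))) ⟩
      ε * (fromℕ d * (U * Us)) + ε * (fromℕ e * (U * Us))
        ≡⟨ ℚ.*-distribˡ-+ ε _ _ ⟨
      ε * (fromℕ d * (U * Us) + fromℕ e * (U * Us))
        ≡⟨ cong (ε *_) (ℚ.*-distribʳ-+ (U * Us) (fromℕ d) (fromℕ e)) ⟨
      ε * ((fromℕ d + fromℕ e) * (U * Us))
        ≡⟨ cong (λ q → ε * (q * (U * Us))) (fromℕ-+ d e) ⟨
      ε * (fromℕ (d ℕ.+ e) * (U * Us)) ∎
      where open ≡-Reasoning

  newtonʳ : ∀ w (r : Vec ℕ J) → ∑₂ (splitVec splitℕ) r (λ k l → pʳ (fromℕ w) k * uʳ u l)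
                               ≡ ε * (fromℕ (∑ʳ (w ℕ.*_) r) * uʳ u r)
  newtonʳ w []      = sym (ℚ.*-zeroʳ ε)
  newtonʳ w (e ∷ r) = begin
    ∑₂ (splitVec splitℕ) (e ∷ r) (λ k l → pʳ (fromℕ w) k * uʳ u l)
      ≡⟨ ∑₂-splitVec splitℕ e r (λ k l → pʳ (fromℕ w) k * uʳ u l) ⟩
    ∑₂ splitℕ e (λ k l → ∑₂ (splitVec splitℕ) r (λ k′ l′ →
      (guard (isZeroRow k′) (p₀ (fromℕ w) k) + guard (k ℕ.≡ᵇ 0) (pʳ (fromℕ w) k′)) * (u l * uʳ u l′)))
      ≡⟨ ∑₂-splitVec-leibniz {z = ℕ._≡ᵇ 0} {isZeroRow} splitℕ-counit counits (p₀ (fromℕ w)) u (pʳ (fromℕ w)) (uʳ u) e r ⟩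
    ∑₂ splitℕ e (λ k l → p₀ (fromℕ w) k * u l) * uʳ u r
      + u e * ∑₂ (splitVec splitℕ) r (λ k l → pʳ (fromℕ w) k * uʳ u l)
      ≡⟨ cong₂ (λ p q → p * uʳ u r + u e * q) head (newtonʳ w r) ⟩
    ε * (fromℕ (w ℕ.* e) * u e) * uʳ u r + u e * (ε * (fromℕ (∑ʳ (w ℕ.*_) r) * uʳ u r))
      ≡⟨ step (w ℕ.* e) (∑ʳ (w ℕ.*_) r) (u e) (uʳ u r) ⟩
    ε * (fromℕ (∑ʳ (w ℕ.*_) (e ∷ r)) * (u e * uʳ u r)) ∎
    where
    open ≡-Reasoning
    counits : Counital isZeroRow (splitVec splitℕ)
    counits = splitVec-counit splitℕ (ℕ._≡ᵇ 0) splitℕ-counit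

    head : ∑₂ splitℕ e (λ k l → p₀ (fromℕ w) k * u l) ≡ ε * (fromℕ (w ℕ.* e) * u e)
    head = begin
      ∑₂ splitℕ e (λ k l → p₀ (fromℕ w) k * u l)
        ≡⟨ ∑₂-cong splitℕ e (λ k l → trans (guard-*ˡ (not (k ℕ.≡ᵇ 0)) (fromℕ w) (u l))
             (sym (guard-*ʳ (not (k ℕ.≡ᵇ 0)) (fromℕ w) (u l)))) ⟩
      ∑₂ splitℕ e (λ k l → fromℕ w * guard (not (k ℕ.≡ᵇ 0)) (u l))
        ≡⟨ ∑₂-*ˡ splitℕ e (fromℕ w) (λ k l → guard (not (k ℕ.≡ᵇ 0)) (u l)) ⟨
      fromℕ w * ∑₂ splitℕ e (λ k l → guard (not (k ℕ.≡ᵇ 0)) (u l))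
        ≡⟨ cong (fromℕ w *_) (newton e) ⟩
      fromℕ w * (ε * (fromℕ e * u e))
        ≡⟨ ℚ*.x∙yz≈y∙xz (fromℕ w) ε (fromℕ e * u e) ⟩
      ε * (fromℕ w * (fromℕ e * u e))
        ≡⟨ cong (ε *_) (trans (sym (ℚ.*-assoc (fromℕ w) (fromℕ e) (u e))) (cong (_* u e) (sym (fromℕ-* w e)))) ⟩
      ε * (fromℕ (w ℕ.* e) * u e) ∎

  -- The Leibniz rule adds up the equations of the single indeterminates. The constants in `pᴹ` are
  -- the degrees of the indeterminates, which turns the exponents `e` into their contributions
  -- `suc (w i) * e` to the degree.
  newtonⱽ : ∀ w (m : Monomial I J) → ∑₂ (splitVec (splitVec splitℕ)) m (λ k l → pᴹ w k * uᴹ u l)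
                                   ≡ ε * (fromℕ (∑ᴹ (λ i e → suc (w i) ℕ.* e) m) * uᴹ u m)
  newtonⱽ w []      = sym (ℚ.*-zeroʳ ε)
  newtonⱽ w (r ∷ m) = begin
    ∑₂ (splitVec (splitVec splitℕ)) (r ∷ m) (λ k l → pᴹ w k * uᴹ u l)
      ≡⟨ ∑₂-splitVec (splitVec splitℕ) r m (λ k l → pᴹ w k * uᴹ u l) ⟩
    ∑₂ (splitVec splitℕ) r (λ k l → ∑₂ (splitVec (splitVec splitℕ)) m (λ k′ l′ →
      (guard (isZero k′) (pʳ (fromℕ (suc (w 0))) k) + guard (isZeroRow k) (pᴹ (w ∘ suc) k′)) * (uʳ u l * uᴹ u l′)))
      ≡⟨ ∑₂-splitVec-leibniz {z = isZeroRow} {isZero} counitr counits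
           (pʳ (fromℕ (suc (w 0)))) (uʳ u) (pᴹ (w ∘ suc)) (uᴹ u) r m ⟩
    ∑₂ (splitVec splitℕ) r (λ k l → pʳ (fromℕ (suc (w 0))) k * uʳ u l) * uᴹ u m
      + uʳ u r * ∑₂ (splitVec (splitVec splitℕ)) m (λ k l → pᴹ (w ∘ suc) k * uᴹ u l)
      ≡⟨ cong₂ (λ p q → p * uᴹ u m + uʳ u r * q) (newtonʳ (suc (w 0)) r) (newtonⱽ (w ∘ suc) m) ⟩
    ε * (fromℕ (∑ʳ (suc (w 0) ℕ.*_) r) * uʳ u r) * uᴹ u m
      + uʳ u r * (ε * (fromℕ (∑ᴹ (λ i e → suc (w (suc i)) ℕ.* e) m) * uᴹ u m))
      ≡⟨ step (∑ʳ (suc (w 0) ℕ.*_) r) (∑ᴹ (λ i e → suc (w (suc i)) ℕ.* e) m) (uʳ u r) (uᴹ u m) ⟩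
    ε * (fromℕ (∑ᴹ (λ i e → suc (w i) ℕ.* e) (r ∷ m)) * (uʳ u r * uᴹ u m)) ∎
    where
    open ≡-Reasoning
    counitr : ∀ {n} → Counital {A = Vec ℕ n} isZeroRow (splitVec splitℕ)
    counitr = splitVec-counit splitℕ (ℕ._≡ᵇ 0) splitℕ-counit
    counits : Counital isZero (splitVec (splitVec splitℕ))
    counits = splitVec-counit (splitVec splitℕ) isZeroRow counitr

  opaque
    unfolding splitℕ

    newtonᴹ : ∀ (m : Monomial I J) → ∑₂ factorizations m (λ k l → pᴹ id k * uᴹ u l) ≡ ε * (fromℕ (deg m) * uᴹ u m)
    newtonᴹ m = trans (newtonⱽ id m) (cong (λ d → ε * (fromℕ d * uᴹ u m)) (sym (deg≡∑ᴹ m)))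

open IsGenerating public

graded : (∀ {I J} → Monomial I J → ℚ) → ℕ → Series
coeff (graded f d) m = guard (deg m ℕ.≡ᵇ d) (f m)

-- Newton's identities contain P_k for k ≥ 1 only, so factorizations whose left factor has degree 0
-- must contribute nothing.
pᴹ-deg0 : ∀ (m : Monomial I J) → deg m ≡ 0 → pᴹ id m ≡ 0ℚ
pᴹ-deg0 m deg≡0 = zeroᴹ id m (trans (sym (deg≡ᵇ0 m)) (cong (ℕ._≡ᵇ 0) deg≡0))
  where
  zeroʳ : ∀ {J} c (r : Vec ℕ J) → isZeroRow r ≡ true → pʳ c r ≡ 0ℚ
  zeroʳ c []         _    = refl
  zeroʳ c (zero ∷ r) zero? = trans (cong₂ _+_ (guard-0 (isZeroRow r)) (zeroʳ c r zero?)) (ℚ.+-identityˡ 0ℚ)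

  zeroᴹ : ∀ {I J} w (m : Monomial I J) → isZero m ≡ true → pᴹ w m ≡ 0ℚ
  zeroᴹ w []      _ = refl
  zeroᴹ w (r ∷ m) zero? with isZeroRow r in r≡0
  ... | true = trans (cong₂ _+_ (trans (cong (guard (isZero m)) (zeroʳ _ r r≡0)) (guard-0 (isZero m))) (zeroᴹ (w ∘ suc) m zero?))
                     (ℚ.+-identityˡ 0ℚ)

∑-splitℕ-guard : ∀ a b d q → ∑₂ splitℕ d (λ k l → guard (a ℕ.≡ᵇ k) (guard (b ℕ.≡ᵇ l) q)) ≡ guard (a ℕ.+ b ℕ.≡ᵇ d) q
∑-splitℕ-guard zero b d q = trans
  (∑₂-cong splitℕ d λ { zero l → refl ; (suc k) l → refl }) (splitℕ-counit d (λ l → guard (b ℕ.≡ᵇ l) q))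
∑-splitℕ-guard (suc a) b zero    q = ∑₂-splitℕ-0 _
∑-splitℕ-guard (suc a) b (suc d) q = trans (∑₂-splitℕ-suc d _) (trans (ℚ.+-identityˡ _) (∑-splitℕ-guard a b d q))

module _ {u ε} (gen : IsGenerating u ε) where

  opaque
    unfolding _⊙_

    -- After the exchange of the two sums, each factorization into a and b with deg a > 0 meets
    -- exactly one possible pair of degrees, and meets it only if deg m is `suc d`. What is left is
    -- the ungraded identity `newtonᴹ`, in which deg m may be replaced by `suc d`.
    newton-identity : ∀ d → (ε * fromℕ (suc d)) • graded (uᴹ u) (suc d)
                          ≋ ⨁ (splitℕ d) (λ kl → P (suc (proj₁ kl)) ⊙ graded (uᴹ u) (proj₂ kl))
    newton-identity d = mk λ m → sym (begin
      ∑₂ splitℕ d (λ k l → ∑₂ factorizations m (λ a b → coeff (P (suc k)) a * guard (deg b ℕ.≡ᵇ l) (uᴹ u b)))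
        ≡⟨ ∑-swap (splitℕ d) (factorizations m) (λ kl ab →
             coeff (P (suc (proj₁ kl))) (proj₁ ab) * guard (deg (proj₂ ab) ℕ.≡ᵇ proj₂ kl) (uᴹ u (proj₂ ab))) ⟩
      ∑₂ factorizations m (λ a b → ∑₂ splitℕ d (λ k l → coeff (P (suc k)) a * guard (deg b ℕ.≡ᵇ l) (uᴹ u b)))
        ≡⟨ ∑₂-cong-∈ factorizations m (λ {a} {b} ab∈ → trans (inner a b)
             (cong (λ e → guard (e ℕ.≡ᵇ suc d) (pᴹ id a * uᴹ u b))
                   (trans (sym (deg-⊞ a b)) (cong deg (factorizations-∈⁻ m ab∈))))) ⟩
      ∑₂ factorizations m (λ a b → guard (deg m ℕ.≡ᵇ suc d) (pᴹ id a * uᴹ u b))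
        ≡⟨ ∑₂-guard factorizations m (deg m ℕ.≡ᵇ suc d) (λ a b → pᴹ id a * uᴹ u b) ⟩
      guard (deg m ℕ.≡ᵇ suc d) (∑₂ factorizations m (λ a b → pᴹ id a * uᴹ u b))
        ≡⟨ cong (guard (deg m ℕ.≡ᵇ suc d)) (newtonᴹ gen m) ⟩
      guard (deg m ℕ.≡ᵇ suc d) (ε * (fromℕ (deg m) * uᴹ u m))
        ≡⟨ guard-cong (deg m ℕ.≟ suc d) (λ eq → trans (cong (λ e → ε * (fromℕ e * uᴹ u m)) eq)
             (sym (ℚ.*-assoc ε (fromℕ (suc d)) (uᴹ u m)))) ⟩
      guard (deg m ℕ.≡ᵇ suc d) (ε * fromℕ (suc d) * uᴹ u m)
        ≡⟨ guard-*ʳ (deg m ℕ.≡ᵇ suc d) (ε * fromℕ (suc d)) (uᴹ u m) ⟨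
      ε * fromℕ (suc d) * guard (deg m ℕ.≡ᵇ suc d) (uᴹ u m) ∎)
      where
      open ≡-Reasoning

      inner : ∀ {I J} (a b : Monomial I J) →
        ∑₂ splitℕ d (λ k l → coeff (P (suc k)) a * guard (deg b ℕ.≡ᵇ l) (uᴹ u b))
          ≡ guard (deg a ℕ.+ deg b ℕ.≡ᵇ suc d) (pᴹ id a * uᴹ u b)
      inner a b = trans
        (∑₂-cong splitℕ d λ k l → trans (cong (_* guard (deg b ℕ.≡ᵇ l) (uᴹ u b)) (coeff-P k a))
          (trans (guard-* (deg a ℕ.≡ᵇ suc k) (deg b ℕ.≡ᵇ l) (pᴹ id a) (uᴹ u b))
                 (sym (guard-∧ (deg a ℕ.≡ᵇ suc k) (deg b ℕ.≡ᵇ l) (pᴹ id a * uᴹ u b)))))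
        (bydeg (deg a) refl)
        where
        q : ℚ
        q = pᴹ id a * uᴹ u b
        bydeg : ∀ e → deg a ≡ e →
          ∑₂ splitℕ d (λ k l → guard (e ℕ.≡ᵇ suc k) (guard (deg b ℕ.≡ᵇ l) q)) ≡ guard (e ℕ.+ deg b ℕ.≡ᵇ suc d) q
        bydeg zero    deg≡0 = trans (∑-0 (splitℕ d)) (sym (trans
          (cong (guard (deg b ℕ.≡ᵇ suc d)) (trans (cong (_* uᴹ u b) (pᴹ-deg0 a deg≡0)) (ℚ.*-zeroˡ (uᴹ u b))))
          (guard-0 (deg b ℕ.≡ᵇ suc d))))
        bydeg (suc e) _     = ∑-splitℕ-guard e (deg b) d q

-- Power sums as sums over compositions

module ℚ-Ring = RingProperties (CommutativeRing.ring ℚ.+-*-commutativeRing)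

alternating-+ : ∀ j k → alternating (j ℕ.+ k) ≡ alternating j * alternating k
alternating-+ zero    k = sym (ℚ.*-identityˡ (alternating k))
alternating-+ (suc j) k = trans (cong -_ (alternating-+ j k)) (ℚ.neg-distribˡ-* (alternating j) (alternating k))

uᴴ : ℕ → ℚ
uᴴ _ = 1ℚ

uᴱ : ℕ → ℚ
uᴱ 0 = 1ℚ
uᴱ 1 = - 1ℚ
uᴱ _ = 0ℚ

gradedᴴ : ∀ d → graded (uᴹ uᴴ) d ≋ H d
gradedᴴ d = mk λ m → cong (guard (deg m ℕ.≡ᵇ d)) (uᴹ≡1 m)
  where
  uʳ≡1 : ∀ {J} (r : Vec ℕ J) → uʳ uᴴ r ≡ 1ℚ
  uʳ≡1 []      = refl
  uʳ≡1 (e ∷ r) = trans (ℚ.*-identityˡ (uʳ uᴴ r)) (uʳ≡1 r)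

  uᴹ≡1 : ∀ {I J} (m : Monomial I J) → uᴹ uᴴ m ≡ 1ℚ
  uᴹ≡1 []      = refl
  uᴹ≡1 (r ∷ m) = trans (cong (_* uᴹ uᴴ m) (uʳ≡1 r)) (trans (ℚ.*-identityˡ (uᴹ uᴴ m)) (uᴹ≡1 m))

gradedᴱ : ∀ d → graded (uᴹ uᴱ) d ≋ E d
gradedᴱ d = mk λ m → trans (cong (guard (deg m ℕ.≡ᵇ d)) (uᴹ≡ m))
  (trans (guard-∧ (deg m ℕ.≡ᵇ d) (does (squareFree? m)) (alternating (#indeterminates m)))
         (cong (λ b → guard b (alternating (#indeterminates m))) (∧-comm (deg m ℕ.≡ᵇ d) (does (squareFree? m)))))
  where
  count : ∀ {J} → Vec ℕ J → ℕ
  count = Vec.count (0 ℕ.<?_)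

  uʳ≡ : ∀ {J} (r : Vec ℕ J) → uʳ uᴱ r ≡ guard (does (VecAll.all? (ℕ._≤? 1) r)) (alternating (count r))
  uʳ≡ []            = refl
  uʳ≡ (0 ∷ r)       = trans (ℚ.*-identityˡ (uʳ uᴱ r)) (uʳ≡ r)
  uʳ≡ (1 ∷ r)       = trans (cong (- 1ℚ *_) (uʳ≡ r)) (trans
    (guard-*ʳ (does (VecAll.all? (ℕ._≤? 1) r)) (- 1ℚ) (alternating (count r)))
    (cong (guard (does (VecAll.all? (ℕ._≤? 1) r))) (ℚ-Ring.-1*x≈-x (alternating (count r)))))
  uʳ≡ (suc (suc e) ∷ r) = ℚ.*-zeroˡ (uʳ uᴱ r)

  uᴹ≡ : ∀ {I J} (m : Monomial I J) → uᴹ uᴱ m ≡ guard (does (squareFree? m)) (alternating (#indeterminates m))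
  uᴹ≡ []      = refl
  uᴹ≡ (r ∷ m) = trans (cong₂ _*_ (uʳ≡ r) (uᴹ≡ m))
    (trans (guard-* (does (VecAll.all? (ℕ._≤? 1) r)) (does (squareFree? m)) (alternating (count r)) (alternating (#indeterminates m)))
           (cong (guard (does (squareFree? (r ∷ m)))) (sym (alternating-+ (count r) (#indeterminates m)))))

∑₂-splitℕ-1 : ∀ e → ∑₂ splitℕ e (λ k l → 1ℚ) ≡ fromℕ (suc e)
∑₂-splitℕ-1 zero    = ∑₂-splitℕ-0 (λ k l → 1ℚ)
∑₂-splitℕ-1 (suc e) = trans (∑₂-splitℕ-suc e (λ k l → 1ℚ))
  (trans (cong (1ℚ +_) (∑₂-splitℕ-1 e)) (sym (fromℕ-+ 1 (suc e))))

generatingᴴ : IsGenerating uᴴ 1ℚ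
generatingᴴ = record { u-0 = refl ; newton = newtonᴴ ; ε² = refl }
  where
  newtonᴴ : ∀ e → ∑₂ splitℕ e (λ k l → guard (not (k ℕ.≡ᵇ 0)) 1ℚ) ≡ 1ℚ * (fromℕ e * 1ℚ)
  newtonᴴ zero    = ∑₂-splitℕ-0 (λ k l → guard (not (k ℕ.≡ᵇ 0)) 1ℚ)
  newtonᴴ (suc e) = trans (∑₂-splitℕ-suc e (λ k l → guard (not (k ℕ.≡ᵇ 0)) 1ℚ))
    (trans (ℚ.+-identityˡ _) (trans (∑₂-splitℕ-1 e)
      (sym (trans (ℚ.*-identityˡ _) (ℚ.*-identityʳ (fromℕ (suc e)))))))

generatingᴱ : IsGenerating uᴱ (- 1ℚ)
generatingᴱ = record { u-0 = refl ; newton = newtonᴱ ; ε² = refl }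
  where
  -- Summing initial coefficients is multiplication by 1 / (1 - x), which takes 1 - x to 1.
  partial : ∀ e → ∑₂ splitℕ e (λ k l → uᴱ k) ≡ guard (e ℕ.≡ᵇ 0) 1ℚ
  partial 0             = ∑₂-splitℕ-0 (λ k l → uᴱ k)
  partial 1             = trans (∑₂-splitℕ-suc 0 (λ k l → uᴱ k)) (cong (1ℚ +_) (∑₂-splitℕ-0 (λ k l → uᴱ (suc k))))
  partial (suc (suc e)) = trans (∑₂-splitℕ-suc (suc e) (λ k l → uᴱ k))
    (cong (1ℚ +_) (trans (∑₂-splitℕ-suc e (λ k l → uᴱ (suc k))) (cong (- 1ℚ +_) (∑-0 (splitℕ e)))))

  rhs : ∀ e → guard (e ℕ.≡ᵇ 0) 1ℚ ≡ - 1ℚ * (fromℕ (suc e) * uᴱ (suc e))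
  rhs zero    = refl
  rhs (suc e) = sym (trans (cong (- 1ℚ *_) (ℚ.*-zeroʳ (fromℕ (suc (suc e))))) (ℚ.*-zeroʳ (- 1ℚ)))

  newtonᴱ : ∀ e → ∑₂ splitℕ e (λ k l → guard (not (k ℕ.≡ᵇ 0)) (uᴱ l)) ≡ - 1ℚ * (fromℕ e * uᴱ e)
  newtonᴱ zero    = ∑₂-splitℕ-0 (λ k l → guard (not (k ℕ.≡ᵇ 0)) (uᴱ l))
  newtonᴱ (suc e) = trans (∑₂-splitℕ-suc e (λ k l → guard (not (k ℕ.≡ᵇ 0)) (uᴱ l)))
    (trans (ℚ.+-identityˡ _) (trans (splitℕ-cocomm e (λ k l → uᴱ l)) (trans (partial e) (rhs e))))

-- Recursion over compositions

compositions-valid : ∀ n → All (λ b → All (0 <_) b × sum b ≡ n) (compositions n)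
compositions-valid zero    = ([] , refl) ∷ []
compositions-valid (suc n) = All.concat⁺ (All.map⁺ (All.map grow-valid (compositions-valid n)))
  where
  grow-valid : ∀ {b} → All (0 <_) b × sum b ≡ n → All (λ b → All (0 <_) b × sum b ≡ suc n) (grow b)
  grow-valid {[]}    (_         , refl) = (s≤s z≤n ∷ [] , refl) ∷ []
  grow-valid {_ ∷ _} (b>0 ∷ bs>0 , refl) =
    (s≤s z≤n ∷ b>0 ∷ bs>0 , refl) ∷ (s≤s z≤n ∷ bs>0 , refl) ∷ []

-- `grow` either prepends a 1 or enlarges the first part. Sorting by the first part instead gives
-- the shape of Newton's recursion; the compositions with first part 1 are the new term at the left
-- end of the splittings.
∑-compositions : ∀ n (φ : List ℕ → ℚ) →
  ∑ (compositions (suc n)) φ ≡ ∑₂ splitℕ n (λ k l → ∑[ bs ∈ compositions l ] φ (suc k ∷ bs))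
∑-compositions zero    φ = sym (∑₂-splitℕ-0 (λ k l → ∑[ bs ∈ compositions l ] φ (suc k ∷ bs)))
∑-compositions (suc n) φ = begin
  ∑ (compositions (suc (suc n))) φ
    ≡⟨ ∑-concatMap grow (compositions (suc n)) φ ⟩
  ∑[ bs ∈ compositions (suc n) ] ∑ (grow bs) φ
    ≡⟨ ∑-compositions n (λ bs → ∑ (grow bs) φ) ⟩
  ∑₂ splitℕ n (λ k l → ∑[ bs ∈ compositions l ] (φ (1 ∷ suc k ∷ bs) + (φ (suc (suc k) ∷ bs) + 0ℚ)))
    ≡⟨ ∑₂-cong splitℕ n (λ k l → trans
         (∑-cong (compositions l) λ bs → cong (φ (1 ∷ suc k ∷ bs) +_) (ℚ.+-identityʳ (φ (suc (suc k) ∷ bs))))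
         (∑-+ (compositions l) (λ bs → φ (1 ∷ suc k ∷ bs)) (λ bs → φ (suc (suc k) ∷ bs)))) ⟩
  ∑₂ splitℕ n (λ k l → ∑[ bs ∈ compositions l ] φ (1 ∷ suc k ∷ bs) + ∑[ bs ∈ compositions l ] φ (suc (suc k) ∷ bs))
    ≡⟨ ∑₂-+ splitℕ n (λ k l → ∑[ bs ∈ compositions l ] φ (1 ∷ suc k ∷ bs)) (λ k l → ∑[ bs ∈ compositions l ] φ (suc (suc k) ∷ bs)) ⟩
  ∑₂ splitℕ n (λ k l → ∑[ bs ∈ compositions l ] φ (1 ∷ suc k ∷ bs))
    + ∑₂ splitℕ n (λ k l → ∑[ bs ∈ compositions l ] φ (suc (suc k) ∷ bs))
    ≡⟨ cong (_+ ∑₂ splitℕ n (λ k l → ∑[ bs ∈ compositions l ] φ (suc (suc k) ∷ bs))) (∑-compositions n (λ bs → φ (1 ∷ bs))) ⟨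
  ∑[ bs ∈ compositions (suc n) ] φ (1 ∷ bs) + ∑₂ splitℕ n (λ k l → ∑[ bs ∈ compositions l ] φ (suc (suc k) ∷ bs))
    ≡⟨ ∑₂-splitℕ-suc n (λ k l → ∑[ bs ∈ compositions l ] φ (suc k ∷ bs)) ⟨
  ∑₂ splitℕ (suc n) (λ k l → ∑[ bs ∈ compositions l ] φ (suc k ∷ bs)) ∎
  where open ≡-Reasoning

-- Normalised so that a single brick `b` weighs ε b, the factor of F_b in Newton's identity of
-- degree b.
brickWeight : ℚ → List ℕ → ℚ
brickWeight ε bs = - ε * (alternating (length bs) * fromℕ (lastBrick bs))

brickSum : ℚ → (ℕ → Series) → ℕ → Series
brickSum ε F d = ⨁ (compositions d) (λ bs → brickWeight ε bs • ∏ (List.map F bs))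

brickWeight-∷ : ∀ ε b c bs → brickWeight ε (b ∷ c ∷ bs) ≡ - brickWeight ε (c ∷ bs)
brickWeight-∷ ε b c bs = trans
  (cong (- ε *_) (sym (ℚ.neg-distribˡ-* (alternating (length (c ∷ bs))) (fromℕ (lastBrick (c ∷ bs))))))
  (sym (ℚ.neg-distribʳ-* (- ε) _))

brickWeight-[_] : ∀ ε b → brickWeight ε (b ∷ []) ≡ ε * fromℕ b
brickWeight-[_] ε b = begin
  - ε * (- 1ℚ * fromℕ b)  ≡⟨ ℚ.*-assoc (- ε) (- 1ℚ) (fromℕ b) ⟨
  - ε * - 1ℚ * fromℕ b    ≡⟨ cong (_* fromℕ b) (trans (ℚ.*-comm (- ε) (- 1ℚ)) (ℚ-Ring.-1*x≈-x (- ε))) ⟩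
  - - ε * fromℕ b         ≡⟨ cong (_* fromℕ b) (ℚ-Ring.-‿involutive ε) ⟩
  ε * fromℕ b             ∎
  where open ≡-Reasoning

∑-neg : ∀ (xs : List A) (f : A → ℚ) → ∑[ x ∈ xs ] (- f x) ≡ - ∑ xs f
∑-neg xs f = trans (∑-cong xs λ x → sym (ℚ-Ring.-1*x≈-x (f x)))
  (trans (sym (∑-*ˡ xs (- 1ℚ) f)) (ℚ-Ring.-1*x≈-x (∑ xs f)))

module _ {u ε} (gen : IsGenerating u ε) where

  private
    F : ℕ → Series
    F = graded (uᴹ u)

  graded-0 : F 0 ≋ 𝟙
  graded-0 = mk λ m → guard-cong (deg m ℕ.≟ 0) λ deg≡0 →
    onZeroᴹ m (trans (sym (deg≡ᵇ0 m)) (cong (ℕ._≡ᵇ 0) deg≡0))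
    where
    onZeroʳ : ∀ {J} (r : Vec ℕ J) → isZeroRow r ≡ true → uʳ u r ≡ 1ℚ
    onZeroʳ []         _   = refl
    onZeroʳ (zero ∷ r) r≡0 = cong₂ _*_ (u-0 gen) (onZeroʳ r r≡0)

    onZeroᴹ : ∀ {I J} (m : Monomial I J) → isZero m ≡ true → uᴹ u m ≡ 1ℚ
    onZeroᴹ []      _   = refl
    onZeroᴹ (r ∷ m) m≡0 with isZeroRow r in r≡0
    ... | true = cong₂ _*_ (onZeroʳ r r≡0) (onZeroᴹ m m≡0)

  -- Removing the first of several bricks keeps the last one and costs a sign, while the composition
  -- with one brick yields the term ε d F_d. This is Newton's identity solved for P_d, with brick
  -- sums in place of the lower power sums.
  brickSum-suc : ∀ d (m : Monomial I J) → coeff (brickSum ε F (suc (suc d))) m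
    ≡ - ∑₂ splitℕ d (λ k l → coeff (F (suc k) ⊙ brickSum ε F (suc l)) m) + ε * fromℕ (suc (suc d)) * coeff (F (suc (suc d))) m
  brickSum-suc d m = begin
    ∑ (compositions (suc (suc d))) φ
      ≡⟨ ∑-compositions (suc d) φ ⟩
    ∑₂ splitℕ (suc d) (λ k l → ∑[ bs ∈ compositions l ] φ (suc k ∷ bs))
      ≡⟨ ∑₂-splitℕ-sucʳ d (λ k l → ∑[ bs ∈ compositions l ] φ (suc k ∷ bs)) ⟩
    ∑₂ splitℕ d (λ k l → ∑[ bs ∈ compositions (suc l) ] φ (suc k ∷ bs)) + (φ (suc (suc d) ∷ []) + 0ℚ)
      ≡⟨ cong₂ _+_ (trans (∑₂-cong splitℕ d nonempty) (∑-neg (splitℕ d) (λ kl → coeff (F (suc (proj₁ kl)) ⊙ brickSum ε F (suc (proj₂ kl))) m))) (trans (ℚ.+-identityʳ (φ (suc (suc d) ∷ [])))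
           (cong₂ _*_ (brickWeight-[_] ε (suc (suc d))) (at (⊙.identityʳ (F (suc (suc d)))) m))) ⟩
    - ∑₂ splitℕ d (λ k l → coeff (F (suc k) ⊙ brickSum ε F (suc l)) m) + ε * fromℕ (suc (suc d)) * coeff (F (suc (suc d))) m ∎
    where
    open ≡-Reasoning
    φ : List ℕ → ℚ
    φ bs = brickWeight ε bs * coeff (∏ (List.map F bs)) m

    -- A positive sum excludes the empty composition, for which the prepended brick would become the
    -- last one.
    summand : ∀ k l {bs} → All (0 <_) bs × sum bs ≡ suc l → φ (suc k ∷ bs) ≡ - coeff (F (suc k) ⊙ brickWeight ε bs • ∏ (List.map F bs)) m
    summand k l {b ∷ bs} _ = begin
      brickWeight ε (suc k ∷ b ∷ bs) * coeff (F (suc k) ⊙ ∏ (List.map F (b ∷ bs))) m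
        ≡⟨ cong (_* coeff (F (suc k) ⊙ ∏ (List.map F (b ∷ bs))) m) (brickWeight-∷ ε (suc k) b bs) ⟩
      - brickWeight ε (b ∷ bs) * coeff (F (suc k) ⊙ ∏ (List.map F (b ∷ bs))) m
        ≡⟨ ℚ.neg-distribˡ-* (brickWeight ε (b ∷ bs)) _ ⟨
      - (brickWeight ε (b ∷ bs) * coeff (F (suc k) ⊙ ∏ (List.map F (b ∷ bs))) m)
        ≡⟨ cong -_ (at (⊙-• (brickWeight ε (b ∷ bs)) (F (suc k)) (∏ (List.map F (b ∷ bs)))) m) ⟨
      - coeff (F (suc k) ⊙ brickWeight ε (b ∷ bs) • ∏ (List.map F (b ∷ bs))) m ∎

    nonempty : ∀ k l → ∑[ bs ∈ compositions (suc l) ] φ (suc k ∷ bs) ≡ - coeff (F (suc k) ⊙ brickSum ε F (suc l)) m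
    nonempty k l = begin
      ∑[ bs ∈ compositions (suc l) ] φ (suc k ∷ bs)
        ≡⟨ ∑-cong-All {xs = compositions (suc l)} {λ bs → φ (suc k ∷ bs)}
             {λ bs → - coeff (F (suc k) ⊙ brickWeight ε bs • ∏ (List.map F bs)) m}
             (All.map (summand k l) (compositions-valid (suc l))) ⟩
      ∑[ bs ∈ compositions (suc l) ] (- coeff (F (suc k) ⊙ brickWeight ε bs • ∏ (List.map F bs)) m)
        ≡⟨ ∑-neg (compositions (suc l)) (λ bs → coeff (F (suc k) ⊙ brickWeight ε bs • ∏ (List.map F bs)) m) ⟩
      - ∑[ bs ∈ compositions (suc l) ] coeff (F (suc k) ⊙ brickWeight ε bs • ∏ (List.map F bs)) m
        ≡⟨ cong -_ (at (⊙-⨁ (compositions (suc l)) (λ bs → brickWeight ε bs • ∏ (List.map F bs)) (F (suc k))) m) ⟨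
      - coeff (F (suc k) ⊙ brickSum ε F (suc l)) m ∎

  P≋brickSum : ∀ d → P (suc d) ≋ brickSum ε F (suc d)
  P≋brickSum d = below (suc d) d ℕ.≤-refl
    where
    open ≡-Reasoning

    -- Strong induction with bound `N`, since the recursion refers to all smaller power sums.
    below : ∀ N d → d < N → P (suc d) ≋ brickSum ε F (suc d)
    below (suc N) zero _ = mk λ m → begin
      coeff (P 1) m
        ≡⟨ at (⊙.identityʳ (P 1)) m ⟨
      coeff (P 1 ⊙ 𝟙) m
        ≡⟨ at (⊙.∙-congˡ {P 1} graded-0) m ⟨
      coeff (P 1 ⊙ F 0) m
        ≡⟨ ∑₂-splitℕ-0 (λ k l → coeff (P (suc k) ⊙ F l) m) ⟨
      coeff (⨁ (splitℕ 0) (λ kl → P (suc (proj₁ kl)) ⊙ F (proj₂ kl))) m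
        ≡⟨ at (newton-identity gen 0) m ⟨
      ε * fromℕ 1 * coeff (F 1) m
        ≡⟨ cong₂ _*_ (brickWeight-[_] ε 1) (at (⊙.identityʳ (F 1)) m) ⟨
      brickWeight ε (1 ∷ []) * coeff (F 1 ⊙ 𝟙) m
        ≡⟨ ℚ.+-identityʳ _ ⟨
      coeff (brickSum ε F 1) m ∎
    below (suc N) (suc d) (s≤s d<N) = mk λ m →
      -- `A` collects the terms of Newton's identity in which F has positive degree, so that P_{d+2}
      -- F_0 remains; `A′` is what the recursion of the brick sums subtracts. They agree by the
      -- induction hypothesis and commutativity of both the product and the splitting.
      let A  = ∑₂ splitℕ d (λ k l → coeff (P (suc k) ⊙ F (suc l)) m)
          A′ = ∑₂ splitℕ d (λ k l → coeff (F (suc k) ⊙ brickSum ε F (suc l)) m)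
          A′≡A : A′ ≡ A
          A′≡A = trans (∑₂-cong-∈ splitℕ d λ {k} {l} kl∈ → trans
                   (at (⊙.∙-congˡ {F (suc k)} (⊙.sym (below N l (ℕ.≤-<-trans (ℕ.m+n≤o⇒n≤o k (ℕ.≤-reflexive (splitℕ-∈⁻ d kl∈))) d<N)))) m)
                   (at (⊙.comm (F (suc k)) (P (suc l))) m))
                 (splitℕ-cocomm d (λ k l → coeff (P (suc l) ⊙ F (suc k)) m))
      in begin
      coeff (P (suc (suc d))) m
        ≡⟨ at (⊙.identityʳ (P (suc (suc d)))) m ⟨
      coeff (P (suc (suc d)) ⊙ 𝟙) m
        ≡⟨ at (⊙.∙-congˡ {P (suc (suc d))} graded-0) m ⟨
      coeff (P (suc (suc d)) ⊙ F 0) m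
        ≡⟨ ℚ.+-identityˡ _ ⟨
      0ℚ + coeff (P (suc (suc d)) ⊙ F 0) m
        ≡⟨ cong (_+ coeff (P (suc (suc d)) ⊙ F 0) m) (ℚ.+-inverseˡ A) ⟨
      - A + A + coeff (P (suc (suc d)) ⊙ F 0) m
        ≡⟨ ℚ.+-assoc (- A) A _ ⟩
      - A + (A + coeff (P (suc (suc d)) ⊙ F 0) m)
        ≡⟨ cong (- A +_) (∑₂-splitℕ-sucʳ d (λ k l → coeff (P (suc k) ⊙ F l) m)) ⟨
      - A + coeff (⨁ (splitℕ (suc d)) (λ kl → P (suc (proj₁ kl)) ⊙ F (proj₂ kl))) m
        ≡⟨ cong₂ (λ B q → - B + q) A′≡A (at (newton-identity gen (suc d)) m) ⟨
      - A′ + ε * fromℕ (suc (suc d)) * coeff (F (suc (suc d))) m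
        ≡⟨ brickSum-suc d m ⟨
      coeff (brickSum ε F (suc (suc d))) m ∎

-- Enumeration of brick tabloids

ℕ≥ : DecTotalOrder 0ℓ 0ℓ 0ℓ
ℕ≥ = DecTotalOrderProperties.≥-decTotalOrder ℕ.≤-decTotalOrder

open import Data.List.Sort ℕ≥ using (sort; sort-↭; sort-↗)

sorted-↭⇒≡ : ∀ {xs ys} → Linked _≥_ xs → Linked _≥_ ys → xs ↭ ys → xs ≡ ys
sorted-↭⇒≡ xs↗ ys↗ xs↭ys = ListPointwise.Pointwise-≡⇒≡
  (↗↭↗⇒≋ (DecTotalOrder.totalOrder ℕ≥) xs↗ ys↗ (↭⇒↭ₛ xs↭ys))

isPartition : (lam : Partition) → IsPartition (parts lam)
isPartition (ds , [ isP ]) = recompute (isPartition? ds) isP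

-- The function `g` recovers from an entry the `x` whose list contains it, so lists of different `x`
-- are disjoint.
unique-concatMap : ∀ {h : A → List B} (g : B → A) {xs} → Unique xs → (∀ x → Unique (h x)) →
                   All (λ x → ∀ {y} → y ∈ h x → g y ≡ x) xs → Unique (concatMap h xs)
unique-concatMap {h = h} g xs! h! g-inv =
  Unique.concat⁺ (All.map⁺ (All.universal h! _)) (AllPairs.map⁺ (disjoint xs! g-inv))
  where
  disjoint : ∀ {xs} → Unique xs → All (λ x → ∀ {y} → y ∈ h x → g y ≡ x) xs → AllPairs (Disjoint on h) xs
  disjoint []          []       = AllPairs.[]
  disjoint (x∉ ∷ xs!) (gx ∷ gs) = AllPairs._∷_ (All.zipWith (λ { (x≢z , gz) (y∈hx , y∈hz) → x≢z (trans (sym (gx y∈hx)) (gz y∈hz)) }) (x∉ , gs))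
                                    (disjoint xs! gs)

-- Undoes `grow` on positive lists, so that no composition is generated twice.
shrink : List ℕ → List ℕ
shrink (1 ∷ bs)           = bs
shrink (suc (suc b) ∷ bs) = suc b ∷ bs
shrink bs                 = bs

compositions-unique : ∀ n → Unique (compositions n)
compositions-unique zero    = [] ∷ []
compositions-unique (suc n) = unique-concatMap shrink (compositions-unique n) grow-unique
  (All.map (λ {bs} valid {cs} → shrink-grow bs (proj₁ valid) {cs}) (compositions-valid n))
  where
  grow-unique : ∀ bs → Unique (grow bs)
  grow-unique []       = [] ∷ []
  grow-unique (b ∷ bs) = ((ℕ.1+n≢n ∘ cong length) ∷ []) ∷ [] ∷ []

  shrink-grow : ∀ bs → All (0 <_) bs → ∀ {cs} → cs ∈ grow bs → shrink cs ≡ bs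
  shrink-grow []           _       (here refl)         = refl
  shrink-grow (b ∷ bs)     _       (here refl)         = refl
  shrink-grow (suc b ∷ bs) (_ ∷ _) (there (here refl)) = refl

decompositions-unique : ∀ rs → Unique (decompositions rs)
decompositions-unique []       = [] ∷ []
decompositions-unique (r ∷ rs) =
  Unique.cartesianProductWith⁺ _∷_ List.∷-injective (compositions-unique r) (decompositions-unique rs)

All-cartesian : ∀ {c} {C : Set c} {P : A → Set p} {Q : B → Set p} {R : C → Set p} (f : A → B → C) {xs ys} →
                (∀ {x y} → P x → Q y → R (f x y)) → All P xs → All Q ys → All R (cartesianProductWith f xs ys)
All-cartesian f pqr []         qs = []
All-cartesian f pqr (px ∷ pxs) qs = All.++⁺ (All.map⁺ (All.map (pqr px) qs)) (All-cartesian f pqr pxs qs)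

Decomposes : List ℕ → List (List ℕ) → Set
Decomposes rs rows = All (All (0 <_)) rows × List.map sum rows ≡ rs

decompositions-valid : ∀ rs → All (Decomposes rs) (decompositions rs)
decompositions-valid []       = ([] , refl) ∷ []
decompositions-valid (r ∷ rs) = All-cartesian _∷_
  (λ { (bs>0 , refl) (rows>0 , refl) → bs>0 ∷ rows>0 , refl }) (compositions-valid r) (decompositions-valid rs)

sortedBricks : List (List ℕ) → List ℕ
sortedBricks rows = sort (concat rows)

_≟ˡ_ : (xs ys : List ℕ) → Dec (xs ≡ ys)
_≟ˡ_ = List.≡-dec ℕ._≟_

-- Sorting the bricks turns the condition on the content into an equation between lists. The sum
-- over tabloids of one content becomes a sum over all decompositions with a Kronecker delta, which
-- can be exchanged with a sum over contents.
∑-BrickTabloid : ∀ lam mu (φ : List (List ℕ) → ℚ) →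
  ∑ (elements (finite-BrickTabloid lam mu)) (φ ∘ value)
    ≡ ∑[ rows ∈ decompositions (parts lam) ] guard (does (sortedBricks rows ≟ˡ parts mu)) (φ rows)
∑-BrickTabloid lam mu φ = begin
  ∑ (select T? (deduplicate _≟_ xs)) (φ ∘ value)
    ≡⟨ ∑-select T? (deduplicate _≟_ xs) φ ⟩
  ∑[ rows ∈ deduplicate _≟_ xs ] guard (does (T? rows)) (φ rows)
    -- The candidates are already distinct, so deduplication preserves the sum.
    ≡⟨ ∑-↭ (λ rows → guard (does (T? rows)) (φ rows))
         (unique-↭ (deduplicate-! xs) (decompositions-unique (parts lam)) (∈-deduplicate⁻ _≟_ xs) (∈-deduplicate⁺ _≟_)) ⟩
  ∑[ rows ∈ xs ] guard (does (T? rows)) (φ rows)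
    ≡⟨ ∑-cong-All {xs = xs} {λ rows → guard (does (T? rows)) (φ rows)}
         {λ rows → guard (does (sortedBricks rows ≟ˡ parts mu)) (φ rows)}
         (All.map (λ { {rows} (rows>0 , sums) → guard-⇔ (T? rows) (sortedBricks rows ≟ˡ parts mu)
            (λ { (_ , _ , perm) → sorted-↭⇒≡ (sort-↗ (concat rows)) (proj₂ (isPartition mu)) (↭-trans (sort-↭ (concat rows)) perm) })
            (λ eq → rows>0 , sums , ↭-trans (↭-sym (sort-↭ (concat rows))) (subst (sortedBricks rows ↭_) eq ↭-refl))
            (φ rows) }) (decompositions-valid (parts lam))) ⟩
  ∑[ rows ∈ xs ] guard (does (sortedBricks rows ≟ˡ parts mu)) (φ rows) ∎
  where
  open ≡-Reasoning
  T? = isBrickTabloid? lam mu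
  _≟_ = List.≡-dec (List.≡-dec ℕ._≟_)
  xs = decompositions (parts lam)
  open import Data.List.Relation.Unary.Unique.DecPropositional.Properties _≟_ using (deduplicate-!)

Rows : ℕ → Set
Rows = Vec (List (List ℕ))

allDecompositions : Vec Partition n → List (Rows n)
allDecompositions []           = [] ∷ []
allDecompositions (lam ∷ lams) = cartesianProductWith _∷_ (decompositions (parts lam)) (allDecompositions lams)

rowsOf : ∀ {lams mus : Vec Partition n} → Pointwise BrickTabloid lams mus → Rows n
rowsOf []       = []
rowsOf (T ∷ Ts) = value T ∷ rowsOf Ts

lasts : Rows n → ℕ
lasts []         = 1
lasts (rows ∷ R) = product (List.map lastBrick rows) ℕ.* lasts R

𝔏≡lasts : ∀ {lams mus : Vec Partition n} (T : Pointwise BrickTabloid lams mus) → 𝔏 T ≡ lasts (rowsOf T)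
𝔏≡lasts []       = refl
𝔏≡lasts (T ∷ Ts) = cong (product (List.map lastBrick (value T)) ℕ.*_) (𝔏≡lasts Ts)

_≟ⱽ_ : (xs ys : Vec (List ℕ) n) → Dec (xs ≡ ys)
_≟ⱽ_ = Vec.≡-dec _≟ˡ_

∑-Pointwise : ∀ (lams mus : Vec Partition n) (φ : Rows n → ℚ) →
  ∑ (elements (finite-Pointwise lams mus)) (φ ∘ rowsOf)
    ≡ ∑[ R ∈ allDecompositions lams ] guard (does (Vec.map sortedBricks R ≟ⱽ Vec.map parts mus)) (φ R)
∑-Pointwise []           []         φ = refl
∑-Pointwise (lam ∷ lams) (mu ∷ mus) φ = begin
  ∑ (elements (finite-Pointwise (lam ∷ lams) (mu ∷ mus))) (φ ∘ rowsOf)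
    ≡⟨ ∑-cartesian _∷_ (elements (finite-BrickTabloid lam mu)) (elements (finite-Pointwise lams mus)) (φ ∘ rowsOf) ⟩
  ∑[ T ∈ elements (finite-BrickTabloid lam mu) ] ∑[ Ts ∈ elements (finite-Pointwise lams mus) ] φ (value T ∷ rowsOf Ts)
    ≡⟨ ∑-cong (elements (finite-BrickTabloid lam mu)) (λ T → ∑-Pointwise lams mus (λ R → φ (value T ∷ R))) ⟩
  ∑[ T ∈ elements (finite-BrickTabloid lam mu) ] ∑[ R ∈ allDecompositions lams ] guard (matches R) (φ (value T ∷ R))
    ≡⟨ ∑-BrickTabloid lam mu (λ rows → ∑[ R ∈ allDecompositions lams ] guard (matches R) (φ (rows ∷ R))) ⟩
  ∑[ rows ∈ decompositions (parts lam) ] guard (does (sortedBricks rows ≟ˡ parts mu))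
    (∑[ R ∈ allDecompositions lams ] guard (matches R) (φ (rows ∷ R)))
    ≡⟨ ∑-cong (decompositions (parts lam)) (λ rows → trans
         (sym (∑-guard (allDecompositions lams) (does (sortedBricks rows ≟ˡ parts mu)) (λ R → guard (matches R) (φ (rows ∷ R)))))
         (∑-cong (allDecompositions lams) λ R → guard-∧ (does (sortedBricks rows ≟ˡ parts mu)) (matches R) (φ (rows ∷ R)))) ⟩
  ∑[ rows ∈ decompositions (parts lam) ] ∑[ R ∈ allDecompositions lams ]
    guard (does (sortedBricks rows ≟ˡ parts mu) ∧ matches R) (φ (rows ∷ R))
    ≡⟨ ∑-cartesian _∷_ (decompositions (parts lam)) (allDecompositions lams)
         (λ R → guard (does (Vec.map sortedBricks R ≟ⱽ Vec.map parts (mu ∷ mus))) (φ R)) ⟨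
  ∑[ R ∈ allDecompositions (lam ∷ lams) ] guard (does (Vec.map sortedBricks R ≟ⱽ Vec.map parts (mu ∷ mus))) (φ R) ∎
  where
  open ≡-Reasoning
  matches : Rows _ → Bool
  matches R = does (Vec.map sortedBricks R ≟ⱽ Vec.map parts mus)

allDecompositions-valid : ∀ (lams : Vec Partition n) →
  All (Pointwise (λ lam → Decomposes (parts lam)) lams) (allDecompositions lams)
allDecompositions-valid []           = [] ∷ []
allDecompositions-valid (lam ∷ lams) =
  All-cartesian _∷_ _∷_ (decompositions-valid (parts lam)) (allDecompositions-valid lams)

sum-concat : ∀ (rows : List (List ℕ)) → sum (concat rows) ≡ sum (List.map sum rows)
sum-concat []           = refl
sum-concat (row ∷ rows) = trans (sum-++ row (concat rows)) (cong (sum row ℕ.+_) (sum-concat rows))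

content : ∀ {lams : Vec Partition n} {R} → Pointwise (λ lam → Decomposes (parts lam)) lams R →
          ∃ λ mus → Vec.map parts mus ≡ Vec.map sortedBricks R × (∀ i → size (lookup mus i) ≡ size (lookup lams i))
content [] = [] , refl , λ ()
content {lams = lam ∷ lams} {rows ∷ R} ((rows>0 , sums) ∷ valid) with content valid
... | mus , parts≡ , sizes =
  mu ∷ mus , cong (sortedBricks rows ∷_) parts≡ , λ { Fin.zero → size≡ ; (Fin.suc i) → sizes i }
  where
  mu : Partition
  mu = sortedBricks rows ,
    [ Perm.All-resp-↭ (↭-sym (sort-↭ (concat rows))) (All.concat⁺ rows>0) , sort-↗ (concat rows) ]

  size≡ : size mu ≡ size lam
  size≡ = trans (sum-↭ (sort-↭ (concat rows))) (trans (sum-concat rows) (cong sum sums))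

-- Cutting rows into bricks preserves the size of the partition at each index, hence the weight:
-- every choice of decompositions is a tabloid whose content is again a type of n.
content-Typ : ∀ (σ : Typ n) {R} → Pointwise (λ lam → Decomposes (parts lam)) (value σ) R →
              ∃ λ (ρ : Typ n) → Vec.map parts (value ρ) ≡ Vec.map sortedBricks R
content-Typ {n} (lams , [ weight≡n ]) valid with content valid
... | mus , parts≡ , sizes = (mus , [ trans weight≡ weight≡n ]) , parts≡
  where
  weight≡ : weight mus ≡ weight lams
  weight≡ = cong sum (List.map-cong (λ i → cong (suc (toℕ i) ℕ.*_) (sizes i)) (allFin n))

map-parts-injective : ∀ {mus nus : Vec Partition n} → Vec.map parts mus ≡ Vec.map parts nus → mus ≡ nus
map-parts-injective {mus = []}     {[]}     _  = refl
map-parts-injective {mus = _ ∷ _} {_ ∷ _} eq = cong₂ _∷_ (value-injective (Vec.∷-injectiveˡ eq))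
  (map-parts-injective (Vec.∷-injectiveʳ eq))

Typ-≡ : ∀ {ρ τ : Typ n} → Vec.map parts (value ρ) ≡ Vec.map parts (value τ) → ρ ≡ τ
Typ-≡ eq = value-injective (map-parts-injective eq)

_≟ᵀ_ : (ρ τ : Typ n) → Dec (ρ ≡ τ)
_≟ᵀ_ = Refinement._≟_ (Vec.≡-dec _≟ᴾ_)

-- Expansion of products of power sums

-- Here `G i d` stands for the series of the block d^(1+i). This is `F ⟨ τ ⟩` in a form that admits
-- induction on the vector, at the price of shifting `G`.
blocks : (ℕ → ℕ → Series) → Vec (List ℕ) n → Series
blocks G []       = 𝟙
blocks G (ds ∷ v) = ∏ (List.map (G 0) ds) ⊙ blocks (G ∘ suc) v

dilations : (ℕ → Series) → ℕ → ℕ → Series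
dilations F i d = F d [x^ suc i ]

∏-allFin : ∀ (G : ℕ → ℕ → Series) (v : Vec (List ℕ) n) →
           ∏ (concatMap (λ i → List.map (G (toℕ i)) (lookup v i)) (allFin n)) ≋ blocks G v
∏-allFin G []       = ⊙.refl
∏-allFin {suc n} G (ds ∷ v) = ⊙.trans
  (∏-++ (List.map (G 0) ds) (concat (List.map f (List.tabulate Fin.suc))))
  (⊙.∙-congˡ (⊙.trans (⊙.reflexive (cong (∏ ∘ concat) (map-tail-allFin f))) (∏-allFin (G ∘ suc) v)))
  where
  f : Fin (suc n) → List Series
  f i = List.map (G (toℕ i)) (lookup (ds ∷ v) i)

lookup-map-parts : ∀ (mus : Vec Partition n) i → parts (lookup mus i) ≡ lookup (Vec.map parts mus) i
lookup-map-parts (mu ∷ mus) Fin.zero    = refl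
lookup-map-parts (mu ∷ mus) (Fin.suc i) = lookup-map-parts mus i

⟨⟩≋blocks : ∀ F (τ : Typ n) → F ⟨ τ ⟩ ≋ blocks (dilations F) (Vec.map parts (value τ))
⟨⟩≋blocks {n} F τ = ⊙.trans (⊙.reflexive (trans
    (sym (∏≡foldr (concatMap (λ i → List.map (dilations F (toℕ i)) (parts (τ ∣^ i))) (allFin n))))
    (cong (∏ ∘ concat) (List.map-cong (λ i → cong (List.map (dilations F (toℕ i))) (lookup-map-parts (value τ) i)) (allFin n)))))
  (∏-allFin (dilations F) (Vec.map parts (value τ)))

blocks-cong : ∀ {G G′ : ℕ → ℕ → Series} → (∀ i d → G i d ≋ G′ i d) → ∀ (v : Vec (List ℕ) n) → blocks G v ≋ blocks G′ v
blocks-cong G≋ []       = ⊙.refl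
blocks-cong G≋ (ds ∷ v) = ⊙.∙-cong (∏-map-cong ds (G≋ 0)) (blocks-cong (G≋ ∘ suc) v)

-- Since series commute, the bricks of each index may be sorted, and the product becomes that of a
-- type.
blocks-↭ : ∀ (G : ℕ → ℕ → Series) (R : Rows n) → blocks G (Vec.map concat R) ≋ blocks G (Vec.map sortedBricks R)
blocks-↭ G []         = ⊙.refl
blocks-↭ G (rows ∷ R) = ⊙.∙-cong
  (⊙.sym (∏-↭ (Perm.map⁺ (G 0) (sort-↭ (concat rows))))) (blocks-↭ (G ∘ suc) R)

⨁-cartesian : ∀ (h : A → B → C) xs ys {f : A → Series} {g : B → Series} {k : C → Series} →
              (∀ x y → f x ⊙ g y ≋ k (h x y)) → ⨁ xs f ⊙ ⨁ ys g ≋ ⨁ (cartesianProductWith h xs ys) k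
⨁-cartesian h xs ys {f} {g} {k} fg≋k = ⊙.trans (⨁-⊙ xs f (⨁ ys g))
  (⊙.trans (⨁-cong xs λ x → ⊙.trans (⊙-⨁ ys g (f x)) (⨁-cong ys (fg≋k x)))
           (mk λ m → sym (∑-cartesian h xs ys (λ z → coeff (k z) m))))

•-⊙-• : ∀ p q f g → p • f ⊙ q • g ≋ (p * q) • (f ⊙ g)
•-⊙-• p q f g = ⊙.trans (•-⊙ p f (q • g)) (mk λ m →
  trans (cong (p *_) (at (⊙-• q f g) m)) (sym (ℚ.*-assoc p q (coeff (f ⊙ g) m))))

•-congˡ : ∀ q {f g} → f ≋ g → q • f ≋ q • g
•-congˡ q f≋g = mk λ m → cong (q *_) (at f≋g m)

module Expand (wt : List ℕ → ℚ) where

  rowsWeight : List (List ℕ) → ℚ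
  rowsWeight []           = 1ℚ
  rowsWeight (row ∷ rows) = wt row * rowsWeight rows

  allRowsWeight : Rows n → ℚ
  allRowsWeight []         = 1ℚ
  allRowsWeight (rows ∷ R) = rowsWeight rows * allRowsWeight R

  expand-rows : ∀ {Q G : ℕ → Series} → (∀ d → 0 < d → Q d ≋ ⨁ (compositions d) (λ bs → wt bs • ∏ (List.map G bs))) →
                ∀ {ds} → All (0 <_) ds → ∏ (List.map Q ds)
                  ≋ ⨁ (decompositions ds) (λ rows → rowsWeight rows • ∏ (List.map G (concat rows)))
  expand-rows Q≋ [] = mk λ m → sym (trans (ℚ.+-identityʳ _) (ℚ.*-identityˡ _))
  expand-rows {G = G} Q≋ {d ∷ ds} (d>0 ∷ ds>0) = ⊙.trans (⊙.∙-cong (Q≋ d d>0) (expand-rows Q≋ ds>0))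
    (⨁-cartesian _∷_ (compositions d) (decompositions ds) λ row rows → ⊙.trans
      (•-⊙-• (wt row) (rowsWeight rows) (∏ (List.map G row)) (∏ (List.map G (concat rows))))
      (•-congˡ (wt row * rowsWeight rows) (⊙.trans (⊙.sym (∏-++ (List.map G row) (List.map G (concat rows))))
        (⊙.reflexive (cong ∏ (sym (List.map-++ G row (concat rows))))))))

  expand-blocks : ∀ {Q G : ℕ → ℕ → Series} →
                  (∀ i d → 0 < d → Q i d ≋ ⨁ (compositions d) (λ bs → wt bs • ∏ (List.map (G i) bs))) →
                  ∀ (lams : Vec Partition n) → blocks Q (Vec.map parts lams)
                    ≋ ⨁ (allDecompositions lams) (λ R → allRowsWeight R • blocks G (Vec.map concat R))
  expand-blocks Q≋ [] = mk λ m → sym (trans (ℚ.+-identityʳ _) (ℚ.*-identityˡ _))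
  expand-blocks {G = G} Q≋ (lam ∷ lams) = ⊙.trans
    (⊙.∙-cong (expand-rows (Q≋ 0) (proj₁ (isPartition lam))) (expand-blocks (Q≋ ∘ suc) lams))
    (⨁-cartesian _∷_ (decompositions (parts lam)) (allDecompositions lams) λ rows R →
      •-⊙-• (rowsWeight rows) (allRowsWeight R) (∏ (List.map (G 0) (concat rows))) (blocks (G ∘ suc) (Vec.map concat R)))

infixr 8 _^^_
_^^_ : ℚ → ℕ → ℚ
q ^^ zero  = 1ℚ
q ^^ suc k = q * q ^^ k

^^-+ : ∀ q j k → q ^^ (j ℕ.+ k) ≡ q ^^ j * q ^^ k
^^-+ q zero    k = sym (ℚ.*-identityˡ (q ^^ k))
^^-+ q (suc j) k = trans (cong (q *_) (^^-+ q j k)) (sym (ℚ.*-assoc q (q ^^ j) (q ^^ k)))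

1^^ : ∀ k → 1ℚ ^^ k ≡ 1ℚ
1^^ zero    = refl
1^^ (suc k) = trans (ℚ.*-identityˡ (1ℚ ^^ k)) (1^^ k)

-1^^ : ∀ k → (- 1ℚ) ^^ k ≡ alternating k
-1^^ zero    = refl
-1^^ (suc k) = trans (ℚ-Ring.-1*x≈-x ((- 1ℚ) ^^ k)) (cong -_ (-1^^ k))

totalLength : Vec (List ℕ) n → ℕ
totalLength []       = 0
totalLength (ds ∷ v) = length ds ℕ.+ totalLength v

ℓ≡totalLength : ∀ (τ : Typ n) → ℓ τ ≡ totalLength (Vec.map parts (value τ))
ℓ≡totalLength (mus , _) = go mus
  where
  go : ∀ {n} (mus : Vec Partition n) →
       sum (List.map (λ i → length (parts (lookup mus i))) (allFin n)) ≡ totalLength (Vec.map parts mus)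
  go []         = refl
  go (mu ∷ mus) = cong (length (parts mu) ℕ.+_)
    (trans (cong sum (map-tail-allFin (λ i → length (parts (lookup (mu ∷ mus) i))))) (go mus))

*-interchange₃ : ∀ a b c a′ b′ c′ → a * (b * c) * (a′ * (b′ * c′)) ≡ a * a′ * (b * b′ * (c * c′))
*-interchange₃ a b c a′ b′ c′ = trans (ℚ*.interchange a (b * c) a′ (b′ * c′)) (cong (a * a′ *_) (ℚ*.interchange b c b′ c′))

module Weights (ε : ℚ) where

  open Expand (brickWeight ε) public

  -- Every row contributes a factor -ε, every brick a factor -1 and every last brick its length.
  -- Over all indices the rows number ℓ(σ), the bricks ℓ(τ), and the lengths multiply to 𝔏(T).
  rowsWeight≡ : ∀ rows → rowsWeight rows ≡
    (- ε) ^^ length rows * (alternating (length (concat rows)) * fromℕ (product (List.map lastBrick rows)))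
  rowsWeight≡ []           = refl
  rowsWeight≡ (row ∷ rows) = begin
    brickWeight ε row * rowsWeight rows
      ≡⟨ cong (brickWeight ε row *_) (rowsWeight≡ rows) ⟩
    - ε * (alternating (length row) * fromℕ (lastBrick row)) * ((- ε) ^^ length rows * (alternating (length (concat rows)) * fromℕ (product (List.map lastBrick rows))))
      ≡⟨ *-interchange₃ (- ε) (alternating (length row)) (fromℕ (lastBrick row)) ((- ε) ^^ length rows) (alternating (length (concat rows))) (fromℕ (product (List.map lastBrick rows))) ⟩
    - ε * (- ε) ^^ length rows * (alternating (length row) * alternating (length (concat rows)) * (fromℕ (lastBrick row) * fromℕ (product (List.map lastBrick rows))))
      ≡⟨ cong (- ε * (- ε) ^^ length rows *_) (cong₂ _*_
           (trans (sym (alternating-+ (length row) (length (concat rows)))) (cong alternating (sym (List.length-++ row))))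
           (sym (fromℕ-* (lastBrick row) (product (List.map lastBrick rows))))) ⟩
    - ε * (- ε) ^^ length rows * (alternating (length (concat (row ∷ rows))) * fromℕ (product (List.map lastBrick (row ∷ rows)))) ∎
    where open ≡-Reasoning

  allRowsWeight≡ : ∀ {lams : Vec Partition n} {R : Rows n} → Pointwise (λ lam → Decomposes (parts lam)) lams R →
    allRowsWeight R ≡ (- ε) ^^ totalLength (Vec.map parts lams)
      * (alternating (totalLength (Vec.map sortedBricks R)) * fromℕ (lasts R))
  allRowsWeight≡ [] = refl
  allRowsWeight≡ {lams = lam ∷ lams} {rows ∷ R} ((_ , sums) ∷ valid) = begin
    rowsWeight rows * allRowsWeight R
      ≡⟨ cong₂ _*_ (trans (rowsWeight≡ rows) (cong₂ (λ j k → (- ε) ^^ j * (alternating k * fromℕ (product (List.map lastBrick rows))))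
           (trans (sym (List.length-map sum rows)) (cong length sums))
           (sym (Perm.↭-length (sort-↭ (concat rows))))))
           (allRowsWeight≡ valid) ⟩
    (- ε) ^^ l * (alternating k * fromℕ q) * ((- ε) ^^ l′ * (alternating k′ * fromℕ q′))
      ≡⟨ *-interchange₃ ((- ε) ^^ l) (alternating k) (fromℕ q) ((- ε) ^^ l′) (alternating k′) (fromℕ q′) ⟩
    (- ε) ^^ l * (- ε) ^^ l′ * (alternating k * alternating k′ * (fromℕ q * fromℕ q′))
      ≡⟨ cong₂ _*_ (sym (^^-+ (- ε) l l′)) (cong₂ _*_ (sym (alternating-+ k k′)) (sym (fromℕ-* q q′))) ⟩
    (- ε) ^^ (l ℕ.+ l′) * (alternating (k ℕ.+ k′) * fromℕ (q ℕ.* q′)) ∎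
    where
    open ≡-Reasoning
    l l′ k k′ q q′ : ℕ
    l  = length (parts lam)
    l′ = totalLength (Vec.map parts lams)
    k  = length (sortedBricks rows)
    k′ = totalLength (Vec.map sortedBricks R)
    q  = product (List.map lastBrick rows)
    q′ = lasts R

-- The first factor is (-1)^ℓ(σ) for ε = 1 and trivial for ε = -1, which is the difference between
-- the signs of the two expansions.
sign : ℚ → Typ n → Typ n → ℚ
sign ε σ τ = (- ε) ^^ ℓ σ * alternating (ℓ τ)

tabloidSum : ℚ → Typ n → Typ n → ℚ
tabloidSum ε σ τ = ∑[ T ∈ 𝒫𝒯ˢⁱᵐᵖ σ τ ] (sign ε σ τ * fromℕ (𝔏 T))

module _ {u ε} (gen : IsGenerating u ε) {F : ℕ → Series} (graded≋F : ∀ d → graded (uᴹ u) d ≋ F d) where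

  open Weights ε

  P≋ : ∀ i d → 0 < d → dilations P i d ≋ ⨁ (compositions d) (λ bs → brickWeight ε bs • ∏ (List.map (dilations F i) bs))
  P≋ i (suc d) _ = ⊙.trans ([x^]-cong (suc i) (P≋brickSum gen d))
    (⊙.trans ([x^]-⨁ (suc i) (compositions (suc d)) (λ bs → brickWeight ε bs • ∏ (List.map (graded (uᴹ u)) bs)))
      (⨁-cong (compositions (suc d)) λ bs → ⊙.trans ([x^]-• (suc i) (brickWeight ε bs) (∏ (List.map (graded (uᴹ u)) bs)))
        (•-congˡ (brickWeight ε bs) (⊙.trans ([x^]-∏ (suc i) (graded (uᴹ u)) bs)
          (∏-map-cong bs λ d → [x^]-cong (suc i) (graded≋F d))))))

  P-expansion : ∀ (σ : Typ n) → P ⟨ σ ⟩ ≋ linearCombination F (tabloidSum ε σ)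
  P-expansion {n} σ = ⊙.trans (⟨⟩≋blocks P σ) (⊙.trans (expand-blocks P≋ (value σ)) (mk λ m → begin
    ∑[ R ∈ allDecompositions (value σ) ] (allRowsWeight R * coeff (blocks (dilations F) (Vec.map concat R)) m)
      -- Exactly one type matches `R`, namely its content; writing the term as a sum over all types
      -- lets the two sums be exchanged.
      ≡⟨ ∑-cong-All {xs = allDecompositions (value σ)}
           {λ R → allRowsWeight R * coeff (blocks (dilations F) (Vec.map concat R)) m}
           {λ R → ∑[ ρ ∈ types n ] guard (matches R ρ) (sign ε σ ρ * fromℕ (lasts R) * coeff (F ⟨ ρ ⟩) m)}
           (All.map (λ {R} valid → pick R valid m) (allDecompositions-valid (value σ))) ⟩
    ∑[ R ∈ allDecompositions (value σ) ] ∑[ ρ ∈ types n ] guard (matches R ρ) (sign ε σ ρ * fromℕ (lasts R) * coeff (F ⟨ ρ ⟩) m)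
      ≡⟨ ∑-swap (allDecompositions (value σ)) (types n) (λ R ρ → guard (matches R ρ) (sign ε σ ρ * fromℕ (lasts R) * coeff (F ⟨ ρ ⟩) m)) ⟩
    ∑[ ρ ∈ types n ] ∑[ R ∈ allDecompositions (value σ) ] guard (matches R ρ) (sign ε σ ρ * fromℕ (lasts R) * coeff (F ⟨ ρ ⟩) m)
      ≡⟨ ∑-cong (types n) (λ ρ → trans
           (∑-cong (allDecompositions (value σ)) λ R → sym (guard-*ˡ (matches R ρ) (sign ε σ ρ * fromℕ (lasts R)) (coeff (F ⟨ ρ ⟩) m)))
           (sym (∑-*ʳ (allDecompositions (value σ)) (coeff (F ⟨ ρ ⟩) m) (λ R → guard (matches R ρ) (sign ε σ ρ * fromℕ (lasts R)))))) ⟩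
    ∑[ ρ ∈ types n ] (∑[ R ∈ allDecompositions (value σ) ] guard (matches R ρ) (sign ε σ ρ * fromℕ (lasts R)) * coeff (F ⟨ ρ ⟩) m)
      ≡⟨ ∑-cong (types n) (λ ρ → cong (_* coeff (F ⟨ ρ ⟩) m) (trans
           (sym (∑-Pointwise (value σ) (value ρ) (λ R → sign ε σ ρ * fromℕ (lasts R))))
           (∑-cong (𝒫𝒯ˢⁱᵐᵖ σ ρ) λ T → cong (λ k → sign ε σ ρ * fromℕ k) (sym (𝔏≡lasts T))))) ⟩
    ∑[ ρ ∈ types n ] (tabloidSum ε σ ρ * coeff (F ⟨ ρ ⟩) m) ∎))
    where
    open ≡-Reasoning

    matches : Rows n → Typ n → Bool
    matches R ρ = does (Vec.map sortedBricks R ≟ⱽ Vec.map parts (value ρ))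

    pick : ∀ R → Pointwise (λ lam → Decomposes (parts lam)) (value σ) R → ∀ {I J} (m : Monomial I J) →
      allRowsWeight R * coeff (blocks (dilations F) (Vec.map concat R)) m
        ≡ ∑[ ρ ∈ types n ] guard (matches R ρ) (sign ε σ ρ * fromℕ (lasts R) * coeff (F ⟨ ρ ⟩) m)
    pick R valid m with content-Typ σ valid
    ... | ρ , parts≡ = begin
      allRowsWeight R * coeff (blocks (dilations F) (Vec.map concat R)) m
        ≡⟨ cong₂ _*_ weight≡ (at (⊙.trans (blocks-↭ (dilations F) R) (⊙.trans
             (⊙.reflexive (cong (blocks (dilations F)) (sym parts≡))) (⊙.sym (⟨⟩≋blocks F ρ)))) m) ⟩
      φ ρ
        ≡⟨ ∑-δ φ (unique (finite-Typ n)) (complete (finite-Typ n) ρ) (ρ ≟ᵀ_) ⟨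
      ∑[ ρ′ ∈ types n ] guard (does (ρ ≟ᵀ ρ′)) (φ ρ′)
        ≡⟨ ∑-cong (types n) (λ ρ′ → guard-⇔ (ρ ≟ᵀ ρ′) (Vec.map sortedBricks R ≟ⱽ Vec.map parts (value ρ′))
             (λ { refl → sym parts≡ }) (λ eq → Typ-≡ {ρ = ρ} {ρ′} (trans parts≡ eq)) (φ ρ′)) ⟩
      ∑[ ρ′ ∈ types n ] guard (matches R ρ′) (φ ρ′) ∎
      where
      φ : Typ n → ℚ
      φ ρ′ = sign ε σ ρ′ * fromℕ (lasts R) * coeff (F ⟨ ρ′ ⟩) m

      weight≡ : allRowsWeight R ≡ sign ε σ ρ * fromℕ (lasts R)
      weight≡ = trans (allRowsWeight≡ valid) (trans
        (cong₂ (λ j k → (- ε) ^^ j * (alternating k * fromℕ (lasts R))) (sym (ℓ≡totalLength σ))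
               (trans (cong totalLength (sym parts≡)) (sym (ℓ≡totalLength ρ))))
        (sym (ℚ.*-assoc ((- ε) ^^ ℓ σ) (alternating (ℓ ρ)) (fromℕ (lasts R)))))

-- Extremal monomials of products of blocks

Vanishing : (ℕ → ℕ → ℕ) → Set
Vanishing h = ∀ i → h i 0 ≡ 0

-- The shape of a monomial of degree t with W = ∑ (i - 1) i e over its factors x_{i,j}^e:
-- W is at most (t - 1) t, with equality only for the monomials 1 and x_{t,j}.
data Shape (t W : ℕ) (S : (ℕ → ℕ → ℕ) → ℕ) (U : (ℕ → ℚ) → ℚ) : Set where
  one    : t ≡ 0 → W ≡ 0 → (∀ h → Vanishing h → S h ≡ 0) → (∀ u → u 0 ≡ 1ℚ → U u ≡ 1ℚ) → Shape t W S U
  single : ∀ d → t ≡ suc d → W ≡ d ℕ.* suc d → (∀ h → Vanishing h → S h ≡ h d 1) →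
           (∀ u → u 0 ≡ 1ℚ → U u ≡ u 1) → Shape t W S U
  spread : ∀ d → t ≡ suc d → W < d ℕ.* suc d → Shape t W S U

-- With s = d + 1 and t = e + 1, the sum (s - 1) s + (t - 1) t falls short of (s + t - 1) (s + t) by
-- 2 s t. A product of two nontrivial monomials is therefore never extremal.
b-superadditive : ∀ d e → d ℕ.* suc d ℕ.+ e ℕ.* suc e < (d ℕ.+ suc e) ℕ.* suc (d ℕ.+ suc e)
b-superadditive d e = subst (suc (d ℕ.* suc d ℕ.+ e ℕ.* suc e) ≤_) (sym (identity d e))
  (s≤s (ℕ.m≤m+n _ (2 ℕ.* d ℕ.* e ℕ.+ 2 ℕ.* d ℕ.+ 2 ℕ.* e ℕ.+ 1)))
  where
  identity : ∀ d e → (d ℕ.+ suc e) ℕ.* suc (d ℕ.+ suc e)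
    ≡ suc (d ℕ.* suc d ℕ.+ e ℕ.* suc e ℕ.+ (2 ℕ.* d ℕ.* e ℕ.+ 2 ℕ.* d ℕ.+ 2 ℕ.* e ℕ.+ 1))
  identity = solve-∀

combine : ∀ {t W S U t′ W′ S′ U′} → Shape t W S U → Shape t′ W′ S′ U′ →
          Shape (t ℕ.+ t′) (W ℕ.+ W′) (λ h → S h ℕ.+ S′ h) (λ u → U u * U′ u)
combine (one refl refl S≡ U≡) (one refl refl S′≡ U′≡) =
  one refl refl (λ h h0 → cong₂ ℕ._+_ (S≡ h h0) (S′≡ h h0)) (λ u u0 → cong₂ _*_ (U≡ u u0) (U′≡ u u0))
combine (one refl refl S≡ U≡) (single d refl refl S′≡ U′≡) =
  single d refl refl (λ h h0 → cong₂ ℕ._+_ (S≡ h h0) (S′≡ h h0))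
    (λ u u0 → trans (cong₂ _*_ (U≡ u u0) (U′≡ u u0)) (ℚ.*-identityˡ (u 1)))
combine (one refl refl S≡ U≡) (spread d refl W<) = spread d refl W<
combine {t = t} {W} (single d t≡ W≡ S≡ U≡) (one refl refl S′≡ U′≡) =
  single d (trans (ℕ.+-identityʳ t) t≡) (trans (ℕ.+-identityʳ W) W≡)
    (λ h h0 → trans (cong₂ ℕ._+_ (S≡ h h0) (S′≡ h h0)) (ℕ.+-identityʳ (h d 1)))
    (λ u u0 → trans (cong₂ _*_ (U≡ u u0) (U′≡ u u0)) (ℚ.*-identityʳ (u 1)))
combine {t = t} {W} (spread d t≡ W<) (one refl refl S′≡ U′≡) =
  spread d (trans (ℕ.+-identityʳ t) t≡) (subst (_< d ℕ.* suc d) (sym (ℕ.+-identityʳ W)) W<)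
combine (single d refl W≡ _ _) (single e refl W′≡ _ _) = spread (d ℕ.+ suc e) refl
  (ℕ.≤-<-trans (ℕ.+-mono-≤ (ℕ.≤-reflexive W≡) (ℕ.≤-reflexive W′≡)) (b-superadditive d e))
combine (single d refl W≡ _ _) (spread e refl W′<) = spread (d ℕ.+ suc e) refl
  (ℕ.≤-<-trans (ℕ.+-mono-≤ (ℕ.≤-reflexive W≡) (ℕ.<⇒≤ W′<)) (b-superadditive d e))
combine (spread d refl W<) (single e refl W′≡ _ _) = spread (d ℕ.+ suc e) refl
  (ℕ.≤-<-trans (ℕ.+-mono-≤ (ℕ.<⇒≤ W<) (ℕ.≤-reflexive W′≡)) (b-superadditive d e))
combine (spread d refl W<) (spread e refl W′<) = spread (d ℕ.+ suc e) refl
  (ℕ.≤-<-trans (ℕ.+-mono-≤ (ℕ.<⇒≤ W<) (ℕ.<⇒≤ W′<)) (b-superadditive d e))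

entry-shape : ∀ i e → Shape (suc i ℕ.* e) (i ℕ.* (suc i ℕ.* e)) (λ h → h i e) (λ u → u e)
entry-shape i 0 = one (ℕ.*-zeroʳ (suc i)) (trans (cong (i ℕ.*_) (ℕ.*-zeroʳ (suc i))) (ℕ.*-zeroʳ i))
  (λ h h0 → h0 i) (λ u u0 → u0)
entry-shape i 1 = single i (ℕ.*-identityʳ (suc i)) (cong (i ℕ.*_) (ℕ.*-identityʳ (suc i)))
  (λ h h0 → refl) (λ u u0 → refl)
-- In degree t = (i + 1) (e + 2) the sum W is i t, and i < t - 1 because the exponent is at least 2.
entry-shape i (suc (suc e)) = spread (suc e ℕ.+ i ℕ.* suc (suc e)) refl
  (ℕ.*-monoˡ-< (suc i ℕ.* suc (suc e)) (s≤s (ℕ.≤-trans (ℕ.m≤m*n i (suc (suc e))) (ℕ.m≤n+m (i ℕ.* suc (suc e)) e))))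

-- The rows are indexed by ι, to allow for an induction on their number.
row-shape : ∀ i (r : Vec ℕ J) → Shape (∑ʳ (suc i ℕ.*_) r) (∑ʳ (λ e → i ℕ.* (suc i ℕ.* e)) r)
                                      (λ h → ∑ʳ (h i) r) (λ u → uʳ u r)
row-shape i []      = one refl refl (λ h h0 → refl) (λ u u0 → refl)
row-shape i (e ∷ r) = combine (entry-shape i e) (row-shape i r)

shape : ∀ (ι : ℕ → ℕ) (m : Monomial I J) →
        Shape (∑ᴹ (λ i e → suc (ι i) ℕ.* e) m) (∑ᴹ (λ i e → ι i ℕ.* (suc (ι i) ℕ.* e)) m)
              (λ h → ∑ᴹ (λ i → h (ι i)) m) (λ u → uᴹ u m)
shape ι []      = one refl refl (λ h h0 → refl) (λ u u0 → refl)
shape ι (r ∷ m) = combine (row-shape (ι 0) r) (shape (ι ∘ suc) m)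

∑ʳ-+ : ∀ (g h : ℕ → ℕ) (r : Vec ℕ J) → ∑ʳ (λ e → g e ℕ.+ h e) r ≡ ∑ʳ g r ℕ.+ ∑ʳ h r
∑ʳ-+ g h []      = refl
∑ʳ-+ g h (e ∷ r) = trans (cong (g e ℕ.+ h e ℕ.+_) (∑ʳ-+ g h r)) (ℕ+.interchange (g e) (h e) _ _)

∑ᴹ-+ : ∀ (g h : ℕ → ℕ → ℕ) (m : Monomial I J) → ∑ᴹ (λ i e → g i e ℕ.+ h i e) m ≡ ∑ᴹ g m ℕ.+ ∑ᴹ h m
∑ᴹ-+ g h []      = refl
∑ᴹ-+ g h (r ∷ m) = trans (cong₂ ℕ._+_ (∑ʳ-+ (g 0) (h 0) r) (∑ᴹ-+ (g ∘ suc) (h ∘ suc) m))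
  (ℕ+.interchange (∑ʳ (g 0) r) (∑ʳ (h 0) r) _ _)

∑ʳ-* : ∀ c (h : ℕ → ℕ) (r : Vec ℕ J) → ∑ʳ (λ e → c ℕ.* h e) r ≡ c ℕ.* ∑ʳ h r
∑ʳ-* c h []      = sym (ℕ.*-zeroʳ c)
∑ʳ-* c h (e ∷ r) = trans (cong (c ℕ.* h e ℕ.+_) (∑ʳ-* c h r)) (sym (ℕ.*-distribˡ-+ c (h e) _))

∑ᴹ-* : ∀ c (h : ℕ → ℕ → ℕ) (m : Monomial I J) → ∑ᴹ (λ i e → c ℕ.* h i e) m ≡ c ℕ.* ∑ᴹ h m
∑ᴹ-* c h []      = sym (ℕ.*-zeroʳ c)
∑ᴹ-* c h (r ∷ m) = trans (cong₂ ℕ._+_ (∑ʳ-* c (h 0) r) (∑ᴹ-* c (h ∘ suc) m)) (sym (ℕ.*-distribˡ-+ c (∑ʳ (h 0) r) _))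

∑ʳ-≤ : ∀ {g h : ℕ → ℕ} → (∀ e → g e ≤ h e) → ∀ (r : Vec ℕ J) → ∑ʳ g r ≤ ∑ʳ h r
∑ʳ-≤ g≤h []      = z≤n
∑ʳ-≤ g≤h (e ∷ r) = ℕ.+-mono-≤ (g≤h e) (∑ʳ-≤ g≤h r)

∑ᴹ-≤ : ∀ {g h : ℕ → ℕ → ℕ} → (∀ i e → g i e ≤ h i e) → ∀ (m : Monomial I J) → ∑ᴹ g m ≤ ∑ᴹ h m
∑ᴹ-≤ g≤h []      = z≤n
∑ᴹ-≤ g≤h (r ∷ m) = ℕ.+-mono-≤ (∑ʳ-≤ (g≤h 0) r) (∑ᴹ-≤ (g≤h ∘ suc) m)

∑ᴹ-cong : ∀ {g h : ℕ → ℕ → ℕ} → (∀ i e → g i e ≡ h i e) → ∀ (m : Monomial I J) → ∑ᴹ g m ≡ ∑ᴹ h m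
∑ᴹ-cong g≗h m = ℕ.≤-antisym (∑ᴹ-≤ (λ i e → ℕ.≤-reflexive (g≗h i e)) m) (∑ᴹ-≤ (λ i e → ℕ.≤-reflexive (sym (g≗h i e))) m)

∑ᴹ-map : ∀ (h : ℕ → ℕ → ℕ) f (m : Monomial I J) → ∑ᴹ h (Vec.map (Vec.map f) m) ≡ ∑ᴹ (λ i e → h i (f e)) m
∑ᴹ-map h f []      = refl
∑ᴹ-map h f (r ∷ m) = cong₂ ℕ._+_ (row≡ r) (∑ᴹ-map (h ∘ suc) f m)
  where
  row≡ : ∀ {J} (r : Vec ℕ J) → ∑ʳ (h 0) (Vec.map f r) ≡ ∑ʳ (h 0 ∘ f) r
  row≡ []      = refl
  row≡ (e ∷ r) = cong (h 0 (f e) ℕ.+_) (row≡ r)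

pos : ℕ → ℕ
pos zero    = 0
pos (suc _) = 1

-- The first term is largest for a single indeterminate of high degree; for N larger than the degrees
-- of all blocks, the second one, which counts indeterminates, only matters in case of equality.
v : ℕ → ℕ → ℕ → ℕ
v N i e = N ℕ.* (i ℕ.* (suc i ℕ.* e)) ℕ.+ pos e

v-vanishing : ∀ N → Vanishing (v N)
v-vanishing N i = trans (ℕ.+-identityʳ _) (trans
  (cong (λ k → N ℕ.* (i ℕ.* k)) (ℕ.*-zeroʳ (suc i))) (trans (cong (N ℕ.*_) (ℕ.*-zeroʳ i)) (ℕ.*-zeroʳ N)))

Additive : (ℕ → ℕ → ℕ) → Monomial I J → Monomial I J → Set
Additive h k l = ∑ᴹ h (k ⊞ l) ≡ ∑ᴹ h k ℕ.+ ∑ᴹ h l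

module _ (N : ℕ) where

  private
    v-linear : ∀ i e f → N ℕ.* (i ℕ.* (suc i ℕ.* (e ℕ.+ f))) ≡ N ℕ.* (i ℕ.* (suc i ℕ.* e)) ℕ.+ N ℕ.* (i ℕ.* (suc i ℕ.* f))
    v-linear i e f = identity N i e f
      where
      identity : ∀ N i e f → N ℕ.* (i ℕ.* (suc i ℕ.* (e ℕ.+ f))) ≡ N ℕ.* (i ℕ.* (suc i ℕ.* e)) ℕ.+ N ℕ.* (i ℕ.* (suc i ℕ.* f))
      identity = solve-∀

    -- Either the measure drops strictly, or the factors have no common indeterminate. The latter is
    -- recorded as additivity for all test functions, the form in which `Spells` uses it.
    Dichotomy : (Sv Kv Lv : ℕ) → ((ℕ → ℕ → ℕ) → Set) → Set
    Dichotomy Sv Kv Lv Add = Sv < Kv ℕ.+ Lv ⊎ (∀ h → Vanishing h → Add h)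

    merge : ∀ {x x′ y y′ z z′} (S S′ K K′ L L′ : (ℕ → ℕ → ℕ) → ℕ) →
            x ≡ S (v N) → y ≡ K (v N) → z ≡ L (v N) → x′ ≡ S′ (v N) → y′ ≡ K′ (v N) → z′ ≡ L′ (v N) →
            Dichotomy x y z (λ h → S h ≡ K h ℕ.+ L h) → Dichotomy x′ y′ z′ (λ h → S′ h ≡ K′ h ℕ.+ L′ h) →
            Dichotomy (x ℕ.+ x′) (y ℕ.+ y′) (z ℕ.+ z′) (λ h → S h ℕ.+ S′ h ≡ (K h ℕ.+ K′ h) ℕ.+ (L h ℕ.+ L′ h))
    merge S S′ K K′ L L′ refl refl refl refl refl refl (inj₁ lt) rest = inj₁ (subst (S (v N) ℕ.+ S′ (v N) <_)
      (ℕ+.interchange (K (v N)) (L (v N)) (K′ (v N)) (L′ (v N))) (ℕ.+-mono-<-≤ lt (weaken rest)))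
      where
      weaken : Dichotomy (S′ (v N)) (K′ (v N)) (L′ (v N)) (λ h → S′ h ≡ K′ h ℕ.+ L′ h) → S′ (v N) ≤ K′ (v N) ℕ.+ L′ (v N)
      weaken (inj₁ lt) = ℕ.<⇒≤ lt
      weaken (inj₂ eq) = ℕ.≤-reflexive (eq (v N) (v-vanishing N))
    merge S S′ K K′ L L′ refl refl refl refl refl refl (inj₂ eq) (inj₁ lt) = inj₁ (subst (S (v N) ℕ.+ S′ (v N) <_)
      (ℕ+.interchange (K (v N)) (L (v N)) (K′ (v N)) (L′ (v N))) (ℕ.+-mono-≤-< (ℕ.≤-reflexive (eq (v N) (v-vanishing N))) lt))
    merge S S′ K K′ L L′ refl refl refl refl refl refl (inj₂ eq) (inj₂ eq′) = inj₂ λ h h0 →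
      trans (cong₂ ℕ._+_ (eq h h0) (eq′ h h0)) (ℕ+.interchange (K h) (L h) (K′ h) (L′ h))

    entry : ∀ i e f → Dichotomy (v N i (e ℕ.+ f)) (v N i e) (v N i f) (λ h → h i (e ℕ.+ f) ≡ h i e ℕ.+ h i f)
    entry i zero    f       = inj₂ λ h h0 → cong (ℕ._+ h i f) (sym (h0 i))
    entry i (suc e) zero    = inj₂ λ h h0 → trans (cong (h i) (ℕ.+-identityʳ (suc e)))
      (trans (sym (ℕ.+-identityʳ (h i (suc e)))) (cong (h i (suc e) ℕ.+_) (sym (h0 i))))
    -- For a common indeterminate the first term of `v` is additive, but the product counts 1 where
    -- the factors count 1 + 1.
    entry i (suc e) (suc f) = inj₁ (begin-strict
      N ℕ.* (i ℕ.* (suc i ℕ.* (suc e ℕ.+ suc f))) ℕ.+ 1  ≡⟨ cong (ℕ._+ 1) (v-linear i (suc e) (suc f)) ⟩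
      x ℕ.+ y ℕ.+ 1                                       <⟨ ℕ.+-monoʳ-< (x ℕ.+ y) (s≤s (s≤s z≤n)) ⟩
      x ℕ.+ y ℕ.+ (1 ℕ.+ 1)                               ≡⟨ ℕ+.interchange x y 1 1 ⟩
      (x ℕ.+ 1) ℕ.+ (y ℕ.+ 1)                             ∎)
      where
      open ℕ.≤-Reasoning
      x y : ℕ
      x = N ℕ.* (i ℕ.* (suc i ℕ.* suc e))
      y = N ℕ.* (i ℕ.* (suc i ℕ.* suc f))

    row-dichotomy : ∀ i (q r : Vec ℕ J) → Dichotomy (∑ʳ (v N i) (Vec.zipWith ℕ._+_ q r)) (∑ʳ (v N i) q) (∑ʳ (v N i) r)
      (λ h → ∑ʳ (h i) (Vec.zipWith ℕ._+_ q r) ≡ ∑ʳ (h i) q ℕ.+ ∑ʳ (h i) r)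
    row-dichotomy i []      []      = inj₂ λ h h0 → refl
    row-dichotomy i (e ∷ q) (f ∷ r) = merge (λ h → h i (e ℕ.+ f)) (λ h → ∑ʳ (h i) (Vec.zipWith ℕ._+_ q r))
      (λ h → h i e) (λ h → ∑ʳ (h i) q) (λ h → h i f) (λ h → ∑ʳ (h i) r) refl refl refl refl refl refl (entry i e f) (row-dichotomy i q r)

    dichotomyᶥ : ∀ (ι : ℕ → ℕ) (k l : Monomial I J) →
      Dichotomy (∑ᴹ (v N ∘ ι) (k ⊞ l)) (∑ᴹ (v N ∘ ι) k) (∑ᴹ (v N ∘ ι) l) (λ h → Additive (h ∘ ι) k l)
    dichotomyᶥ ι []      []      = inj₂ λ h h0 → refl
    dichotomyᶥ ι (q ∷ k) (r ∷ l) = merge (λ h → ∑ʳ (h (ι 0)) (Vec.zipWith ℕ._+_ q r)) (λ h → ∑ᴹ (h ∘ ι ∘ suc) (k ⊞ l))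
      (λ h → ∑ʳ (h (ι 0)) q) (λ h → ∑ᴹ (h ∘ ι ∘ suc) k) (λ h → ∑ʳ (h (ι 0)) r) (λ h → ∑ᴹ (h ∘ ι ∘ suc) l)
      refl refl refl refl refl refl (row-dichotomy (ι 0) q r) (dichotomyᶥ (ι ∘ suc) k l)

  dichotomy : ∀ (k l : Monomial I J) → ∑ᴹ (v N) (k ⊞ l) < ∑ᴹ (v N) k ℕ.+ ∑ᴹ (v N) l ⊎ (∀ h → Vanishing h → Additive h k l)
  dichotomy = dichotomyᶥ id

-- Monomials occurring in a product of blocks

Block : Set
Block = ℕ × ℕ

-- The pair (i , d) stands for the block d^{1+i}, whose extremal monomials are the x_{d,j}^{1+i};
-- as in ∑ᴹ, the degrees of indeterminates are counted from 0 in the argument of h, hence the pred.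
∑ᴮ : (ℕ → ℕ → ℕ) → List Block → ℕ
∑ᴮ h bs = sum (List.map (λ b → h (ℕ.pred (proj₂ b)) (suc (proj₁ b))) bs)

-- Equality of two multisets, the nonzero exponents of `m` with their degrees and the extremal
-- powers of the blocks, tested by all functions that ignore zero exponents.
Spells : Monomial I J → List Block → Set
Spells m bs = ∀ h → Vanishing h → ∑ᴹ h m ≡ ∑ᴮ h bs

Admissible : ℕ → List Block → Set
Admissible n = All (λ b → 0 < proj₂ b × proj₂ b ≤ n)

∏ᴮ : (ℕ → Series) → List Block → Series
∏ᴮ F bs = ∏ (List.map (λ b → dilations F (proj₁ b) (proj₂ b)) bs)

scale-unscale : ∀ r .{{_ : NonZero r}} (m : Monomial I J) → VecAll.All (VecAll.All (r ∣_)) m →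
                Vec.map (Vec.map (ℕ._* r)) (Vec.map (Vec.map (_/ r)) m) ≡ m
scale-unscale r []      VecAll.[]        = refl
scale-unscale r (q ∷ m) (r∣q VecAll.∷ r∣m) = cong₂ _∷_ (row≡ q r∣q) (scale-unscale r m r∣m)
  where
  row≡ : ∀ {J} (q : Vec ℕ J) → VecAll.All (r ∣_) q → Vec.map (ℕ._* r) (Vec.map (_/ r) q) ≡ q
  row≡ []      VecAll.[]          = refl
  row≡ (e ∷ q) (r∣e VecAll.∷ r∣q) = cong₂ _∷_ (m/n*n≡m r∣e) (row≡ q r∣q)

-- Summed over a monomial, this bounds the number of its indeterminates by its degree, even after
-- scaling the exponents.
pos≤ : ∀ i e r → pos (e ℕ.* r) ≤ suc i ℕ.* e
pos≤ i zero    r       = z≤n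
pos≤ i (suc e) zero    rewrite ℕ.*-zeroʳ e = z≤n
pos≤ i (suc e) (suc r) = s≤s z≤n

module _ {u ε} (gen : IsGenerating u ε) {n : ℕ} where

  private
    F : ℕ → Series
    F = graded (uᴹ u)

    V : Monomial I J → ℕ
    V = ∑ᴹ (v (suc n))

    Vᴮ : List Block → ℕ
    Vᴮ = ∑ᴮ (v (suc n))

  -- Here `q` is the coefficient of `m` in the series of the block. In the case `tight`, `m` is a
  -- power x_{d,j}^r, and its coefficient is u_1 = ε whatever the block.
  data BlockOutcome (m : Monomial I J) (b : Block) (q : ℚ) : Set where
    zero  : q ≡ 0ℚ → BlockOutcome m b q
    below : V m < Vᴮ (b ∷ []) → BlockOutcome m b q
    tight : Spells m (b ∷ []) → q ≡ ε → BlockOutcome m b q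

  graded-outcome : ∀ i d → suc d ≤ n → (g : Monomial I J) → deg g ≡ suc d →
                   BlockOutcome (Vec.map (Vec.map (ℕ._* suc i)) g) (i , suc d) (uᴹ u g)
  graded-outcome i d d<n g deg≡ with shape id g
  ... | one t≡0 _ _ _ = contradiction (trans (sym deg≡) (trans (deg≡∑ᴹ g) t≡0)) λ ()
  ... | single d′ t≡ _ S≡ U≡ with refl ← trans (sym t≡) (trans (sym (deg≡∑ᴹ g)) deg≡) =
    tight (λ h h0 → trans (∑ᴹ-map h (ℕ._* suc i) g) (trans (S≡ (λ i′ e → h i′ (e ℕ.* suc i)) h0)
            (trans (cong (h d) (ℕ.*-identityˡ (suc i))) (sym (ℕ.+-identityʳ _)))))
          (trans (U≡ u (u-0 gen)) (u-1 gen))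
  -- The multiplier `suc n` is chosen for this case: the first term of V is smaller by at least
  -- `suc n * r`, whereas the count of indeterminates is at most deg g ≤ n.
  ... | spread d′ t≡ W< with refl ← trans (sym t≡) (trans (sym (deg≡∑ᴹ g)) deg≡) = below (begin-strict
    ∑ᴹ (v (suc n)) (Vec.map (Vec.map (ℕ._* r)) g)
      ≡⟨ ∑ᴹ-map (v (suc n)) (ℕ._* r) g ⟩
    ∑ᴹ (λ i e → suc n ℕ.* (i ℕ.* (suc i ℕ.* (e ℕ.* r))) ℕ.+ pos (e ℕ.* r)) g
      ≡⟨ ∑ᴹ-cong (λ i e → cong (ℕ._+ pos (e ℕ.* r)) (regroup (suc n) i e r)) g ⟩
    ∑ᴹ (λ i e → suc n ℕ.* r ℕ.* (i ℕ.* (suc i ℕ.* e)) ℕ.+ pos (e ℕ.* r)) g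
      ≡⟨ ∑ᴹ-+ (λ i e → suc n ℕ.* r ℕ.* (i ℕ.* (suc i ℕ.* e))) (λ i e → pos (e ℕ.* r)) g ⟩
    ∑ᴹ (λ i e → suc n ℕ.* r ℕ.* (i ℕ.* (suc i ℕ.* e))) g ℕ.+ ∑ᴹ (λ i e → pos (e ℕ.* r)) g
      ≡⟨ cong (ℕ._+ ∑ᴹ (λ i e → pos (e ℕ.* r)) g) (∑ᴹ-* (suc n ℕ.* r) (λ i e → i ℕ.* (suc i ℕ.* e)) g) ⟩
    suc n ℕ.* r ℕ.* W ℕ.+ ∑ᴹ (λ i e → pos (e ℕ.* r)) g
      ≤⟨ ℕ.+-monoʳ-≤ (suc n ℕ.* r ℕ.* W) (ℕ.≤-trans (∑ᴹ-≤ (λ i e → pos≤ i e r) g)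
           (ℕ.≤-trans (ℕ.≤-reflexive t≡) d<n)) ⟩
    suc n ℕ.* r ℕ.* W ℕ.+ n
      <⟨ ℕ.+-monoʳ-< (suc n ℕ.* r ℕ.* W) (ℕ.<-≤-trans (ℕ.n<1+n n) (ℕ.m≤m*n (suc n) r)) ⟩
    suc n ℕ.* r ℕ.* W ℕ.+ suc n ℕ.* r
      ≡⟨ trans (ℕ.+-comm (suc n ℕ.* r ℕ.* W) _) (sym (ℕ.*-suc (suc n ℕ.* r) W)) ⟩
    suc n ℕ.* r ℕ.* suc W
      ≤⟨ ℕ.*-monoʳ-≤ (suc n ℕ.* r) W< ⟩
    suc n ℕ.* r ℕ.* (d ℕ.* suc d)
      ≡⟨ regroup′ (suc n) d r ⟩
    suc n ℕ.* (d ℕ.* (suc d ℕ.* r))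
      ≤⟨ ℕ.m≤m+n _ 1 ⟩
    v (suc n) d r
      ≡⟨ ℕ.+-identityʳ _ ⟨
    Vᴮ ((i , suc d) ∷ []) ∎)
    where
    open ℕ.≤-Reasoning
    r W : ℕ
    r = suc i
    W = ∑ᴹ (λ i e → i ℕ.* (suc i ℕ.* e)) g

    regroup : ∀ N i e r → N ℕ.* (i ℕ.* (suc i ℕ.* (e ℕ.* r))) ≡ N ℕ.* r ℕ.* (i ℕ.* (suc i ℕ.* e))
    regroup = solve-∀

    regroup′ : ∀ N d r → N ℕ.* r ℕ.* (d ℕ.* suc d) ≡ N ℕ.* (d ℕ.* (suc d ℕ.* r))
    regroup′ = solve-∀

  block-outcome : ∀ i d → 0 < d → d ≤ n → (m : Monomial I J) → BlockOutcome m (i , d) (coeff (dilations F i d) m)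
  block-outcome i (suc d) _ d≤n m with VecAll.all? (VecAll.all? (suc i ∣?_)) m
  ... | no  _   = zero refl
  ... | yes r∣m with deg (Vec.map (Vec.map (_/ suc i)) m) ℕ.≟ suc d
  ...   | no deg≢  = zero (guard-no (deg (Vec.map (Vec.map (_/ suc i)) m) ℕ.≟ suc d) deg≢)
  ...   | yes deg≡ = subst₂ (λ m → BlockOutcome m (i , suc d)) (scale-unscale (suc i) m r∣m)
    (sym (guard-yes (deg (Vec.map (Vec.map (_/ suc i)) m) ℕ.≟ suc d) deg≡))
    (graded-outcome i d d≤n (Vec.map (Vec.map (_/ suc i)) m) deg≡)

  -- In the case `tight` only the sign of `q` is controlled, since `m` may have several
  -- factorizations into extremal monomials; their coefficients share the sign and cannot cancel.
  data Outcome (m : Monomial I J) (bs : List Block) (q : ℚ) : Set where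
    zero  : q ≡ 0ℚ → Outcome m bs q
    below : V m < Vᴮ bs → Outcome m bs q
    tight : Spells m bs → 0ℚ ℚ.≤ ε ^^ length bs * q → Outcome m bs q

  outcome-+ : ∀ {m : Monomial I J} {bs p q} → Outcome m bs p → Outcome m bs q → Outcome m bs (p + q)
  outcome-+ (zero refl) (zero refl)  = zero refl
  outcome-+ (below lt)  _            = below lt
  outcome-+ _           (below lt)   = below lt
  outcome-+ {m = m} {bs} {q = q} (zero refl) (tight sp 0≤) = tight sp (subst (λ q → 0ℚ ℚ.≤ ε ^^ length bs * q) (sym (ℚ.+-identityˡ q)) 0≤)
  outcome-+ {m = m} {bs} {p = p} (tight sp 0≤) (zero refl) = tight sp (subst (λ q → 0ℚ ℚ.≤ ε ^^ length bs * q) (sym (ℚ.+-identityʳ p)) 0≤)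
  outcome-+ {m = m} {bs} {p} {q} (tight sp 0≤) (tight _ 0≤′) = tight sp (subst (0ℚ ℚ.≤_)
    (sym (ℚ.*-distribˡ-+ (ε ^^ length bs) p q)) (ℚ.+-mono-≤ 0≤ 0≤′))


  V-⊞ : ∀ (k l : Monomial I J) → V (k ⊞ l) ≤ V k ℕ.+ V l
  V-⊞ k l with dichotomy (suc n) k l
  ... | inj₁ lt  = ℕ.<⇒≤ lt
  ... | inj₂ add = ℕ.≤-reflexive (add (v (suc n)) (v-vanishing (suc n)))

  Vᴮ-∷ : ∀ b bs → Vᴮ (b ∷ []) ℕ.+ Vᴮ bs ≡ Vᴮ (b ∷ bs)
  Vᴮ-∷ b bs = cong (ℕ._+ Vᴮ bs) (ℕ.+-identityʳ (v (suc n) (ℕ.pred (proj₂ b)) (suc (proj₁ b))))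

  -- V is subadditive, so one strict inequality suffices for `below`. If both factors are tight,
  -- either they share an indeterminate and V drops, or their spellings concatenate and the two
  -- factors ε cancel.
  outcome-⊞ : ∀ {k l : Monomial I J} {b bs p q} → BlockOutcome k b p → Outcome l bs q → Outcome (k ⊞ l) (b ∷ bs) (p * q)
  outcome-⊞ {q = q} (zero refl) _ = zero (ℚ.*-zeroˡ q)
  outcome-⊞ {p = p} _ (zero refl) = zero (ℚ.*-zeroʳ p)
  outcome-⊞ {k = k} {l} {b} {bs} (below lt) (below lt′) = below (ℕ.≤-<-trans (V-⊞ k l)
    (subst (V k ℕ.+ V l <_) (Vᴮ-∷ b bs) (ℕ.+-mono-< lt lt′)))
  outcome-⊞ {k = k} {l} {b} {bs} (below lt) (tight sp _) = below (ℕ.≤-<-trans (V-⊞ k l)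
    (subst (V k ℕ.+ V l <_) (Vᴮ-∷ b bs) (ℕ.+-mono-<-≤ lt (ℕ.≤-reflexive (sp (v (suc n)) (v-vanishing (suc n)))))))
  outcome-⊞ {k = k} {l} {b} {bs} (tight sp _) (below lt) = below (ℕ.≤-<-trans (V-⊞ k l)
    (subst (V k ℕ.+ V l <_) (Vᴮ-∷ b bs) (ℕ.+-mono-≤-< (ℕ.≤-reflexive (sp (v (suc n)) (v-vanishing (suc n)))) lt)))
  outcome-⊞ {k = k} {l} {b} {bs} {q = q} (tight spk refl) (tight spl 0≤) with dichotomy (suc n) k l
  ... | inj₁ lt  = below (subst (V (k ⊞ l) <_) (trans (cong₂ ℕ._+_ (spk _ (v-vanishing (suc n))) (spl _ (v-vanishing (suc n)))) (Vᴮ-∷ b bs)) lt)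
  ... | inj₂ add = tight
    (λ h h0 → trans (add h h0) (trans (cong₂ ℕ._+_ (spk h h0) (spl h h0)) (cong (ℕ._+ ∑ᴮ h bs) (ℕ.+-identityʳ _))))
    (subst (0ℚ ℚ.≤_) (sym (ε-cancel gen (ε ^^ length bs) q)) 0≤)

  ∑-outcome : ∀ {m : Monomial I J} {bs} {xs : List A} {f : A → ℚ} → (∀ {x} → x ∈ xs → Outcome m bs (f x)) → Outcome m bs (∑ xs f)
  ∑-outcome {xs = []}     out = zero refl
  ∑-outcome {xs = x ∷ xs} {f} out = outcome-+ (out (here refl)) (∑-outcome {xs = xs} {f} (out ∘ there))

  opaque
    unfolding _⊙_

    summand-outcome : ∀ {b bs} → 0 < proj₂ b × proj₂ b ≤ n →
      (∀ {I J} (l : Monomial I J) → Outcome l bs (coeff (∏ᴮ F bs) l)) →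
      ∀ (m : Monomial I J) {kl} → kl ∈ factorizations m →
      Outcome m (b ∷ bs) (coeff (dilations F (proj₁ b) (proj₂ b)) (proj₁ kl) * coeff (∏ᴮ F bs) (proj₂ kl))
    summand-outcome {b = i , d} {bs} (d>0 , d≤n) rest m {k , l} kl∈ = subst
      (λ m → Outcome m ((i , d) ∷ bs) (coeff (dilations F i d) k * coeff (∏ᴮ F bs) l)) (factorizations-∈⁻ m kl∈)
      (outcome-⊞ (block-outcome i d d>0 d≤n k) (rest l))

    ∏-outcome : ∀ {bs} → Admissible n bs → ∀ (m : Monomial I J) → Outcome m bs (coeff (∏ᴮ F bs) m)
    ∏-outcome {bs = []} [] m with shape id m
    ... | one t≡ _ S≡ _ = tight S≡ (subst (λ q → 0ℚ ℚ.≤ 1ℚ * q) (sym (guard-yes (deg m ℕ.≟ 0) (trans (deg≡∑ᴹ m) t≡))) (ℚ.nonNegative⁻¹ (1ℚ * 1ℚ)))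
    ... | single d t≡ _ _ _ = zero (guard-no (deg m ℕ.≟ 0) λ deg≡0 → contradiction (trans (sym t≡) (trans (sym (deg≡∑ᴹ m)) deg≡0)) λ ())
    ... | spread d t≡ _     = zero (guard-no (deg m ℕ.≟ 0) λ deg≡0 → contradiction (trans (sym t≡) (trans (sym (deg≡∑ᴹ m)) deg≡0)) λ ())
    ∏-outcome {bs = b ∷ bs} (b-ok ∷ bs-ok) m = ∑-outcome {xs = factorizations m}
      (summand-outcome b-ok (∏-outcome bs-ok) m)

-- Linear independence

ind : Bool → ℕ
ind b = if b then 1 else 0

≡ᵇ-true : ∀ {m n} → (m ℕ.≡ᵇ n) ≡ true → m ≡ n
≡ᵇ-true {m} {n} eq = ℕ.≡ᵇ⇒≡ m n (subst T (sym eq) tt)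

≡ᵇ-refl : ∀ m → (m ℕ.≡ᵇ m) ≡ true
≡ᵇ-refl zero    = refl
≡ᵇ-refl (suc m) = ≡ᵇ-refl m

∑ʳ-replicate : ∀ {h} → h 0 ≡ 0 → ∀ J → ∑ʳ h (Vec.replicate J 0) ≡ 0
∑ʳ-replicate h0 zero    = refl
∑ʳ-replicate h0 (suc J) = cong₂ ℕ._+_ h0 (∑ʳ-replicate h0 J)

∑ᴹ-replicate : ∀ {h} → Vanishing h → ∀ I → ∑ᴹ h (Vec.replicate I (Vec.replicate J 0)) ≡ 0
∑ᴹ-replicate         h0 zero    = refl
∑ᴹ-replicate {J = J} h0 (suc I) = cong₂ ℕ._+_ (∑ʳ-replicate (h0 0) J) (∑ᴹ-replicate (h0 ∘ suc) I)

∑ʳ-0 : ∀ (r : Vec ℕ J) → ∑ʳ (λ _ → 0) r ≡ 0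
∑ʳ-0 []      = refl
∑ʳ-0 (e ∷ r) = ∑ʳ-0 r

∑ᴹ-0 : ∀ (m : Monomial I J) → ∑ᴹ (λ _ _ → 0) m ≡ 0
∑ᴹ-0 []      = refl
∑ᴹ-0 (r ∷ m) = cong₂ ℕ._+_ (∑ʳ-0 r) (∑ᴹ-0 m)

scaleʳ : ℕ → Vec ℕ J → Vec ℕ J
scaleʳ r = Vec.map (ℕ._* r)

scale : ℕ → Monomial I J → Monomial I J
scale r = Vec.map (scaleʳ r)

zero-⊞ʳ : ∀ s (r : Vec ℕ J) → Vec.zipWith ℕ._+_ (scaleʳ s (Vec.replicate J 0)) r ≡ r
zero-⊞ʳ s []      = refl
zero-⊞ʳ s (e ∷ r) = cong (e ∷_) (zero-⊞ʳ s r)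

zero-⊞ : ∀ s (m : Monomial I J) → scale s (Vec.replicate I (Vec.replicate J 0)) ⊞ m ≡ m
zero-⊞ s []      = refl
zero-⊞ s (r ∷ m) = cong₂ _∷_ (zero-⊞ʳ s r) (zero-⊞ s m)

-- The test function whose sum over a monomial counts the indices j for which x_{1+d,j} has exponent
-- exactly 1 + e.
occurs : ℕ → ℕ → ℕ → ℕ → ℕ
occurs d e i k = ind ((i ℕ.≡ᵇ d) ∧ (k ℕ.≡ᵇ suc e))

occurs-vanishing : ∀ d e → Vanishing (occurs d e)
occurs-vanishing d e i with i ℕ.≡ᵇ d
... | true  = refl
... | false = refl

module _ {u : ℕ → ℚ} (u-0 : u 0 ≡ 1ℚ) where

  uʳ-replicate : ∀ J → uʳ u (Vec.replicate J 0) ≡ 1ℚ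
  uʳ-replicate zero    = refl
  uʳ-replicate (suc J) = cong₂ _*_ u-0 (uʳ-replicate J)

  uᴹ-replicate : ∀ I J → uᴹ u (Vec.replicate I (Vec.replicate J 0)) ≡ 1ℚ
  uᴹ-replicate zero    J = refl
  uᴹ-replicate (suc I) J = cong₂ _*_ (uʳ-replicate J) (uᴹ-replicate I J)

  record Factorʳ (e : ℕ) (r : Vec ℕ J) : Set where
    field
      x       : Vec ℕ J
      rest    : Vec ℕ J
      x⊞rest≡ : Vec.zipWith ℕ._+_ (scaleʳ (suc e) x) rest ≡ r
      ∑-x     : ∀ h → h 0 ≡ 0 → ∑ʳ h x ≡ h 1
      uʳ-x    : uʳ u x ≡ u 1
      ∑-rest  : ∀ h → h 0 ≡ 0 → ∑ʳ h r ≡ h (suc e) ℕ.+ ∑ʳ h rest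

  factorʳ : ∀ e (r : Vec ℕ J) → 0 < ∑ʳ (λ k → ind (k ℕ.≡ᵇ suc e)) r → Factorʳ e r
  factorʳ {suc J} e (k ∷ r) 0< with k ℕ.≡ᵇ suc e in eq
  ... | true  = record
    { x       = 1 ∷ Vec.replicate J 0
    ; rest    = 0 ∷ r
    ; x⊞rest≡ = cong₂ _∷_ (trans (ℕ.+-identityʳ _) (trans (ℕ.+-identityʳ (suc e)) (sym (≡ᵇ-true eq)))) (zero-⊞ʳ (suc e) r)
    ; ∑-x     = λ h h0 → trans (cong (h 1 ℕ.+_) (∑ʳ-replicate h0 J)) (ℕ.+-identityʳ (h 1))
    ; uʳ-x    = trans (cong (u 1 *_) (uʳ-replicate J)) (ℚ.*-identityʳ (u 1))
    ; ∑-rest  = λ h h0 → cong₂ ℕ._+_ (cong h (≡ᵇ-true eq)) (cong (ℕ._+ ∑ʳ h r) (sym h0))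
    }
  ... | false = record
    { x       = 0 ∷ f.x
    ; rest    = k ∷ f.rest
    ; x⊞rest≡ = cong (k ∷_) f.x⊞rest≡
    ; ∑-x     = λ h h0 → cong₂ ℕ._+_ h0 (f.∑-x h h0)
    ; uʳ-x    = trans (cong (_* uʳ u f.x) u-0) (trans (ℚ.*-identityˡ (uʳ u f.x)) f.uʳ-x)
    ; ∑-rest  = λ h h0 → trans (cong (h k ℕ.+_) (f.∑-rest h h0)) (ℕ+.x∙yz≈y∙xz (h k) (h (suc e)) (∑ʳ h f.rest))
    }
    where module f = Factorʳ (factorʳ e r 0<)

  -- A full power x_{1+d,j}^(1+e) is split off: `x` is the indeterminate itself, and `∑-rest`
  -- expresses that it no longer occurs in `rest`, without reference to j.
  record Factor (d e : ℕ) (m : Monomial I J) : Set where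
    field
      x       : Monomial I J
      rest    : Monomial I J
      x⊞rest≡ : scale (suc e) x ⊞ rest ≡ m
      ∑-x     : ∀ h → Vanishing h → ∑ᴹ h x ≡ h d 1
      uᴹ-x    : uᴹ u x ≡ u 1
      ∑-rest  : ∀ h → Vanishing h → ∑ᴹ h m ≡ h d (suc e) ℕ.+ ∑ᴹ h rest

  factor : ∀ d e (m : Monomial I J) → 0 < ∑ᴹ (occurs d e) m → Factor d e m
  factor {suc I} {J} zero e (r ∷ m) 0< = record
    { x       = f.x ∷ Vec.replicate I (Vec.replicate J 0)
    ; rest    = f.rest ∷ m
    ; x⊞rest≡ = cong₂ _∷_ f.x⊞rest≡ (zero-⊞ (suc e) m)
    ; ∑-x     = λ h h0 → trans (cong₂ ℕ._+_ (f.∑-x (h 0) (h0 0)) (∑ᴹ-replicate (h0 ∘ suc) I)) (ℕ.+-identityʳ (h 0 1))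
    ; uᴹ-x    = trans (cong₂ _*_ f.uʳ-x (uᴹ-replicate I J)) (ℚ.*-identityʳ (u 1))
    ; ∑-rest  = λ h h0 → trans (cong (ℕ._+ ∑ᴹ (h ∘ suc) m) (f.∑-rest (h 0) (h0 0))) (ℕ.+-assoc (h 0 (suc e)) _ _)
    }
    where module f = Factorʳ (factorʳ e r (subst (0 <_) (trans (cong (∑ʳ (occurs 0 e 0) r ℕ.+_) (∑ᴹ-0 m)) (ℕ.+-identityʳ _)) 0<))
  factor {suc I} {J} (suc d) e (r ∷ m) 0< = record
    { x       = Vec.replicate J 0 ∷ f.x
    ; rest    = r ∷ f.rest
    ; x⊞rest≡ = cong₂ _∷_ (zero-⊞ʳ (suc e) r) f.x⊞rest≡
    ; ∑-x     = λ h h0 → cong₂ ℕ._+_ (∑ʳ-replicate (h0 0) J) (f.∑-x (h ∘ suc) (h0 ∘ suc))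
    ; uᴹ-x    = trans (cong₂ _*_ (uʳ-replicate J) f.uᴹ-x) (ℚ.*-identityˡ (u 1))
    ; ∑-rest  = λ h h0 → trans (cong (∑ʳ (h 0) r ℕ.+_) (f.∑-rest (h ∘ suc) (h0 ∘ suc))) (ℕ+.x∙yz≈y∙xz (∑ʳ (h 0) r) (h (suc d) (suc e)) _)
    }
    where module f = Factor (factor d e m (subst (0 <_) (cong (ℕ._+ ∑ᴹ (occurs d e) m) (∑ʳ-0 r)) 0<))

unscale-scale : ∀ r .{{_ : NonZero r}} (m : Monomial I J) → Vec.map (Vec.map (_/ r)) (scale r m) ≡ m
unscale-scale r []      = refl
unscale-scale r (q ∷ m) = cong₂ _∷_ (row≡ q) (unscale-scale r m)
  where
  row≡ : ∀ {J} (q : Vec ℕ J) → Vec.map (_/ r) (scaleʳ r q) ≡ q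
  row≡ []      = refl
  row≡ (e ∷ q) = cong₂ _∷_ (m*n/n≡m e r) (row≡ q)

scale-divisible : ∀ r (m : Monomial I J) → VecAll.All (VecAll.All (r ∣_)) (scale r m)
scale-divisible r []      = VecAll.[]
scale-divisible r (q ∷ m) = row∣ q VecAll.∷ scale-divisible r m
  where
  row∣ : ∀ {J} (q : Vec ℕ J) → VecAll.All (r ∣_) (scaleʳ r q)
  row∣ []      = VecAll.[]
  row∣ (e ∷ q) = divides-refl e VecAll.∷ row∣ q

coeff-scale : ∀ f r .{{_ : NonZero r}} (m : Monomial I J) → coeff (f [x^ r ]) (scale r m) ≡ coeff f m
coeff-scale f r m = trans (guard-yes (VecAll.all? (VecAll.all? (r ∣?_)) (scale r m)) (scale-divisible r m))
  (cong (coeff f) (unscale-scale r m))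

∑-nonneg : ∀ (xs : List A) {f : A → ℚ} → (∀ {x} → x ∈ xs → 0ℚ ℚ.≤ f x) → 0ℚ ℚ.≤ ∑ xs f
∑-nonneg []       0≤f = ℚ.≤-refl
∑-nonneg (x ∷ xs) 0≤f = ℚ.+-mono-≤ (0≤f (here refl)) (∑-nonneg xs (0≤f ∘ there))

∑-positive : ∀ {xs : List A} {f : A → ℚ} → (∀ {x} → x ∈ xs → 0ℚ ℚ.≤ f x) → ∀ {x} → x ∈ xs → 0ℚ ℚ.< f x → 0ℚ ℚ.< ∑ xs f
∑-positive {xs = x ∷ xs} 0≤f (here refl) 0<fx = ℚ.+-mono-<-≤ 0<fx (∑-nonneg xs (0≤f ∘ there))
∑-positive {xs = x ∷ xs} 0≤f (there x∈)  0<fx = ℚ.+-mono-≤-< (0≤f (here refl)) (∑-positive (0≤f ∘ there) x∈ 0<fx)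

module _ {u ε} (gen : IsGenerating u ε) {n : ℕ} where

  private
    F : ℕ → Series
    F = graded (uᴹ u)

  -- Testing the spelling with V shows that `m` attains the maximal measure, which rules out
  -- `below`.
  outcome-nonneg : ∀ {m : Monomial I J} {bs q} → Spells m bs → Outcome gen {n} m bs q → 0ℚ ℚ.≤ ε ^^ length bs * q
  outcome-nonneg {bs = bs} sp (zero refl) = ℚ.≤-reflexive (sym (ℚ.*-zeroʳ (ε ^^ length bs)))
  outcome-nonneg sp (below lt)  = contradiction (sp (v (suc n)) (v-vanishing (suc n))) (ℕ.<⇒≢ lt)
  outcome-nonneg sp (tight _ 0≤) = 0≤

  opaque
    unfolding _⊙_

    -- After scaling by the common sign all summands are nonnegative. The factorization that splits
    -- off the power of the first block gives a positive one, by induction on the remaining blocks.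
    spelled-positive : ∀ {bs} → Admissible n bs → ∀ (m : Monomial I J) → Spells m bs → 0ℚ ℚ.< ε ^^ length bs * coeff (∏ᴮ F bs) m
    spelled-positive [] m sp = subst (λ q → 0ℚ ℚ.< 1ℚ * q)
      (sym (guard-yes (deg m ℕ.≟ 0) (trans (deg≡∑ᴹ m) (sp (λ i e → suc i ℕ.* e) (λ i → ℕ.*-zeroʳ (suc i))))))
      (ℚ.positive⁻¹ (1ℚ * 1ℚ))
    spelled-positive {I} {J} {(i , suc d) ∷ bs} ((d>0 , d≤n) ∷ ok) m sp = subst (0ℚ ℚ.<_)
      (sym (∑-*ˡ (factorizations m) s term))
      (∑-positive {xs = factorizations m} {λ kl → s * term kl}
        (λ kl∈ → outcome-nonneg sp (summand-outcome gen (d>0 , d≤n) (∏-outcome gen ok) m kl∈))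
        (subst (λ m → (scale (suc i) f.x , f.rest) ∈ factorizations m) f.x⊞rest≡ (factorizations-∈⁺ (scale (suc i) f.x) f.rest))
        (subst (0ℚ ℚ.<_) (trans (sym (ε-cancel gen (ε ^^ length bs) _)) (cong (λ q → s * (q * coeff (∏ᴮ F bs) f.rest)) (sym coeff≡ε)))
          (spelled-positive ok f.rest rest-spells)))
      where
      s : ℚ
      s = ε ^^ length ((i , suc d) ∷ bs)

      term : Monomial I J × Monomial I J → ℚ
      term kl = coeff (dilations F i (suc d)) (proj₁ kl) * coeff (∏ᴮ F bs) (proj₂ kl)

      -- The first block counts itself, so testing the spelling with `occurs d i` shows that `m`
      -- contains a matching power.
      module f = Factor (factor {u} (u-0 gen) d i m (subst (0 <_) (sym (sp (occurs d i) (occurs-vanishing d i)))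
        (subst (λ b → 0 < ind b ℕ.+ ∑ᴮ (occurs d i) bs) (sym (cong₂ _∧_ (≡ᵇ-refl d) (≡ᵇ-refl i))) (s≤s z≤n))))

      rest-spells : Spells f.rest bs
      rest-spells h h0 = ℕ.+-cancelˡ-≡ (h d (suc i)) _ _ (trans (sym (f.∑-rest h h0)) (sp h h0))

      coeff≡ε : coeff (dilations F i (suc d)) (scale (suc i) f.x) ≡ ε
      coeff≡ε = trans (coeff-scale (F (suc d)) (suc i) f.x) (trans
        (guard-yes (deg f.x ℕ.≟ suc d) (trans (deg≡∑ᴹ f.x)
          (trans (f.∑-x (λ i e → suc i ℕ.* e) (λ i → ℕ.*-zeroʳ (suc i))) (ℕ.*-identityʳ (suc d)))))
        (trans f.uᴹ-x (u-1 gen)))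

-- The column is a new one, so that the factor x_{1+d,j}^r has no indeterminate in common with m.
adjoin : ℕ → ℕ → Monomial I J → Monomial I (suc J)
adjoin d       r []      = []
adjoin zero    r (q ∷ m) = (r ∷ q) ∷ Vec.map (0 ∷_) m
adjoin (suc d) r (q ∷ m) = (0 ∷ q) ∷ adjoin d r m

∑ᴹ-adjoin : ∀ {h} → Vanishing h → ∀ d r (m : Monomial I J) → d < I → ∑ᴹ h (adjoin d r m) ≡ h d r ℕ.+ ∑ᴹ h m
∑ᴹ-adjoin {h = h} h0 zero    r (q ∷ m) _         = trans (cong (h 0 r ℕ.+ ∑ʳ (h 0) q ℕ.+_) (tail (h0 ∘ suc) m)) (ℕ.+-assoc (h 0 r) _ _)
  where
  tail : ∀ {I J h} → Vanishing h → (m : Monomial I J) → ∑ᴹ h (Vec.map (0 ∷_) m) ≡ ∑ᴹ h m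
  tail h0 []      = refl
  tail {h = h} h0 (q ∷ m) = cong₂ ℕ._+_ (cong (ℕ._+ ∑ʳ (h 0) q) (h0 0)) (tail (h0 ∘ suc) m)
∑ᴹ-adjoin {h = h} h0 (suc d) r (q ∷ m) (s≤s d<I) = trans
  (cong₂ ℕ._+_ (cong (ℕ._+ ∑ʳ (h 0) q) (h0 0)) (∑ᴹ-adjoin (h0 ∘ suc) d r m d<I))
  (ℕ+.x∙yz≈y∙xz (∑ʳ (h 0) q) (h (suc d) r) _)

-- All block degrees are at most n, so n rows suffice; every block receives a column of its own.
spell : ∀ {bs} → Admissible n bs → ∃₂ λ J (m : Monomial n J) → Spells m bs
spell {n} [] = 0 , Vec.replicate n [] , λ h h0 → ∑ᴹ-replicate h0 n
spell {n} {(i , suc d) ∷ bs} ((_ , d<n) ∷ ok) with spell ok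
... | J , m , sp = suc J , adjoin d (suc i) m , λ h h0 →
  trans (∑ᴹ-adjoin h0 d (suc i) m d<n) (cong (h d (suc i) ℕ.+_) (sp h h0))

-- Recovering a type from its blocks

blockList : Vec (List ℕ) n → List Block
blockList []       = []
blockList (ds ∷ w) = List.map (0 ,_) ds ++ List.map (Product.map₁ suc) (blockList w)

blocks≋∏ : ∀ (G : ℕ → ℕ → Series) (w : Vec (List ℕ) n) →
           blocks G w ≋ ∏ (List.map (λ b → G (proj₁ b) (proj₂ b)) (blockList w))
blocks≋∏ G []       = ⊙.refl
blocks≋∏ G (ds ∷ w) = ⊙.trans (⊙.∙-congˡ (blocks≋∏ (G ∘ suc) w)) (⊙.sym (⊙.trans
  (⊙.reflexive (cong ∏ (trans (List.map-++ g (List.map (0 ,_) ds) (List.map (Product.map₁ suc) (blockList w)))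
    (cong₂ _++_ (sym (List.map-∘ ds)) (sym (List.map-∘ (blockList w)))))))
  (∏-++ (List.map (G 0) ds) (List.map (λ b → G (suc (proj₁ b)) (proj₂ b)) (blockList w)))))
  where
  g : Block → Series
  g b = G (proj₁ b) (proj₂ b)

∑ⱽ : (ℕ → ℕ → ℕ) → Vec (List ℕ) n → ℕ
∑ⱽ H []       = 0
∑ⱽ H (ds ∷ w) = sum (List.map (H 0) ds) ℕ.+ ∑ⱽ (H ∘ suc) w

∑ⱽ-blockList : ∀ H (w : Vec (List ℕ) n) → sum (List.map (λ b → H (proj₁ b) (proj₂ b)) (blockList w)) ≡ ∑ⱽ H w
∑ⱽ-blockList H []       = refl
∑ⱽ-blockList H (ds ∷ w) = trans
  (cong sum (trans (List.map-++ g (List.map (0 ,_) ds) (List.map (Product.map₁ suc) (blockList w)))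
    (cong₂ _++_ (sym (List.map-∘ ds)) (sym (List.map-∘ (blockList w))))))
  (trans (sum-++ (List.map (H 0) ds) _) (cong (sum (List.map (H 0) ds) ℕ.+_) (∑ⱽ-blockList (H ∘ suc) w)))
  where
  g : Block → ℕ
  g b = H (proj₁ b) (proj₂ b)

typeBlocks : Typ n → List Block
typeBlocks τ = blockList (Vec.map parts (value τ))

typeBlocks-positive : ∀ (mus : Vec Partition n) → All (λ b → 0 < proj₂ b) (blockList (Vec.map parts mus))
typeBlocks-positive []         = []
typeBlocks-positive (mu ∷ mus) =
  All.++⁺ (All.map⁺ (proj₁ (isPartition mu))) (All.map⁺ (typeBlocks-positive mus))

sum-map-* : ∀ c xs → sum (List.map (c ℕ.*_) xs) ≡ c ℕ.* sum xs
sum-map-* c []       = sym (ℕ.*-zeroʳ c)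
sum-map-* c (x ∷ xs) = trans (cong (c ℕ.* x ℕ.+_) (sum-map-* c xs)) (sym (ℕ.*-distribˡ-+ c x (sum xs)))

weight≡∑ⱽ : ∀ (mus : Vec Partition n) → weight mus ≡ ∑ⱽ (λ i d → suc i ℕ.* d) (Vec.map parts mus)
weight≡∑ⱽ = go suc
  where
  go : ∀ {n} (w : ℕ → ℕ) (mus : Vec Partition n) →
       sum (List.map (λ i → w (toℕ i) ℕ.* size (lookup mus i)) (allFin n)) ≡ ∑ⱽ (λ i d → w i ℕ.* d) (Vec.map parts mus)
  go w []         = refl
  go w (mu ∷ mus) = cong₂ ℕ._+_ (sym (sum-map-* (w 0) (parts mu)))
    (trans (cong sum (map-tail-allFin (λ i → w (toℕ i) ℕ.* size (lookup (mu ∷ mus) i)))) (go (w ∘ suc) mus))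

≤-sum-map : ∀ (f : A → ℕ) xs {N} → sum (List.map f xs) ≤ N → All (λ x → f x ≤ N) xs
≤-sum-map f []       _  = []
≤-sum-map f (x ∷ xs) le = ℕ.m+n≤o⇒m≤o (f x) le ∷ ≤-sum-map f xs (ℕ.m+n≤o⇒n≤o (f x) le)

typeBlocks-admissible : ∀ (τ : Typ n) → Admissible n (typeBlocks τ)
typeBlocks-admissible {n} τ@(mus , [ weight≡n ]) = All.zip (typeBlocks-positive mus ,
  All.map (λ {b} le → ℕ.≤-trans (ℕ.m≤n*m (proj₂ b) (suc (proj₁ b))) le)
    (≤-sum-map (λ b → suc (proj₁ b) ℕ.* proj₂ b) (typeBlocks τ) (ℕ.≤-reflexive (trans
      (∑ⱽ-blockList (λ i d → suc i ℕ.* d) (Vec.map parts mus))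
      (trans (sym (weight≡∑ⱽ mus)) (recompute (weight mus ℕ.≟ n) weight≡n))))))

-- The indicator of the first entry of `xs` locates it in `ys`; removing it on both sides preserves
-- the hypothesis.
sums-↭ : ∀ xs ys → (∀ (K : ℕ → ℕ) → sum (List.map K xs) ≡ sum (List.map K ys)) → xs ↭ ys
sums-↭ []       []       _  = ↭-refl
sums-↭ []       (y ∷ ys) eq = contradiction (eq (λ _ → 1)) λ ()
sums-↭ (x ∷ xs) ys       eq with ∈-∃++ (occurs⇒∈ ys (subst (0 <_) (eq K) (subst (λ b → 0 < ind b ℕ.+ sum (List.map K xs)) (sym (≡ᵇ-refl x)) (s≤s z≤n))))
  where
  K : ℕ → ℕ
  K y = ind (x ℕ.≡ᵇ y)

  occurs⇒∈ : ∀ ys → 0 < sum (List.map K ys) → x ∈ ys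
  occurs⇒∈ (y ∷ ys) 0< with x ℕ.≡ᵇ y in x≡ᵇy
  ... | true  = here (≡ᵇ-true x≡ᵇy)
  ... | false = there (occurs⇒∈ ys 0<)
... | as , bs , refl = ↭-trans (prep x (sums-↭ xs (as ++ bs) λ K → ℕ.+-cancelˡ-≡ (K x) _ _
        (trans (eq K) (sum-↭ (Perm.map⁺ K (Perm.shift x as bs))))))
      (↭-sym (Perm.shift x as bs))

-- Test functions supported on the first index determine the first partition, as sorted permutations
-- of each other are equal; those vanishing there give the induction hypothesis.
∑ⱽ-injective : ∀ (mus nus : Vec Partition n) →
  (∀ H → ∑ⱽ H (Vec.map parts mus) ≡ ∑ⱽ H (Vec.map parts nus)) → mus ≡ nus
∑ⱽ-injective []         []         _  = refl
∑ⱽ-injective (mu ∷ mus) (nu ∷ nus) eq = cong₂ _∷_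
  (value-injective (sorted-↭⇒≡ (proj₂ (isPartition mu)) (proj₂ (isPartition nu)) (sums-↭ (parts mu) (parts nu) λ K →
    trans (sym (trans (cong (sum (List.map K (parts mu)) ℕ.+_) (∑ⱽ-0 (Vec.map parts mus))) (ℕ.+-identityʳ _)))
      (trans (eq (first K)) (trans (cong (sum (List.map K (parts nu)) ℕ.+_) (∑ⱽ-0 (Vec.map parts nus))) (ℕ.+-identityʳ _))))))
  (∑ⱽ-injective mus nus λ H → trans (cong (ℕ._+ ∑ⱽ H (Vec.map parts mus)) (sym (sum-0 (parts mu))))
    (trans (eq (others H)) (cong (ℕ._+ ∑ⱽ H (Vec.map parts nus)) (sum-0 (parts nu)))))
  where
  first : (ℕ → ℕ) → ℕ → ℕ → ℕ
  first K zero    = K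
  first K (suc _) = λ _ → 0

  others : (ℕ → ℕ → ℕ) → ℕ → ℕ → ℕ
  others H zero    = λ _ → 0
  others H (suc i) = H i

  sum-0 : ∀ xs → sum (List.map {A = ℕ} (λ _ → 0) xs) ≡ 0
  sum-0 []       = refl
  sum-0 (x ∷ xs) = sum-0 xs

  ∑ⱽ-0 : ∀ {n} (w : Vec (List ℕ) n) → ∑ⱽ (λ _ _ → 0) w ≡ 0
  ∑ⱽ-0 []       = refl
  ∑ⱽ-0 (ds ∷ w) = cong₂ ℕ._+_ (sum-0 ds) (∑ⱽ-0 w)

spells-injective : ∀ (ρ τ : Typ n) {m : Monomial I J} → Spells m (typeBlocks ρ) → Spells m (typeBlocks τ) → ρ ≡ τ
spells-injective {n = n} ρ τ {m} spρ spτ = value-injective (∑ⱽ-injective (value ρ) (value τ) λ H →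
  trans (sym (∑ᴮ≡∑ⱽ H ρ)) (trans (sym (spρ (curried H) (λ _ → refl))) (trans (spτ (curried H) (λ _ → refl)) (∑ᴮ≡∑ⱽ H τ))))
  where
  -- `Spells` takes the degree first, counted from 0, and the exponent second; the clause for
  -- exponent 0 provides the required vanishing.
  curried : (ℕ → ℕ → ℕ) → ℕ → ℕ → ℕ
  curried H d zero    = 0
  curried H d (suc i) = H i (suc d)

  ∑ᴮ≡∑ⱽ : ∀ H (τ : Typ n) → ∑ᴮ (curried H) (typeBlocks τ) ≡ ∑ⱽ H (Vec.map parts (value τ))
  ∑ᴮ≡∑ⱽ H τ = trans (cong sum (List.map-cong-local (All.map (λ { {i , suc d} _ → refl }) (typeBlocks-positive (value τ)))))
    (∑ⱽ-blockList H (Vec.map parts (value τ)))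

-- Uniqueness of the expansion

module _ {u ε} (gen : IsGenerating u ε) {F : ℕ → Series} (graded≋F : ∀ d → graded (uᴹ u) d ≋ F d) where

  ⟨⟩≋∏ᴮ : ∀ (τ : Typ n) → F ⟨ τ ⟩ ≋ ∏ᴮ (graded (uᴹ u)) (typeBlocks τ)
  ⟨⟩≋∏ᴮ τ = ⊙.trans (⟨⟩≋blocks F τ) (⊙.trans
    (blocks-cong (λ i d → [x^]-cong (suc i) (⊙.sym (graded≋F d))) (Vec.map parts (value τ)))
    (blocks≋∏ (dilations (graded (uᴹ u))) (Vec.map parts (value τ))))

  -- The monomial spelled by ρ occurs in F ⟨ ρ ⟩, and otherwise only in F ⟨ τ ⟩ with V ρ < V τ.
  independent : ∀ (c : Typ n → ℚ) → (∀ {I J} (m : Monomial I J) → coeff (linearCombination F c) m ≡ 0ℚ) → ∀ ρ → c ρ ≡ 0ℚ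
  independent {n} c vanishes ρ = downward (suc (Vmax ∸ V ρ)) ρ ℕ.≤-refl
    where
    V : Typ n → ℕ
    V τ = ∑ᴮ (v (suc n)) (typeBlocks τ)

    Vmax : ℕ
    Vmax = sum (List.map V (types n))

    V≤Vmax : ∀ τ → V τ ≤ Vmax
    V≤Vmax τ = All.lookup (≤-sum-map V (types n) ℕ.≤-refl) (complete (finite-Typ n) τ)

    -- Types of larger measure come first, since their series may contain the monomial of `ρ` too;
    -- `Vmax` bounds the measures, so `Vmax ∸ V ρ` decreases.
    downward : ∀ k ρ → Vmax ∸ V ρ < k → c ρ ≡ 0ℚ
    downward (suc k) ρ (s≤s Vmax∸Vρ≤k) with spell (typeBlocks-admissible ρ)
    ... | J , m , sp = cancel (begin
      c ρ * coeff (F ⟨ ρ ⟩) m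
        ≡⟨ ∑-δ (λ τ → c τ * coeff (F ⟨ τ ⟩) m) (unique (finite-Typ n)) (complete (finite-Typ n) ρ) (ρ ≟ᵀ_) ⟨
      ∑[ τ ∈ types n ] guard (does (ρ ≟ᵀ τ)) (c τ * coeff (F ⟨ τ ⟩) m)
        ≡⟨ ∑-cong (types n) (λ τ → only τ (ρ ≟ᵀ τ)) ⟩
      coeff (linearCombination F c) m
        ≡⟨ vanishes m ⟩
      0ℚ ∎)
      where
      open ≡-Reasoning

      only : ∀ τ (ρ≟τ : Dec (ρ ≡ τ)) → guard (does ρ≟τ) (c τ * coeff (F ⟨ τ ⟩) m) ≡ c τ * coeff (F ⟨ τ ⟩) m
      only τ (yes _)  = refl
      only τ (no ρ≢τ) with ∏-outcome gen (typeBlocks-admissible τ) m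
      ... | zero ∏≡0  = sym (trans (cong (c τ *_) (trans (at (⟨⟩≋∏ᴮ τ) m) ∏≡0)) (ℚ.*-zeroʳ (c τ)))
      ... | below lt  = sym (trans (cong (_* coeff (F ⟨ τ ⟩) m) (downward k τ (ℕ.<-≤-trans
              (ℕ.∸-monoʳ-< (subst (_< V τ) (sp (v (suc n)) (v-vanishing (suc n))) lt) (V≤Vmax τ)) Vmax∸Vρ≤k)))
            (ℚ.*-zeroˡ (coeff (F ⟨ τ ⟩) m)))
      ... | tight spτ _ = contradiction (spells-injective ρ τ {m} sp spτ) ρ≢τ

      s : ℚ
      s = ε ^^ length (typeBlocks ρ)

      0<sF : 0ℚ ℚ.< s * coeff (F ⟨ ρ ⟩) m
      0<sF = subst (λ q → 0ℚ ℚ.< s * q) (sym (at (⟨⟩≋∏ᴮ ρ) m)) (spelled-positive gen (typeBlocks-admissible ρ) m sp)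

      -- Scaling by `s` makes the coefficient of the spelled monomial positive, hence invertible.
      cancel : c ρ * coeff (F ⟨ ρ ⟩) m ≡ 0ℚ → c ρ ≡ 0ℚ
      cancel eq = begin
        c ρ                 ≡⟨ ℚ.*-identityʳ (c ρ) ⟨
        c ρ * 1ℚ            ≡⟨ cong (c ρ *_) (ℚ.*-inverseʳ t) ⟨
        c ρ * (t * ℚ.1/ t)  ≡⟨ ℚ.*-assoc (c ρ) t (ℚ.1/ t) ⟨
        c ρ * t * ℚ.1/ t    ≡⟨ cong (_* ℚ.1/ t) (trans (ℚ*.x∙yz≈y∙xz (c ρ) s (coeff (F ⟨ ρ ⟩) m)) (trans (cong (s *_) eq) (ℚ.*-zeroʳ s))) ⟩
        0ℚ * ℚ.1/ t         ≡⟨ ℚ.*-zeroˡ (ℚ.1/ t) ⟩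
        0ℚ                  ∎
        where
        t : ℚ
        t = s * coeff (F ⟨ ρ ⟩) m
        instance
          t≢0 : ℚ.NonZero t
          t≢0 = ℚ.pos⇒nonZero t {{ℚ.positive 0<sF}}

  hasCoefficient : ∀ (σ τ : Typ n) → HasCoefficient F (P ⟨ σ ⟩) τ (tabloidSum ε σ τ)
  hasCoefficient {n} σ τ = record
    { expansion = tabloidSum ε σ , (λ m → at (P-expansion gen graded≋F σ) m) , refl
    ; unique    = λ c P≈ → ℚ-Ring.x∙y⁻¹≈ε⇒x≈y (c τ) (tabloidSum ε σ τ)
        (independent (λ ρ → c ρ + - tabloidSum ε σ ρ) (difference-vanishes c P≈) τ)
    }
    where
    difference-vanishes : ∀ c → P ⟨ σ ⟩ ≈ linearCombination F c → ∀ {I J} (m : Monomial I J) →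
      coeff (linearCombination F (λ ρ → c ρ + - tabloidSum ε σ ρ)) m ≡ 0ℚ
    difference-vanishes c P≈ m = begin
      ∑[ ρ ∈ types n ] ((c ρ + - tabloidSum ε σ ρ) * coeff (F ⟨ ρ ⟩) m)
        ≡⟨ ∑-cong (types n) (λ ρ → trans (ℚ.*-distribʳ-+ (coeff (F ⟨ ρ ⟩) m) (c ρ) (- tabloidSum ε σ ρ))
             (cong (λ q → c ρ * coeff (F ⟨ ρ ⟩) m + q) (sym (ℚ.neg-distribˡ-* (tabloidSum ε σ ρ) (coeff (F ⟨ ρ ⟩) m))))) ⟩
      ∑[ ρ ∈ types n ] (c ρ * coeff (F ⟨ ρ ⟩) m + - (tabloidSum ε σ ρ * coeff (F ⟨ ρ ⟩) m))
        ≡⟨ ∑-+ (types n) (λ ρ → c ρ * coeff (F ⟨ ρ ⟩) m) (λ ρ → - (tabloidSum ε σ ρ * coeff (F ⟨ ρ ⟩) m)) ⟩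
      coeff (linearCombination F c) m + ∑[ ρ ∈ types n ] (- (tabloidSum ε σ ρ * coeff (F ⟨ ρ ⟩) m))
        ≡⟨ cong₂ _+_ (sym (P≈ m)) (trans (∑-neg (types n) (λ ρ → tabloidSum ε σ ρ * coeff (F ⟨ ρ ⟩) m))
             (cong -_ (sym (at (P-expansion gen graded≋F σ) m)))) ⟩
      coeff (P ⟨ σ ⟩) m + - coeff (P ⟨ σ ⟩) m
        ≡⟨ ℚ.+-inverseʳ (coeff (P ⟨ σ ⟩) m) ⟩
      0ℚ ∎
      where open ≡-Reasoning

-- The numbers |j - k| and j + k have the same parity; lowering both j and k by one changes two
-- signs on the right.
alternating-⊖ : ∀ j k → alternating ℤ.∣ j ⊖ k ∣ ≡ alternating k * alternating j
alternating-⊖ zero    zero    = refl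
alternating-⊖ zero    (suc k) = sym (ℚ.*-identityʳ (alternating (suc k)))
alternating-⊖ (suc j) zero    = sym (ℚ.*-identityˡ (alternating (suc j)))
alternating-⊖ (suc j) (suc k) = begin
  alternating ℤ.∣ suc j ⊖ suc k ∣           ≡⟨ cong (alternating ∘ ℤ.∣_∣) (ℤ.[1+m]⊖[1+n]≡m⊖n j k) ⟩
  alternating ℤ.∣ j ⊖ k ∣                   ≡⟨ alternating-⊖ j k ⟩
  alternating k * alternating j             ≡⟨ ℚ-Ring.-‿involutive (alternating k * alternating j) ⟨
  - - (alternating k * alternating j)       ≡⟨ cong -_ (ℚ.neg-distribʳ-* (alternating k) (alternating j)) ⟩
  - (alternating k * - alternating j)       ≡⟨ ℚ.neg-distribˡ-* (alternating k) (- alternating j) ⟩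
  - alternating k * - alternating j         ∎
  where open ≡-Reasoning

open import Data.Integer.Base using (+_; _-_)

signᴴ : ∀ (σ τ : Typ n) → -1^ (+ ℓ τ - + ℓ σ) ≡ sign 1ℚ σ τ
signᴴ σ τ = trans (cong (alternating ∘ ℤ.∣_∣) (ℤ.m-n≡m⊖n (ℓ τ) (ℓ σ)))
  (trans (alternating-⊖ (ℓ τ) (ℓ σ)) (cong (_* alternating (ℓ τ)) (sym (-1^^ (ℓ σ)))))

signᴱ : ∀ (σ τ : Typ n) → -1^ (+ ℓ τ) ≡ sign (- 1ℚ) σ τ
signᴱ σ τ = sym (trans (cong (_* alternating (ℓ τ)) (1^^ (ℓ σ))) (ℚ.*-identityˡ (alternating (ℓ τ))))

tabloidSum≡ : ∀ ε s (σ τ : Typ n) → s ≡ sign ε σ τ → tabloidSum ε σ τ ≡ ∑[ T ∈ 𝒫𝒯ˢⁱᵐᵖ σ τ ] (s * fromℕ (𝔏 T))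
tabloidSum≡ ε s σ τ refl = refl

theorem37 : ∀ (n : ℕ) (σ τ : Typ n) →
    HasCoefficient H (P ⟨ σ ⟩) τ (∑[ T ∈ 𝒫𝒯ˢⁱᵐᵖ σ τ ] (-1^ (+ ℓ τ - + ℓ σ) * fromℕ (𝔏 T)))
    × HasCoefficient E (P ⟨ σ ⟩) τ (∑[ T ∈ 𝒫𝒯ˢⁱᵐᵖ σ τ ] (-1^ (+ ℓ τ) * fromℕ (𝔏 T)))
theorem37 n σ τ =
  subst (HasCoefficient H (P ⟨ σ ⟩) τ) (tabloidSum≡ 1ℚ _ σ τ (signᴴ σ τ)) (hasCoefficient generatingᴴ gradedᴴ σ τ) ,
  subst (HasCoefficient E (P ⟨ σ ⟩) τ) (tabloidSum≡ (- 1ℚ) _ σ τ (signᴱ σ τ)) (hasCoefficient generatingᴱ gradedᴱ σ τ)
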